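{- For each fixed integer $k \geq 0$, the decision problem $\textsc{Hanano}$ (given a level of the Hanano Puzzle, decide whether it is solvable), restricted to levels containing at most $k$ movable blocks, is in $\mathsf{NP}$.
   Context: The Hanano Puzzle is a one-player game on a finite $n\times m$ 2D grid. A level consists of: immovable gray blocks (walls); flowers, each colored red, blue or yellow and attached to immovable blocks; movable gray blocks; and movable colored blocks (red, blue or yellow), each rectangular and marked on exactly one of its four sides. Movable blocks are the movable gray blocks and the colored blocks. The player moves a movable block one cell left or right (if there is room). The game has gravity: any movable block that is not supported from below falls until it is supported; blocks resting on a moving block are carried along. When an unbloomed colored block comes into contact with a flower of the same color (or with the flower of an already bloomed block of the same color), it blooms: a flower emerges from its marked side, occupying the adjacent cell(s) and becoming part of the block; blocks in the way are pushed along if there is space, and a bloom may trigger further blooms. Blooming is irreversible. A level is solvable if there is a sequence of moves after which every colored block is bloomed. $\textsc{Hanano}$ denotes the set of solvable levels. -}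

module Defs where

open import Data.Bool.Base using (Bool; true; false)
open import Data.Fin.Base using (Fin; zero; suc)
open import Data.Integer.Base as ℤ using (ℤ; +_; -[1+_])
open import Data.List.Base as List
  using (List; []; _∷_; [_]; _++_; concatMap; cartesianProduct; length; replicate; upTo)
open import Data.List.Membership.Propositional using (_∈_; _∉_)
open import Data.List.Relation.Unary.Any using (Any)
open import Data.Maybe.Base using (Maybe; just; nothing; _>>=_)
open import Data.Nat.Base as ℕ using (ℕ; zero; suc; _≤_; _<_)
open import Data.Product.Base using (Σ-syntax; ∃; ∃-syntax; _×_; _,_)
open import Data.Sum.Base using (_⊎_; inj₁; inj₂)
open import Data.Vec.Base as Vec using (Vec; []; _∷_; lookup; _[_]%=_)
open import Function.Bundles using (_⇔_; _↔_)
open import Relation.Binary.Construct.Closure.ReflexiveTransitive using (Star)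
open import Relation.Binary.PropositionalEquality using (_≡_; _≢_)
open import Relation.Nullary.Negation using (¬_)

------------------------------------------------------------------------
-- Polynomials with natural coefficients, as expressions in one variable

data Polynomial : Set where
  con     : ℕ → Polynomial
  var     : Polynomial
  _⊕_ _⊗_ : Polynomial → Polynomial → Polynomial

⟦_⟧ : Polynomial → ℕ → ℕ
⟦ con c ⟧ n = c
⟦ var   ⟧ n = n
⟦ p ⊕ q ⟧ n = ⟦ p ⟧ n ℕ.+ ⟦ q ⟧ n
⟦ p ⊗ q ⟧ n = ⟦ p ⟧ n ℕ.* ⟦ q ⟧ n

------------------------------------------------------------------------
-- Deterministic multitape Turing machines

Finite : Set → Set
Finite A = ∃[ n ] (A ↔ Fin n)

data Symbol (W : Set) : Set where
  blank : Symbol W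
  bit   : Bool → Symbol W
  work  : W → Symbol W

data HeadMove : Set where
  goLeft stay goRight : HeadMove

-- A tape is infinite in both directions.  Both lists start at the cell next
-- to the head; all cells beyond them are blank.
record Tape (W : Set) : Set where
  constructor tape
  field
    before  : List (Symbol W)
    scanned : Symbol W
    after   : List (Symbol W)

open Tape public

module _ {W : Set} where

  moveHead : HeadMove → Tape W → Tape W
  moveHead stay    t                   = t
  moveHead goLeft  (tape []       a r) = tape [] blank (a ∷ r)
  moveHead goLeft  (tape (b ∷ l)  a r) = tape l b (a ∷ r)
  moveHead goRight (tape l a [])       = tape (a ∷ l) blank []
  moveHead goRight (tape l a (b ∷ r))  = tape (a ∷ l) b r

  update : Symbol W × HeadMove → Tape W → Tape W
  update (a , m) t = moveHead m (record t { scanned = a })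

  blankTape : Tape W
  blankTape = tape [] blank []

  inputTape : List Bool → Tape W
  inputTape []       = blankTape
  inputTape (b ∷ bs) = tape [] (bit b) (List.map bit bs)

data Action (W Q : Set) (t : ℕ) : Set where
  halt     : Bool → Action W Q t
  continue : Q → Vec (Symbol W × HeadMove) t → Action W Q t

-- The first two tapes hold the two inputs of the machine.
record TuringMachine : Set₁ where
  field
    extraTapes    : ℕ
    Work          : Set
    Control       : Set
    finiteWork    : Finite Work
    finiteControl : Finite Control
    start         : Control

  tapes : ℕ
  tapes = 2 ℕ.+ extraTapes

  field
    transition : Control → Vec (Symbol Work) tapes → Action Work Control tapes

  runFrom : ℕ → Control → Vec (Tape Work) tapes → Maybe Bool
  runFrom zero       q ts = nothing
  runFrom (suc fuel) q ts with transition q (Vec.map scanned ts)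
  ... | halt b        = just b
  ... | continue q′ w = runFrom fuel q′ (Vec.zipWith update w ts)

  -- The verdict on the inputs x and u, if reached within the given time.
  run : ℕ → List Bool → List Bool → Maybe Bool
  run time x u =
    runFrom time start (inputTape x ∷ inputTape u ∷ Vec.replicate extraTapes blankTape)

-- Membership in NP: a polynomial-time verifier with polynomially long
-- certificates.
record NP (A : List Bool → Set) : Set₁ where
  field
    verifier          : TuringMachine
    timeBound         : Polynomial
    certificateBound  : Polynomial

  open TuringMachine verifier

  verdict : List Bool → List Bool → Maybe Bool
  verdict x u = run (⟦ timeBound ⟧ (length x ℕ.+ length u)) x u

  field
    halts    : ∀ x u → ∃[ b ] (verdict x u ≡ just b)
    verifies : ∀ x → A x ⇔
      (∃[ u ] (length u ≤ ⟦ certificateBound ⟧ (length x) × verdict x u ≡ just true))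

------------------------------------------------------------------------
-- Levels of the Hanano Puzzle

data Colour : Set where
  red blue yellow : Colour

data Direction : Set where
  up down left right : Direction

data Horizontal : Direction → Set where
  left  : Horizontal left
  right : Horizontal right

opposite : Direction → Direction
opposite up    = down
opposite down  = up
opposite left  = right
opposite right = left

-- (row , column), with row 0 at the top and column 0 at the left.  Cells
-- outside the grid are included, so that stepping is total and invertible.
Cell : Set
Cell = ℤ × ℤ

step : Direction → Cell → Cell
step up    (r , c) = ℤ.pred r , c
step down  (r , c) = ℤ.suc r , c
step left  (r , c) = r , ℤ.pred c
step right (r , c) = r , ℤ.suc c

_+ᶜ_ : Cell → Cell → Cell
(r , c) +ᶜ (r′ , c′) = r ℤ.+ r′ , c ℤ.+ c′

data Tile : Set where
  empty wall : Tile
  flower     : Colour → Tile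

-- A movable block at its initial place.  A gray block may have any polyomino
-- shape and lists its cells; a coloured block is a rectangle with a marked side.
data Block : Set where
  gray     : List (ℕ × ℕ) → Block
  coloured : Colour → Direction → (top left height width : ℕ) → Block

record Level : Set where
  field
    rows cols : ℕ
    grid      : Vec (Vec Tile cols) rows
    blocks    : List Block

cell : ℕ × ℕ → Cell
cell (r , c) = + r , + c

footprint : Block → List Cell
footprint (gray ps)              = List.map cell ps
footprint (coloured _ _ t l h w) =
  List.map cell
    (cartesianProduct (List.map (t ℕ.+_) (upTo h)) (List.map (l ℕ.+_) (upTo w)))

mark : Block → Maybe (Colour × Direction)
mark (gray _)               = nothing
mark (coloured c d _ _ _ _) = just (c , d)

_‼_ : ∀ {A : Set} {n} → Vec A n → ℤ → Maybe A
xs       ‼ -[1+ _ ]  = nothing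
[]       ‼ (+ _)     = nothing
(x ∷ _)  ‼ (+ zero)  = just x
(_ ∷ xs) ‼ (+ suc n) = xs ‼ (+ n)

-- The nonempty connected sets of cells, grown one cell at a time; the list
-- has the most recently attached cell first.
data Polyomino : List Cell → Set where
  single : ∀ p → Polyomino [ p ]
  attach : ∀ {p ps} → Any (λ q → ∃[ d ] (q ≡ step d p)) ps →
           Polyomino ps → Polyomino (p ∷ ps)

data ProperShape : Block → Set where
  gray     : ∀ {ps} → Polyomino (List.map cell ps) → ProperShape (gray ps)
  coloured : ∀ {c d t l h w} → 0 < h → 0 < w → ProperShape (coloured c d t l h w)

record BlockState : Set where
  constructor blockState
  field
    displacement : ℤ × ℤ
    bloomed      : Bool

open BlockState public

module Game (L : Level) where
  open Level L

  Index : Set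
  Index = Fin (length blocks)

  block : Index → Block
  block = List.lookup blocks

  tileAt : Cell → Maybe Tile
  tileAt (r , c) = (grid ‼ r) >>= (_‼ c)

  -- Not a wall, not a flower of the grid, and not outside the grid; movable
  -- blocks are ignored.
  Free : Cell → Set
  Free p = tileAt p ≡ just empty

  record WellFormed : Set where
    field
      shapes   : ∀ i → ProperShape (block i)
      placed   : ∀ i {p} → p ∈ footprint (block i) → Free p
      disjoint : ∀ i j {p} → p ∈ footprint (block i) → p ∈ footprint (block j) → i ≡ j
      attached : ∀ p c → tileAt p ≡ just (flower c) → ∃[ d ] (tileAt (step d p) ≡ just wall)

  State : Set
  State = Vec BlockState (length blocks)

  initial : State
  initial = Vec.replicate _ (blockState (+ 0 , + 0) false)

  shift : Direction → BlockState → BlockState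
  shift d b = record b { displacement = step d (displacement b) }

  module _ (s : State) where

    -- The cells of block i without the flower it may have grown.
    Body : Index → Cell → Set
    Body i p = p ∈ List.map (_+ᶜ displacement (lookup s i)) (footprint (block i))

    -- The cells adjacent to the d-side of the body of block i.
    Beside : Index → Direction → Cell → Set
    Beside i d p = ¬ Body i p × Body i (step (opposite d) p)

    Petal : Index → Colour → Cell → Set
    Petal i c p =
      bloomed (lookup s i) ≡ true × ∃[ d ] (mark (block i) ≡ just (c , d) × Beside i d p)

    Occupies : Index → Cell → Set
    Occupies i p = Body i p ⊎ (∃[ c ] Petal i c p)

    FlowerAt : Colour → Cell → Set
    FlowerAt c p = tileAt p ≡ just (flower c) ⊎ (∃[ j ] Petal j c p)

    RestsOn : Index → Index → Set
    RestsOn j i = j ≢ i × ∃[ p ] (Occupies j p × Occupies i (step down p))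

    -- Inductive, so that blocks resting only on each other are unsupported.
    data Supported : Index → Set where
      on-grid  : ∀ {i p} → Occupies i p → ¬ Free (step down p) → Supported i
      on-block : ∀ {i j} → RestsOn i j → Supported j → Supported i

    Unsupported : Index → Set
    Unsupported i = ¬ Supported i

    -- The blocks in M can jointly move one cell in direction d.
    Room : (Index → Set) → Direction → Set
    Room M d = ∀ {j p} → M j → Occupies j p →
      Free (step d p) × (∀ {l} → Occupies l (step d p) → M l)

    -- The blocks set in motion when the player moves block i.
    data Carried (i : Index) : Index → Set where
      itself : Carried i i
      rider  : ∀ {j l} → Carried i j → RestsOn l j → Carried i l

    -- The blocks set in motion when a flower emerges from the d-side of block i.
    data Pushed (i : Index) (d : Direction) : Index → Set where
      by-flower : ∀ {j p} → Beside i d p → Occupies j p → Pushed i d j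
      by-block  : ∀ {j l p} → Pushed i d j → Occupies j p → Occupies l (step d p) →
                  Pushed i d l
      rider     : ∀ {j l} → Horizontal d → Pushed i d j → RestsOn l j → l ≢ i →
                  Pushed i d l

    Contact : Index → Colour → Set
    Contact i c = ∃[ p ] ∃[ d ] (Body i p × FlowerAt c (step d p))

    record CanBloom (i : Index) (d : Direction) : Set where
      field
        colour    : Colour
        marked    : mark (block i) ≡ just (colour , d)
        unbloomed : bloomed (lookup s i) ≡ false
        contact   : Contact i colour
        free      : ∀ {p} → Beside i d p → Free p
        unmoved   : ¬ Pushed i d i
        room      : Room (Pushed i d) d

    NoBloom : Set
    NoBloom = ∀ i d → ¬ CanBloom i d

    Settled : Set
    Settled = NoBloom × (∀ i → Supported i)

    AllBloomed : Set
    AllBloomed = ∀ i {c d} → mark (block i) ≡ just (c , d) → bloomed (lookup s i) ≡ true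

  Shifted : (Index → Set) → Direction → State → State → Set
  Shifted M d s s′ = ∀ j →
    (M j → lookup s′ j ≡ shift d (lookup s j)) × (¬ M j → lookup s′ j ≡ lookup s j)

  -- What happens without the player: blooming takes precedence over falling,
  -- and all unsupported blocks fall together, one cell at a time.  If several
  -- blocks can bloom, any of them may be first.
  data _↝_ (s : State) : State → Set where
    bloom : ∀ {i d s′} → CanBloom s i d → Shifted (Pushed s i d) d s s′ →
            s ↝ (s′ [ i ]%= λ b → record b { bloomed = true })
    fall  : ∀ {i s′} → NoBloom s → Unsupported s i → Shifted (Unsupported s) down s s′ →
            s ↝ s′

  Settles : State → State → Set
  Settles s s′ = Star _↝_ s s′ × Settled s′

  Slide : State → State → Set
  Slide s s′ =
    ∃[ i ] ∃[ d ] (Horizontal d × Room s (Carried s i) d × Shifted (Carried s i) d s s′)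

  Move : State → State → Set
  Move s s″ = ∃[ s′ ] (Slide s s′ × Settles s′ s″)

  Solvable : Set
  Solvable = ∃[ s ] ∃[ s′ ] (Settles initial s × Star Move s s′ × AllBloomed s′)

------------------------------------------------------------------------
-- Levels as bit strings: self-delimiting codes, with numbers in unary and one
-- code word per grid cell

encodeℕ : ℕ → List Bool
encodeℕ n = replicate n true ++ [ false ]

encodeList : ∀ {A : Set} → (A → List Bool) → List A → List Bool
encodeList f xs = encodeℕ (length xs) ++ concatMap f xs

encodeColour : Colour → List Bool
encodeColour red    = false ∷ []
encodeColour blue   = true ∷ false ∷ []
encodeColour yellow = true ∷ true ∷ []

encodeDirection : Direction → List Bool
encodeDirection up    = false ∷ false ∷ []
encodeDirection down  = false ∷ true ∷ []
encodeDirection left  = true ∷ false ∷ []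
encodeDirection right = true ∷ true ∷ []

encodeTile : Tile → List Bool
encodeTile empty      = false ∷ []
encodeTile wall       = true ∷ false ∷ []
encodeTile (flower c) = true ∷ true ∷ encodeColour c

encodeBlock : Block → List Bool
encodeBlock (gray ps) =
  false ∷ encodeList (λ (r , c) → encodeℕ r ++ encodeℕ c) ps
encodeBlock (coloured c d t l h w) =
  true ∷ encodeColour c ++ encodeDirection d ++
  encodeℕ t ++ encodeℕ l ++ encodeℕ h ++ encodeℕ w

encode : Level → List Bool
encode L =
  encodeℕ rows ++ encodeℕ cols ++
  concatMap (λ row → concatMap encodeTile (Vec.toList row)) (Vec.toList grid) ++
  encodeList encodeBlock blocks
  where open Level L

-- HANANO restricted to levels with at most k movable blocks.
Hanano≤ : ℕ → List Bool → Set
Hanano≤ k x = Σ[ L ∈ Level ]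
  (encode L ≡ x × Game.WellFormed L × length (Level.blocks L) ≤ k × Game.Solvable L)

{-# OPTIONS --safe #-}
module Submission where

open import Defs
open import Data.Bool.Base using (Bool; true; false; if_then_else_; not; _∨_; T)
open import Data.Empty using (⊥)
import Data.Fin.Base as Fin
open import Data.Fin.Base using (Fin; zero; suc; toℕ; fromℕ<)
import Data.Fin.Properties as Fin
open import Data.Fin.Properties using (+↔⊎; *↔×; 2↔Bool; 1↔⊤; toℕ-injective; toℕ<n; toℕ-fromℕ<)
open import Data.Integer.Base as ℤ using (ℤ) renaming (+_ to pos)
import Data.Integer.Properties as ℤ
import Data.List.Base as List
open import Data.List.Base using (List; []; _∷_; length; _++_; concatMap)
open import Data.List.Membership.Propositional using (_∈_)
open import Data.List.Membership.Propositional.Properties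
  using (∈-map⁺; ∈-map⁻; ∈-cartesianProduct⁺; ∈-cartesianProduct⁻; ∈-upTo⁺; ∈-upTo⁻; ∈-applyUpTo⁺; ∈-applyUpTo⁻)
import Data.List.Properties as List
open import Data.List.Relation.Unary.Any using (Any; here; there)
import Data.Maybe.Base as Maybe
open import Data.Maybe.Base using (Maybe; just; nothing; maybe′)
open import Data.Maybe.Properties using (just-injective)
open import Data.Nat.Base
  using (ℕ; zero; suc; _+_; _*_; _∸_; _≤_; _<_; z≤n; s≤s; _⊔_; _⊓_; pred; _<ᵇ_; _^_)
import Data.Nat.DivMod as ℕ
import Data.Nat.Divisibility as ℕ
import Data.Nat.Properties as ℕ
open import Data.Product.Base using (∃; ∃-syntax; Σ-syntax; _×_; _,_; proj₁; proj₂; map₂)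
open import Data.Product.Function.NonDependent.Propositional using (_×-↔_)
open import Data.Product.Properties using (,-injectiveˡ; ,-injectiveʳ)
open import Data.Sum.Base using (_⊎_; inj₁; inj₂; [_,_]′)
open import Data.Sum.Function.Propositional using (_⊎-↔_)
open import Data.Unit.Base using (⊤; tt)
import Data.Vec.Base as Vec
open import Data.Vec.Base using (Vec; []; _∷_; lookup; zipWith; tabulate)
import Data.Vec.Properties as Vec
import Data.Vec.Relation.Unary.All as All
open import Data.Vec.Relation.Unary.All using (All; []; _∷_)
open import Function.Base using (_∘_; id; case_of_; _∋_)
open import Function.Bundles using (mk↔ₛ′; Inverse; mk⇔)
open import Function.Properties.Inverse using (↔-sym; ↔-trans)
open import Relation.Binary.Construct.Closure.ReflexiveTransitive as Star using (Star; ε; _◅_; _◅◅_)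
open import Relation.Binary.PropositionalEquality
  using (_≡_; _≢_; refl; sym; trans; cong; cong₂; subst; subst₂; module ≡-Reasoning)
open import Relation.Nullary.Decidable using (decidable-stable; True; toWitness)
open import Relation.Nullary.Decidable.Core using (Dec; yes; no)
open import Relation.Nullary.Negation using (¬_; contradiction)
open import Algebra.Properties.AbelianGroup ℤ.+-0-abelianGroup using (∙-cancelʳ)

-- A certificate tabulates, as an array of small numbers, the level, the
-- position of each of its parts in the input, and a sequence of states in which
-- each arises from the previous one by a single bloom, fall or slide.  All this
-- is expressed by a first-order formula with bounded quantifiers over the input
-- and the array: the relations "supported", "carried" and "pushed" are
-- reachability in a graph with at most k vertices, so k rounds define them.  For
-- fixed k there are only polynomially many states, because occupied cells stay
-- free cells of the grid, so a solution without repeated states is short enough.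
-- A formula is evaluated by loops over registers that are bounded by the length
-- of the word, and each register is the head position on a tape of its own.

-- A certificate is arbitrary data and need not come from a level. Since the numbers of an array are
-- decoded by total functions, every array nevertheless describes a level; the formula checks, bit
-- by bit and at guessed positions, that the code of this level is the input. So nothing is parsed,
-- and the level read off an array (soundness) and the level given in advance (completeness) are
-- treated alike through `Describes`. Two limits shape the formulas. Values saturate at
-- `lastPosition`, so formulas avoid sums, reach constants by counting down, and every successor has
-- to be shown exact. Quantifiers over cells range over the grid only, while the game lives on
-- integer cells; they are adequate for `Safe` states, so safety has to be carried along the path
-- together with the meaning of its steps. The relations of the game are not defined as decidable
-- ones; decisions come from evaluating formulas. Formulas are opaque, so that a meaning lemma
-- unfolds only the block it is about.

-- Closure properties of finite types

finite-⊤ : Finite ⊤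
finite-⊤ = 1 , ↔-sym 1↔⊤

finite-Bool : Finite Bool
finite-Bool = 2 , ↔-sym 2↔Bool

finite-⊎ : ∀ {A B : Set} → Finite A → Finite B → Finite (A ⊎ B)
finite-⊎ (m , f) (n , g) = m + n , ↔-trans (f ⊎-↔ g) (↔-sym +↔⊎)

finite-× : ∀ {A B : Set} → Finite A → Finite B → Finite (A × B)
finite-× (m , f) (n , g) = m * n , ↔-trans (f ×-↔ g) (↔-sym *↔×)

finite-Maybe : ∀ {A : Set} → Finite A → Finite (Maybe A)
finite-Maybe {A} (n , f) = suc n , mk↔ₛ′ to from to∘from from∘to
  where
  to : Maybe A → Fin (suc n)
  to nothing  = zero
  to (just a) = suc (Inverse.to f a)
  from : Fin (suc n) → Maybe A
  from zero    = nothing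
  from (suc i) = just (Inverse.from f i)
  to∘from : ∀ i → to (from i) ≡ i
  to∘from zero    = refl
  to∘from (suc i) = cong suc (Inverse.strictlyInverseˡ f i)
  from∘to : ∀ a → from (to a) ≡ a
  from∘to nothing  = refl
  from∘to (just a) = cong just (Inverse.strictlyInverseʳ f a)

-- Structured programs; the labels of a program become the control states of a
-- Turing machine

module While (W : Set) (n : ℕ) where

  Tapes Symbols Ops : Set
  Tapes   = Vec (Tape W) n
  Symbols = Vec (Symbol W) n
  Ops     = Vec (Symbol W × HeadMove) n

  heads : Tapes → Symbols
  heads = Vec.map scanned

  perform : Ops → Tapes → Tapes
  perform = zipWith update

  noop : Symbols → Ops
  noop = Vec.map (_, stay)

  infixr 5 _⨾_

  data Program : Set where
    act   : (Symbols → Ops) → Program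
    _⨾_   : Program → Program → Program
    ite   : (Symbols → Bool) → Program → Program → Program
    while : (Symbols → Bool) → Program → Program

  -- The time counts transitions of the compiled machine: every test costs one, while sequencing is
  -- free because the last transition of the first program leads straight into the second.
  data Exec : Program → Tapes → ℕ → Tapes → Set where
    act        : ∀ {f ts} → Exec (act f) ts 1 (perform (f (heads ts)) ts)
    seq        : ∀ {p q ts ts′ ts″ m m′} → Exec p ts m ts′ → Exec q ts′ m′ ts″ →
                 Exec (p ⨾ q) ts (m + m′) ts″
    ite-true   : ∀ {b p q ts ts′ m} → b (heads ts) ≡ true → Exec p ts m ts′ →
                 Exec (ite b p q) ts (suc m) ts′
    ite-false  : ∀ {b p q ts ts′ m} → b (heads ts) ≡ false → Exec q ts m ts′ →
                 Exec (ite b p q) ts (suc m) ts′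
    while-stop : ∀ {b p ts} → b (heads ts) ≡ false → Exec (while b p) ts 1 ts
    while-go   : ∀ {b p ts ts′ ts″ m m′} → b (heads ts) ≡ true → Exec p ts m ts′ →
                 Exec (while b p) ts′ m′ ts″ → Exec (while b p) ts (suc (m + m′)) ts″

  -- The added `nothing` is the state in which the test of a conditional or a loop is made.
  Label : Program → Set
  Label (act f)     = ⊤
  Label (p ⨾ q)     = Label p ⊎ Label q
  Label (ite b p q) = Maybe (Label p ⊎ Label q)
  Label (while b p) = Maybe (Label p)

  finite-Label : ∀ p → Finite (Label p)
  finite-Label (act f)     = finite-⊤
  finite-Label (p ⨾ q)     = finite-⊎ (finite-Label p) (finite-Label q)
  finite-Label (ite b p q) = finite-Maybe (finite-⊎ (finite-Label p) (finite-Label q))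
  finite-Label (while b p) = finite-Maybe (finite-Label p)

  entry : ∀ p → Label p
  entry (act f)     = tt
  entry (p ⨾ q)     = inj₁ (entry p)
  entry (ite b p q) = nothing
  entry (while b p) = nothing

  -- Here `nothing` in place of the next label means that the program ends with this transition; the
  -- enclosing program substitutes its own continuation.
  δ : ∀ p → Label p → Symbols → Ops × Maybe (Label p)
  δ (act f)     _               ss = f ss , nothing
  δ (p ⨾ q)     (inj₁ l)        ss = map₂ (λ e → just (maybe′ inj₁ (inj₂ (entry q)) e)) (δ p l ss)
  δ (p ⨾ q)     (inj₂ l)        ss = map₂ (Maybe.map inj₂) (δ q l ss)
  δ (ite b p q) nothing         ss =
    noop ss , just (just (if b ss then inj₁ (entry p) else inj₂ (entry q)))
  δ (ite b p q) (just (inj₁ l)) ss = map₂ (Maybe.map (just ∘ inj₁)) (δ p l ss)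
  δ (ite b p q) (just (inj₂ l)) ss = map₂ (Maybe.map (just ∘ inj₂)) (δ q l ss)
  δ (while b p) nothing         ss = noop ss , (if b ss then just (just (entry p)) else nothing)
  δ (while b p) (just l)        ss = map₂ (λ e → just (maybe′ just nothing e)) (δ p l ss)

  data Runs (p : Program) : Label p → Tapes → ℕ → Tapes → Set where
    exit : ∀ {l ts o} → δ p l (heads ts) ≡ (o , nothing) → Runs p l ts 1 (perform o ts)
    next : ∀ {l l′ ts ts′ m o} → δ p l (heads ts) ≡ (o , just l′) →
           Runs p l′ (perform o ts) m ts′ → Runs p l ts (suc m) ts′

  embed : ∀ {p q} (f : Label p → Label q) →
          (∀ l ss → δ q (f l) ss ≡ map₂ (Maybe.map f) (δ p l ss)) →
          ∀ {l ts m ts′} → Runs p l ts m ts′ → Runs q (f l) ts m ts′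
  embed f eq (exit e)   = exit (trans (eq _ _) (cong (map₂ (Maybe.map f)) e))
  embed f eq (next e r) = next (trans (eq _ _) (cong (map₂ (Maybe.map f)) e)) (embed f eq r)

  -- Exits of `p` are redirected to `l₀` within the same transition, so the two times add up
  -- exactly. This serves both sequencing and the return to the test of a loop.
  embed-then : ∀ {p q} (f : Label p → Label q) (l₀ : Label q) →
               (∀ l ss → δ q (f l) ss ≡ map₂ (λ e → just (maybe′ f l₀ e)) (δ p l ss)) →
               ∀ {l ts m ts′ m′ ts″} → Runs p l ts m ts′ → Runs q l₀ ts′ m′ ts″ →
               Runs q (f l) ts (m + m′) ts″
  embed-then f l₀ eq (exit e)   s =
    next (trans (eq _ _) (cong (map₂ (λ e → just (maybe′ f l₀ e))) e)) s
  embed-then f l₀ eq (next e r) s =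
    next (trans (eq _ _) (cong (map₂ (λ e → just (maybe′ f l₀ e))) e)) (embed-then f l₀ eq r s)

  perform-noop : ∀ {m} (ts : Vec (Tape W) m) →
                 zipWith update (Vec.map (_, stay) (Vec.map scanned ts)) ts ≡ ts
  perform-noop []       = refl
  perform-noop (t ∷ ts) = cong (t ∷_) (perform-noop ts)

  noop-then : ∀ {p l l′ ts m ts′} → δ p l (heads ts) ≡ (noop (heads ts) , just l′) →
              Runs p l′ ts m ts′ → Runs p l ts (suc m) ts′
  noop-then {p} {l′ = l′} {ts} {m} {ts′} e r =
    next e (subst (λ t → Runs p l′ t m ts′) (sym (perform-noop ts)) r)

  compile : ∀ {p ts m ts′} → Exec p ts m ts′ → Runs p (entry p) ts m ts′
  compile act = exit refl
  compile (seq e₁ e₂) =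
    embed-then inj₁ _ (λ _ _ → refl) (compile e₁) (embed inj₂ (λ _ _ → refl) (compile e₂))
  compile (ite-true {b} b≡ e) =
    noop-then (cong (λ c → _ , just (just (if c then _ else _))) b≡)
      (embed (just ∘ inj₁) (λ _ _ → refl) (compile e))
  compile (ite-false {b} b≡ e) =
    noop-then (cong (λ c → _ , just (just (if c then _ else _))) b≡)
      (embed (just ∘ inj₂) (λ _ _ → refl) (compile e))
  compile (while-stop {b} {p} {ts} b≡) =
    subst (Runs _ _ ts 1) (perform-noop ts)
      (exit (cong (λ c → _ , (if c then just (just (entry p)) else nothing)) b≡))
  compile (while-go {b} {p} b≡ e₁ e₂) =
    noop-then (cong (λ c → _ , (if c then just (just (entry p)) else nothing)) b≡)
      (embed-then just nothing (λ _ _ → refl) (compile e₁) (compile e₂))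

-- Turing machines from programs

module _ (W : Set) (finiteW : Finite W) (e : ℕ) where
  open While W (2 + e)

  machine : Program → (Symbols → Bool) → TuringMachine
  machine p accept = record
    { extraTapes    = e
    ; Work          = W
    ; Control       = Maybe (Label p)
    ; finiteWork    = finiteW
    ; finiteControl = finite-Maybe (finite-Label p)
    ; start         = just (entry p)
    ; transition    = λ
      { nothing  ss → halt (accept ss)
      ; (just l) ss → continue (proj₂ (δ p l ss)) (proj₁ (δ p l ss)) }
    }

  module _ (p : Program) (accept : Symbols → Bool) where
    open TuringMachine (machine p accept) using (runFrom; run)

    -- The exit leads to the control state `nothing`, where the verdict costs one more unit of fuel.
    runs⇒runFrom : ∀ {l ts m ts′} → Runs p l ts m ts′ → ∀ f →
                   runFrom (m + suc f) (just l) ts ≡ just (accept (heads ts′))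
    runs⇒runFrom (exit e)   f rewrite e = refl
    runs⇒runFrom (next e r) f rewrite e = runs⇒runFrom r f

    exec⇒run : ∀ {x u m ts′ time} →
               Exec p (inputTape x ∷ inputTape u ∷ Vec.replicate e blankTape) m ts′ →
               suc m ≤ time → run time x u ≡ just (accept (heads ts′))
    exec⇒run {x} {u} {m} {ts′} {time} ex m<time =
      subst (λ t → run t x u ≡ just (accept (heads ts′)))
        (trans (ℕ.+-suc m (time ∸ suc m)) (ℕ.m+[n∸m]≡n m<time))
        (runs⇒runFrom (compile ex) (time ∸ suc m))

-- Register programs: the first phase writes the word pairing the two inputs,
-- between two end markers, on every extra tape.  From then on an extra tape is
-- only a register, whose value is the position of the head.

_!_ : ∀ {A : Set} → List A → ℕ → Maybe A
[]       ! _     = nothing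
(a ∷ _)  ! zero  = just a
(_ ∷ as) ! suc i = as ! i

-- The inputs are laid side by side so that one head position addresses both; the inner `Maybe`
-- covers positions at which the shorter input has run out.
Mark : Set
Mark = Maybe (Maybe (Maybe Bool × Maybe Bool))

pattern originMark = nothing
pattern endMark    = just nothing
pattern datum a b  = just (just (a , b))

finite-Mark : Finite Mark
finite-Mark = finite-Maybe (finite-Maybe
  (finite-× (finite-Maybe finite-Bool) (finite-Maybe finite-Bool)))

isOrigin isEnd : Symbol Mark → Bool
isOrigin (work originMark) = true
isOrigin _                 = false
isEnd (work endMark) = true
isEnd _              = false

-- A marker counts as two missing bits, in agreement with `_!_` beyond the end of a list.
testDatum : (Maybe Bool → Maybe Bool → Bool) → Symbol Mark → Bool
testDatum f (work (datum a b)) = f a b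
testDatum f _                  = f nothing nothing

bitOf : Symbol Mark → Maybe Bool
bitOf (bit b) = just b
bitOf _       = nothing

isBit : Symbol Mark → Bool
isBit (bit _) = true
isBit _       = false

at : ∀ {m} → ℕ → Vec (Symbol Mark) m → Symbol Mark
at r       []       = blank
at zero    (s ∷ ss) = s
at (suc r) (s ∷ ss) = at r ss

moveAt : ∀ {m} → ℕ → HeadMove → Vec (Symbol Mark) m → Vec (Symbol Mark × HeadMove) m
moveAt r       h []       = []
moveAt zero    h (s ∷ ss) = (s , h) ∷ Vec.map (_, stay) ss
moveAt (suc r) h (s ∷ ss) = (s , stay) ∷ moveAt r h ss

module Commands (M : ℕ) where
  open While Mark (2 + M) public

  sense : (Symbol Mark → Bool) → ℕ → Symbols → Bool
  sense f r (_ ∷ _ ∷ ss) = f (at r ss)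

  move : HeadMove → ℕ → Program
  move h r = act λ { (a ∷ b ∷ ss) → (a , stay) ∷ (b , stay) ∷ moveAt r h ss }

  positive : ℕ → Symbols → Bool
  positive r ss = not (sense isOrigin r ss)

  clear toEnd incr decr : ℕ → Program
  clear r = while (positive r) (move goLeft r)
  toEnd r = while (not ∘ sense isEnd r) (move goRight r)
  incr r  = ite (sense isEnd r) (act noop) (move goRight r)
  decr r  = ite (sense isOrigin r) (act noop) (move goLeft r)

  transfer : ℕ → ℕ → Program
  transfer s d = clear d ⨾ while (positive s) (move goLeft s ⨾ move goRight d)

  -- A register is read by counting it down, so the source is moved to `d` and to `t` simultaneously
  -- and restored from `t` afterwards.
  copy : ℕ → ℕ → ℕ → Program
  copy s d t =
    clear d ⨾ clear t ⨾
    while (positive s) (move goLeft s ⨾ move goRight d ⨾ move goRight t) ⨾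
    transfer t s

  uniform : (Symbol Mark → Symbol Mark → Mark) → HeadMove → HeadMove → Program
  uniform w h h′ = act λ { (a ∷ b ∷ ss) → (a , h) ∷ (b , h) ∷ Vec.map (λ _ → work (w a b) , h′) ss }

  unread : Symbols → Bool
  unread (a ∷ b ∷ _) = isBit a ∨ isBit b

  setup : Program
  setup =
    uniform (λ _ _ → originMark) stay goRight ⨾
    while unread
      (uniform (λ a b → datum (bitOf a) (bitOf b)) goRight goRight) ⨾
    uniform (λ _ _ → endMark) stay stay

wordLength : List Bool → List Bool → ℕ
wordLength x u = length x ⊔ length u

lastPosition : List Bool → List Bool → ℕ
lastPosition x u = suc (wordLength x u)

module Word (x u : List Bool) where

  -- `N` is the largest register value. Time is measured in the sum of the input lengths, and `K` is
  -- the bound on `N` that is a polynomial in this sum.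
  n N K : ℕ
  n = wordLength x u
  N = lastPosition x u
  K = suc (length x + length u)

  N≤K : N ≤ K
  N≤K = s≤s (ℕ.m⊔n≤m+n (length x) (length u))

  -- The marker at position 0 shifts the inputs: the bits with index `i` stand at position `suc i`.
  content : ℕ → Mark
  content zero    = originMark
  content (suc i) with i ℕ.<? n
  ... | yes _ = datum (x ! i) (u ! i)
  ... | no _  = endMark

  symbolAt : ℕ → Symbol Mark
  symbolAt v = work (content v)

  below : ℕ → List (Symbol Mark)
  below zero    = []
  below (suc v) = symbolAt v ∷ below v

  above : ℕ → ℕ → List (Symbol Mark)
  above v zero    = []
  above v (suc j) = symbolAt v ∷ above (suc v) j

  tapeAt : ℕ → Tape Mark
  tapeAt v = tape (below v) (symbolAt v) (above (suc v) (N ∸ v))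

  content-data : ∀ {i} → i < n → content (suc i) ≡ datum (x ! i) (u ! i)
  content-data {i} i<n with i ℕ.<? n
  ... | yes _  = refl
  ... | no i≮n = contradiction i<n i≮n

  content-end : ∀ {i} → ¬ (i < n) → content (suc i) ≡ endMark
  content-end {i} i≮n with i ℕ.<? n
  ... | yes i<n = contradiction i<n i≮n
  ... | no _    = refl

  ∸-suc : ∀ {v m} → v < m → m ∸ v ≡ suc (m ∸ suc v)
  ∸-suc {zero}  (s≤s _)   = refl
  ∸-suc {suc v} (s≤s v<m) = ∸-suc v<m

  left-tapeAt : ∀ v → v < N → moveHead goLeft (tapeAt (suc v)) ≡ tapeAt v
  left-tapeAt v v<N = cong (λ k → tape (below v) (symbolAt v) (above (suc v) k)) (sym (∸-suc v<N))

  right-tapeAt : ∀ v → v < N → moveHead goRight (tapeAt v) ≡ tapeAt (suc v)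
  right-tapeAt v v<N rewrite ∸-suc v<N = refl

  isOrigin-suc : ∀ v → isOrigin (symbolAt (suc v)) ≡ false
  isOrigin-suc v with v ℕ.<? n
  ... | yes _ = refl
  ... | no _  = refl

  isEnd-inside : ∀ v → v < N → isEnd (symbolAt v) ≡ false
  isEnd-inside zero    _         = refl
  isEnd-inside (suc v) (s≤s v<n) rewrite content-data v<n = refl

  isEnd-last : isEnd (symbolAt N) ≡ true
  isEnd-last rewrite content-end (ℕ.<-irrefl {n} refl) = refl

  !-beyond : ∀ (bs : List Bool) {i} → length bs ≤ i → bs ! i ≡ nothing
  !-beyond []       _       = refl
  !-beyond (b ∷ bs) (s≤s l) = !-beyond bs l

  testDatum-symbolAt : ∀ f i → testDatum f (symbolAt (suc i)) ≡ f (x ! i) (u ! i)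
  testDatum-symbolAt f i with i ℕ.<? n
  ... | yes _  = refl
  ... | no i≮n = sym (cong₂ f
    (!-beyond x (ℕ.≤-trans (ℕ.m≤m⊔n _ _) (ℕ.≮⇒≥ i≮n)))
    (!-beyond u (ℕ.≤-trans (ℕ.m≤n⊔m (length x) _) (ℕ.≮⇒≥ i≮n))))

  Registers : Set
  Registers = ℕ → ℕ

  regs : ∀ m → Registers → Vec (Tape Mark) m
  regs zero    ρ = []
  regs (suc m) ρ = tapeAt (ρ 0) ∷ regs m (ρ ∘ suc)

  Bounded : Registers → Set
  Bounded ρ = ∀ i → ρ i ≤ N

  set : ℕ → ℕ → Registers → Registers
  set zero    v ρ zero    = v
  set zero    v ρ (suc i) = ρ (suc i)
  set (suc r) v ρ zero    = ρ zero
  set (suc r) v ρ (suc i) = set r v (ρ ∘ suc) i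

  -- Register files are functions, so a change is described pointwise instead of by an equation with
  -- `set`.
  Sets : ℕ → ℕ → Registers → Registers → Set
  Sets r v ρ ρ′ = ρ′ r ≡ v × (∀ i → i ≢ r → ρ′ i ≡ ρ i)

  sets-set : ∀ r v ρ → Sets r v ρ (set r v ρ)
  sets-set zero    v ρ = refl , λ { zero i≢r → contradiction refl i≢r ; (suc i) _ → refl }
  sets-set (suc r) v ρ with sets-set r v (ρ ∘ suc)
  ... | same , other = same , λ { zero _ → refl ; (suc i) i≢r → other i (i≢r ∘ cong suc) }

  sets-bounded : ∀ {r v ρ ρ′} → Sets r v ρ ρ′ → v ≤ N → Bounded ρ → Bounded ρ′
  sets-bounded {r} (refl , other) v≤N b i with i ℕ.≟ r
  ... | yes refl = v≤N
  ... | no i≢r   = subst (_≤ N) (sym (other i i≢r)) (b i)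

  perform-moveAt : ∀ m r h v ρ → r < m → moveHead h (tapeAt (ρ r)) ≡ tapeAt v →
    zipWith update (moveAt r h (Vec.map scanned (regs m ρ))) (regs m ρ) ≡ regs m (set r v ρ)
  perform-moveAt (suc m) zero    h v ρ _ eq =
    cong₂ _∷_ eq (While.perform-noop Mark 0 (regs m (ρ ∘ suc)))
  perform-moveAt (suc m) (suc r) h v ρ (s≤s r<m) eq =
    cong (tapeAt (ρ 0) ∷_) (perform-moveAt m r h v (ρ ∘ suc) r<m eq)

  at-regs : ∀ m r ρ → r < m → at r (Vec.map scanned (regs m ρ)) ≡ symbolAt (ρ r)
  at-regs (suc m) zero    ρ _         = refl
  at-regs (suc m) (suc r) ρ (s≤s r<m) = at-regs m r (ρ ∘ suc) r<m

  -- The bounds are numbers here; K and loopTime are the values of polynomials.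
  loopTime : ℕ → ℕ
  loopTime b = 1 + K * (1 + b)

  module Semantics (M : ℕ) (xt ut : Tape Mark) where
    open Commands M public

    config : Registers → Tapes
    config ρ = xt ∷ ut ∷ regs M ρ

    Does : Program → Registers → ℕ → (Registers → Set) → Set
    Does p ρ b Q = ∃[ t ] ∃[ ρ′ ] (Exec p (config ρ) t (config ρ′) × t ≤ b × Q ρ′)

    infixr 5 _then_

    _then_ : ∀ {p q ρ b b′ Q Q′} → Does p ρ b Q → (∀ {ρ′} → Q ρ′ → Does q ρ′ b′ Q′) →
             Does (p ⨾ q) ρ (b + b′) Q′
    (t , ρ′ , e , t≤b , h) then f with f h
    ... | t′ , ρ″ , e′ , t′≤b′ , h′ = t + t′ , ρ″ , seq e e′ , ℕ.+-mono-≤ t≤b t′≤b′ , h′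

    weaken : ∀ {p ρ b b′ Q Q′} → Does p ρ b Q → b ≤ b′ → (∀ {ρ′} → Q ρ′ → Q′ ρ′) → Does p ρ b′ Q′
    weaken (t , ρ′ , e , t≤b , h) b≤b′ f = t , ρ′ , e , ℕ.≤-trans t≤b b≤b′ , f h

    post : ∀ {p ρ b Q Q′} → Does p ρ b Q → (∀ {ρ′} → Q ρ′ → Q′ ρ′) → Does p ρ b Q′
    post d = weaken d ℕ.≤-refl

    sense-config : ∀ f {r} ρ → r < M → sense f r (heads (config ρ)) ≡ f (symbolAt (ρ r))
    sense-config f ρ r<M = cong f (at-regs M _ ρ r<M)

    positive-zero : ∀ {r ρ} → r < M → ρ r ≡ 0 → positive r (heads (config ρ)) ≡ false
    positive-zero {ρ = ρ} r<M eq =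
      cong not (trans (sense-config isOrigin ρ r<M) (cong (isOrigin ∘ symbolAt) eq))

    positive-suc : ∀ {r ρ v} → r < M → ρ r ≡ suc v → positive r (heads (config ρ)) ≡ true
    positive-suc {ρ = ρ} {v} r<M eq =
      cong not (trans (sense-config isOrigin ρ r<M) (trans (cong (isOrigin ∘ symbolAt) eq) (isOrigin-suc v)))

    does-noop : ∀ ρ → Does (act noop) ρ 1 (_≡ ρ)
    does-noop ρ =
      1 , ρ , subst (Exec _ _ 1) (perform-noop (config ρ)) act , ℕ.≤-refl , refl

    does-move : ∀ {h r v ρ} → r < M → moveHead h (tapeAt (ρ r)) ≡ tapeAt v →
                Does (move h r) ρ 1 (Sets r v ρ)
    does-move {h} {r} {v} {ρ} r<M eq =
      1 , set r v ρ ,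
      subst (λ ts → Exec (move h r) (config ρ) 1 (xt ∷ ut ∷ ts)) (perform-moveAt M r h v ρ r<M eq) act ,
      ℕ.≤-refl , sets-set r v ρ

    does-left : ∀ {r v ρ} → r < M → ρ r ≡ suc v → suc v ≤ N → Does (move goLeft r) ρ 1 (Sets r v ρ)
    does-left r<M eq v<N = does-move r<M (trans (cong (moveHead goLeft ∘ tapeAt) eq) (left-tapeAt _ v<N))

    does-right : ∀ {r v ρ} → r < M → ρ r ≡ v → v < N → Does (move goRight r) ρ 1 (Sets r (suc v) ρ)
    does-right r<M eq v<N = does-move r<M (trans (cong (moveHead goRight ∘ tapeAt) eq) (right-tapeAt _ v<N))

    -- The index of the invariant is the number of rounds left. It is at most `N`, hence at most
    -- `K`, which gives a bound that does not mention it.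
    does-while : ∀ {b p c} (I : ℕ → Registers → Set) →
      (∀ {ρ} → I 0 ρ → b (heads (config ρ)) ≡ false) →
      (∀ {v ρ} → I (suc v) ρ → b (heads (config ρ)) ≡ true × Does p ρ c (I v)) →
      ∀ {v ρ} → v ≤ N → I v ρ → Does (while b p) ρ (loopTime c) (I 0)
    does-while {b} {p} {c} I stop go v≤N i =
      weaken (loop _ i) (s≤s (ℕ.*-monoˡ-≤ (suc c) (ℕ.≤-trans v≤N N≤K))) id
      where
      loop : ∀ v {ρ} → I v ρ → Does (while b p) ρ (1 + v * (1 + c)) (I 0)
      loop zero    i = 1 , _ , while-stop (stop i) , ℕ.≤-refl , i
      loop (suc v) i with go i
      ... | b≡ , t , ρ′ , e , t≤c , i′ with loop v i′
      ...   | t′ , ρ″ , e′ , t′≤ , i″ =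
        _ , ρ″ , while-go b≡ e e′ ,
        s≤s (ℕ.≤-trans (ℕ.+-mono-≤ t≤c t′≤) (ℕ.≤-reflexive (ℕ.+-suc c _))) , i″

    does-clear : ∀ {r ρ} → r < M → Bounded ρ → Does (clear r) ρ (loopTime 1) (Sets r 0 ρ)
    does-clear {r} {ρ} r<M bd = post
      (does-while (λ v ρ′ → ρ′ r ≡ v × v ≤ N × (∀ i → i ≢ r → ρ′ i ≡ ρ i))
        (λ { (eq , _) → positive-zero r<M eq })
        (λ { (eq , v<N , other) → positive-suc r<M eq ,
             post (does-left r<M eq v<N)
               (λ { (eq′ , other′) → eq′ , ℕ.<⇒≤ v<N , λ i i≢r → trans (other′ i i≢r) (other i i≢r) }) })
        (bd r) (refl , bd r , λ _ _ → refl))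
      (λ { (eq , _ , other) → eq , other })

    does-toEnd : ∀ {r ρ} → r < M → Bounded ρ → Does (toEnd r) ρ (loopTime 1) (Sets r N ρ)
    does-toEnd {r} {ρ} r<M bd = post
      (does-while (λ v ρ′ → ρ′ r + v ≡ N × (∀ i → i ≢ r → ρ′ i ≡ ρ i))
        (λ {ρ′} (eq , _) → cong not (trans (sense-config isEnd ρ′ r<M)
          (trans (cong (isEnd ∘ symbolAt) (trans (sym (ℕ.+-identityʳ _)) eq)) isEnd-last)))
        (λ {v} {ρ′} (eq , other) →
          let r<N : ρ′ r < N
              r<N = ℕ.≤-trans (s≤s (ℕ.m≤m+n _ v)) (ℕ.≤-reflexive (trans (sym (ℕ.+-suc _ v)) eq))
          in cong not (trans (sense-config isEnd ρ′ r<M) (isEnd-inside _ r<N)) ,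
             post (does-right r<M refl r<N) λ (eq′ , other′) →
               trans (cong (_+ v) eq′) (trans (sym (ℕ.+-suc _ v)) eq) ,
               λ i i≢r → trans (other′ i i≢r) (other i i≢r))
        {v = N ∸ ρ r} (ℕ.m∸n≤m N (ρ r)) (ℕ.m+[n∸m]≡n (bd r) , λ _ _ → refl))
      (λ (eq , other) → trans (sym (ℕ.+-identityʳ _)) eq , other)

    does-incr : ∀ {r ρ} → r < M → Bounded ρ → Does (incr r) ρ 2 (Sets r (N ⊓ suc (ρ r)) ρ)
    does-incr {r} {ρ} r<M bd with ρ r ℕ.<? N
    ... | yes r<N with does-right {ρ = ρ} r<M refl r<N
    ...   | t , ρ′ , e , t≤1 , h =
      suc t , ρ′ , ite-false (trans (sense-config isEnd ρ r<M) (isEnd-inside _ r<N)) e , s≤s t≤1 ,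
      subst (λ v → Sets r v ρ ρ′) (sym (ℕ.m≥n⇒m⊓n≡n r<N)) h
    does-incr {r} {ρ} r<M bd | no r≮N with does-noop ρ
    ...   | t , ρ′ , e , t≤1 , refl =
      suc t , ρ , ite-true (trans (sense-config isEnd ρ r<M) (trans (cong (isEnd ∘ symbolAt) r≡N) isEnd-last)) e ,
      s≤s t≤1 , trans r≡N (sym (ℕ.m≤n⇒m⊓n≡m (ℕ.m≤n⇒m≤1+n (ℕ.≤-reflexive (sym r≡N))))) , λ _ _ → refl
      where
      r≡N : ρ r ≡ N
      r≡N = ℕ.≤-antisym (bd r) (ℕ.≮⇒≥ r≮N)

    does-decr : ∀ {r ρ} → r < M → Bounded ρ → Does (decr r) ρ 2 (Sets r (pred (ρ r)) ρ)
    does-decr {r} {ρ} r<M bd with ρ r in eq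
    ... | zero with does-noop ρ
    ...   | t , ρ′ , e , t≤1 , refl =
      suc t , ρ , ite-true (trans (sense-config isOrigin ρ r<M) (cong (isOrigin ∘ symbolAt) eq)) e ,
      s≤s t≤1 , eq , λ _ _ → refl
    does-decr {r} {ρ} r<M bd | suc v with does-left {ρ = ρ} r<M eq (subst (_≤ N) eq (bd r))
    ...   | t , ρ′ , e , t≤1 , h =
      suc t , ρ′ , ite-false (trans (sense-config isOrigin ρ r<M) (trans (cong (isOrigin ∘ symbolAt) eq) (isOrigin-suc v))) e ,
      s≤s t≤1 , h

    transferTime copyTime : ℕ
    transferTime = loopTime 1 + loopTime 2
    copyTime     = loopTime 1 + (loopTime 1 + (loopTime 3 + transferTime))

    Transfers : ℕ → ℕ → Registers → Registers → Set
    Transfers s d ρ ρ′ = ρ′ s ≡ 0 × ρ′ d ≡ ρ s × (∀ i → i ≢ s → i ≢ d → ρ′ i ≡ ρ i)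

    does-transfer : ∀ {s d ρ} → s < M → d < M → s ≢ d → Bounded ρ →
                    Does (transfer s d) ρ transferTime (Transfers s d ρ)
    does-transfer {s} {d} {ρ} s<M d<M s≢d bd =
      does-clear d<M bd then λ {ρ₁} (d≡0 , other₁) → post
        -- The sum of the two registers is preserved; besides the result, this shows that `d` never
        -- runs off the tape.
        (does-while (λ w ρ′ → ρ′ s ≡ w × ρ′ d + w ≡ ρ s × (∀ i → i ≢ s → i ≢ d → ρ′ i ≡ ρ i))
          (λ (eq , _) → positive-zero s<M eq)
          (λ {w} {ρ₂} (eq , sum , other) →
            let w<N : suc w ≤ N
                w<N = ℕ.≤-trans (ℕ.m≤n+m _ (ρ₂ d)) (ℕ.≤-trans (ℕ.≤-reflexive sum) (bd s))
                d<N : ρ₂ d < N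
                d<N = ℕ.≤-trans (s≤s (ℕ.m≤m+n _ w))
                        (ℕ.≤-trans (ℕ.≤-reflexive (trans (sym (ℕ.+-suc _ w)) sum)) (bd s))
            in positive-suc s<M eq ,
               (does-left s<M eq w<N then λ {ρ₃} (s≡ , other₃) →
                post (does-right d<M (other₃ d (s≢d ∘ sym)) d<N) λ {ρ₄} (d≡ , other₄) →
                  trans (other₄ s s≢d) s≡ ,
                  trans (cong (_+ w) d≡) (trans (sym (ℕ.+-suc _ w)) sum) ,
                  λ i i≢s i≢d → trans (other₄ i i≢d) (trans (other₃ i i≢s) (other i i≢s i≢d))))
          (bd s)
          (other₁ s s≢d , cong (_+ ρ s) d≡0 , λ i _ i≢d → other₁ i i≢d))
        (λ {ρ′} (s≡0 , sum , other) → s≡0 , trans (sym (ℕ.+-identityʳ (ρ′ d))) sum , other)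

    does-copy : ∀ {s d t ρ} → s < M → d < M → t < M → s ≢ d → s ≢ t → d ≢ t → Bounded ρ →
      Does (copy s d t) ρ copyTime (λ ρ′ → ρ′ d ≡ ρ s × ρ′ t ≡ 0 × (∀ i → i ≢ d → i ≢ t → ρ′ i ≡ ρ i))
    does-copy {s} {d} {t} {ρ} s<M d<M t<M s≢d s≢t d≢t bd =
      does-clear d<M bd then λ {ρ₁} h₁@(d≡0 , other₁) →
      does-clear t<M (sets-bounded {ρ = ρ} h₁ z≤n bd) then λ {ρ₂} h₂@(t≡0 , other₂) →
      does-while
          (λ w ρ′ → ρ′ s ≡ w × ρ′ d + w ≡ ρ s × ρ′ t + w ≡ ρ s ×
                    (∀ i → i ≢ s → i ≢ d → i ≢ t → ρ′ i ≡ ρ i))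
          (λ (eq , _) → positive-zero s<M eq)
          (λ {w} {ρ₃} (eq , sumd , sumt , other) →
            positive-suc s<M eq ,
            (does-left s<M eq (ℕ.≤-trans (ℕ.m≤n+m _ (ρ₃ d)) (ℕ.≤-trans (ℕ.≤-reflexive sumd) (bd s)))
               then λ {ρ₄} (s≡ , other₄) →
             does-right d<M (other₄ d (s≢d ∘ sym)) (room (ρ₃ d) w sumd) then λ {ρ₅} (d≡ , other₅) →
             post (does-right t<M (trans (other₅ t (d≢t ∘ sym)) (other₄ t (s≢t ∘ sym))) (room (ρ₃ t) w sumt))
               λ {ρ₆} (t≡ , other₆) →
               trans (other₆ s s≢t) (trans (other₅ s s≢d) s≡) ,
               trans (cong (_+ w) (trans (other₆ d d≢t) d≡)) (trans (sym (ℕ.+-suc _ w)) sumd) ,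
               trans (cong (_+ w) t≡) (trans (sym (ℕ.+-suc _ w)) sumt) ,
               λ i i≢s i≢d i≢t → trans (other₆ i i≢t) (trans (other₅ i i≢d)
                 (trans (other₄ i i≢s) (other i i≢s i≢d i≢t)))))
          (bd s)
          (trans (other₂ s s≢t) (other₁ s s≢d) ,
           cong (_+ ρ s) (trans (other₂ d d≢t) d≡0) ,
           cong (_+ ρ s) t≡0 ,
           λ i _ i≢d i≢t → trans (other₂ i i≢t) (other₁ i i≢d))
        then λ {ρ₃} (s≡0 , sumd , sumt , other₃) →
      post (does-transfer t<M s<M (s≢t ∘ sym) (bounded₃ ρ₃ s≡0 sumd sumt other₃))
        λ {ρ₄} (t≡0 , s≡ , other₄) →
          trans (other₄ d d≢t (s≢d ∘ sym)) (trans (sym (ℕ.+-identityʳ _)) sumd) ,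
          t≡0 ,
          λ i i≢d i≢t → restore ρ₃ ρ₄ s≡ sumt other₃ other₄ i i≢d i≢t
      where
      room : ∀ a w → a + suc w ≡ ρ s → a < N
      room a w eq = ℕ.≤-trans (s≤s (ℕ.m≤m+n a w))
        (ℕ.≤-trans (ℕ.≤-reflexive (trans (sym (ℕ.+-suc a w)) eq)) (bd s))
      bounded₃ : ∀ ρ₃ → ρ₃ s ≡ 0 → ρ₃ d + 0 ≡ ρ s → ρ₃ t + 0 ≡ ρ s →
                 (∀ i → i ≢ s → i ≢ d → i ≢ t → ρ₃ i ≡ ρ i) → Bounded ρ₃
      bounded₃ ρ₃ s≡0 sumd sumt other i with i ℕ.≟ s | i ℕ.≟ d | i ℕ.≟ t
      ... | yes refl | _        | _        = subst (_≤ N) (sym s≡0) z≤n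
      ... | no _     | yes refl | _        = subst (_≤ N) (sym (trans (sym (ℕ.+-identityʳ _)) sumd)) (bd s)
      ... | no _     | no _     | yes refl = subst (_≤ N) (sym (trans (sym (ℕ.+-identityʳ _)) sumt)) (bd s)
      ... | no a     | no b     | no c     = subst (_≤ N) (sym (other i a b c)) (bd i)
      restore : ∀ ρ₃ ρ₄ → ρ₄ s ≡ ρ₃ t → ρ₃ t + 0 ≡ ρ s →
                (∀ i → i ≢ s → i ≢ d → i ≢ t → ρ₃ i ≡ ρ i) → (∀ i → i ≢ t → i ≢ s → ρ₄ i ≡ ρ₃ i) →
                ∀ i → i ≢ d → i ≢ t → ρ₄ i ≡ ρ i
      restore ρ₃ ρ₄ s≡ sumt other₃ other₄ i i≢d i≢t with i ℕ.≟ s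
      ... | yes refl = trans s≡ (trans (sym (ℕ.+-identityʳ _)) sumt)
      ... | no i≢s   = trans (other₄ i i≢t i≢s) (other₃ i i≢s i≢d i≢t)

-- Terms over numbers that never exceed N: since successors saturate at N, every
-- loop has at most N rounds and every term has a polynomial time bound.

data Term : ℕ → Set where
  var   : ∀ {m} → Fin m → Term m
  zero  : ∀ {m} → Term m
  suc   : ∀ {m} → Term m → Term m
  dec   : ∀ {m} → Term m → Term m
  top   : ∀ {m} → Term m
  query : ∀ {m} → (Maybe Bool → Maybe Bool → Bool) → Term m → Term m
  cond  : ∀ {m} → Term m → Term m → Term m → Term m
  rec   : ∀ {m} → Term m → Term (1 + m) → Term (2 + m) → Term m
  call  : ∀ {m n} → Term (suc n) → Vec (Term m) (suc n) → Term m

-- The counter runs downwards because the loop that computes it decrements its register at the start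
-- of each round.
iter : (ℕ → ℕ → ℕ) → ℕ → ℕ → ℕ
iter f zero    a = a
iter f (suc j) a = iter f j (f j a)

ifPositive : ∀ {A : Set} → ℕ → A → A → A
ifPositive zero    a b = b
ifPositive (suc _) a b = a

module Evaluation (x u : List Bool) where

  eval  : ∀ {m} → Term m → Vec ℕ m → ℕ
  evals : ∀ {m n} → Vec (Term m) n → Vec ℕ m → Vec ℕ n

  eval (var i)      ρ = lookup ρ i
  eval zero         ρ = 0
  eval (suc t)      ρ = lastPosition x u ⊓ suc (eval t ρ)
  eval (dec t)     ρ = pred (eval t ρ)
  eval top          ρ = lastPosition x u
  eval (query f t)  ρ = if f (x ! eval t ρ) (u ! eval t ρ) then 1 else 0
  eval (cond c a b) ρ = ifPositive (eval c ρ) (eval a ρ) (eval b ρ)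
  eval (rec n z s)  ρ =
    iter (λ j a → eval s (a ∷ j ∷ ρ)) (eval n ρ) (eval z (eval n ρ ∷ ρ))
  eval (call f ts)  ρ = eval f (evals ts ρ)

  evals []       ρ = []
  evals (t ∷ ts) ρ = eval t ρ ∷ evals ts ρ

iota : ℕ → ∀ n → Vec ℕ n
iota d zero    = []
iota d (suc n) = d ∷ iota (suc d) n

-- Registers from limit t d on are not used when the value of t is computed in
-- register d.
limit  : ∀ {m} → Term m → ℕ → ℕ
limits : ∀ {m n} → Vec (Term m) n → ℕ → ℕ
limit (var i)              d = 2 + d
limit zero                 d = 1 + d
limit (suc t)              d = limit t d ⊔ (1 + d)
limit (dec t)             d = limit t d ⊔ (1 + d)
limit top                  d = 1 + d
limit (query f t)          d = limit t d ⊔ (1 + d)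
limit (cond c a b)         d = (limit c d ⊔ (limit a d ⊔ limit b d)) ⊔ (1 + d)
limit (rec n z s)          d = (limit n d ⊔ (limit z (1 + d) ⊔ limit s (2 + d))) ⊔ (3 + d)
limit (call {n = n} f ts)  d = (limits ts d ⊔ limit f (d + suc n)) ⊔ (1 + (d + suc n))
limits []       d = 0
limits (t ∷ ts) d = limit t d ⊔ limits ts (suc d)

-- At the sum of the input lengths this computes to `loopTime`, so the time bounds proved for loops
-- apply without conversion.
loopᵖ : Polynomial → Polynomial
loopᵖ p = con 1 ⊕ ((con 1 ⊕ var) ⊗ (con 1 ⊕ p))

transferᵖ copyᵖ : Polynomial
transferᵖ = loopᵖ (con 1) ⊕ loopᵖ (con 2)
copyᵖ     = loopᵖ (con 1) ⊕ (loopᵖ (con 1) ⊕ (loopᵖ (con 3) ⊕ transferᵖ))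

cost  : ∀ {m} → Term m → Polynomial
costs : ∀ {m n} → Vec (Term m) n → Polynomial
cost (var i)      = copyᵖ
cost zero         = loopᵖ (con 1)
cost (suc t)      = cost t ⊕ con 2
cost (dec t)     = cost t ⊕ con 2
cost top          = loopᵖ (con 1)
cost (query f t)  = cost t ⊕ (con 2 ⊕ (con 1 ⊕ (loopᵖ (con 1) ⊕ con 2)))
cost (cond c a b) = cost c ⊕ (con 1 ⊕ (cost a ⊕ cost b))
cost (rec n z s)  = cost n ⊕ (cost z ⊕ (loopᵖ (con 1 ⊕ (cost s ⊕ transferᵖ)) ⊕ transferᵖ))
cost (call f ts)  = costs ts ⊕ (cost f ⊕ transferᵖ)
costs []       = con 1
costs (t ∷ ts) = cost t ⊕ costs ts

module Code (M : ℕ) where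
  open Commands M

  -- Registers form a stack: the variables lie at the places `σ` below `d`, the result is left in
  -- `d`, and everything above `d` is scratch space.
  code  : ∀ {m} → Term m → Vec ℕ m → ℕ → Program
  codes : ∀ {m n} → Vec (Term m) n → Vec ℕ m → ℕ → Program

  code (var i)      σ d = copy (lookup σ i) d (suc d)
  code zero         σ d = clear d
  code (suc t)      σ d = code t σ d ⨾ incr d
  code (dec t)     σ d = code t σ d ⨾ decr d
  code top          σ d = toEnd d
  code (query f t)  σ d =
    -- The increment compensates for the marker at position 0.
    code t σ d ⨾ incr d ⨾ ite (sense (testDatum f) d) (clear d ⨾ incr d) (clear d)
  code (cond c a b) σ d = code c σ d ⨾ ite (positive d) (code a σ d) (code b σ d)
  code (rec n z s)  σ d =
    code n σ d ⨾ code z (d ∷ σ) (1 + d) ⨾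
    while (positive d)
      (move goLeft d ⨾ code s (1 + d ∷ d ∷ σ) (2 + d) ⨾ transfer (2 + d) (1 + d)) ⨾
    transfer (1 + d) d
  code (call {n = n} f ts) σ d =
    codes ts σ d ⨾ code f (iota d (suc n)) (d + suc n) ⨾ transfer (d + suc n) d

  codes []       σ d = act noop
  codes (t ∷ ts) σ d = code t σ d ⨾ codes ts σ (suc d)

module CodeCorrect (x u : List Bool) (M : ℕ) (xt ut : Tape Mark) where
  open Word x u
  open Semantics M xt ut
  open Evaluation x u
  open Code M

  time : Polynomial → ℕ
  time p = ⟦ p ⟧ (length x + length u)

  Keeps : ℕ → Registers → Registers → Set
  Keeps d ρ ρ′ = ∀ i → i < d → ρ′ i ≡ ρ i

  Result : ℕ → ℕ → Registers → Registers → Set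
  Result d v ρ ρ′ = ρ′ d ≡ v × Keeps d ρ ρ′ × Bounded ρ′

  Below : ℕ → ∀ {m} → Vec ℕ m → Set
  Below d = All (_< d)

  below-suc : ∀ {d m} {σ : Vec ℕ m} → Below d σ → Below (suc d) σ
  below-suc = All.map ℕ.m≤n⇒m≤1+n

  below-lookup : ∀ {d m} {σ : Vec ℕ m} → Below d σ → ∀ i → lookup σ i < d
  below-lookup (p ∷ ps) zero    = p
  below-lookup (p ∷ ps) (suc i) = below-lookup ps i

  keeps-map : ∀ {d ρ ρ′ m} {σ : Vec ℕ m} → Below d σ → Keeps d ρ ρ′ → Vec.map ρ′ σ ≡ Vec.map ρ σ
  keeps-map []       k = refl
  keeps-map (p ∷ ps) k = cong₂ _∷_ (k _ p) (keeps-map ps k)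

  keeps-trans : ∀ {d d′ ρ ρ′ ρ″} → d ≤ d′ → Keeps d ρ ρ′ → Keeps d′ ρ′ ρ″ → Keeps d ρ ρ″
  keeps-trans d≤d′ k k′ i i<d = trans (k′ i (ℕ.≤-trans i<d d≤d′)) (k i i<d)

  sets⇒result : ∀ {d v ρ ρ′} → Bounded ρ → v ≤ N → Sets d v ρ ρ′ → Result d v ρ ρ′
  sets⇒result {ρ = ρ} bd v≤N h@(eq , other) =
    eq , (λ i i<d → other i (ℕ.<⇒≢ i<d)) , sets-bounded {ρ = ρ} h v≤N bd

  transfers⇒result : ∀ {s d ρ ρ′} → Bounded ρ → d < s → Transfers s d ρ ρ′ → Result d (ρ s) ρ ρ′
  transfers⇒result {s} {d} {ρ} {ρ′} bd d<s (s≡0 , d≡ , other) =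
    d≡ , (λ i i<d → other i (ℕ.<⇒≢ (ℕ.<-trans i<d d<s)) (ℕ.<⇒≢ i<d)) , bounded
    where
    bounded : Bounded ρ′
    bounded i with i ℕ.≟ s | i ℕ.≟ d
    ... | yes refl | _        = subst (_≤ N) (sym s≡0) z≤n
    ... | no _     | yes refl = subst (_≤ N) (sym d≡) (bd s)
    ... | no a     | no b     = subst (_≤ N) (sym (other i a b)) (bd i)

  iota-below : ∀ d n → Below (d + n) (iota d n)
  iota-below d zero    = []
  iota-below d (suc n) =
    ℕ.m<m+n d (s≤s z≤n) ∷ subst (λ e → Below e (iota (suc d) n)) (sym (ℕ.+-suc d n)) (iota-below (suc d) n)

  does-ite-true : ∀ {b p q ρ c Q} → b (heads (config ρ)) ≡ true → Does p ρ c Q → Does (ite b p q) ρ (1 + c) Q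
  does-ite-true b≡ (t , ρ′ , e , le , h) = suc t , ρ′ , ite-true b≡ e , s≤s le , h

  does-ite-false : ∀ {b p q ρ c Q} → b (heads (config ρ)) ≡ false → Does q ρ c Q → Does (ite b p q) ρ (1 + c) Q
  does-ite-false b≡ (t , ρ′ , e , le , h) = suc t , ρ′ , ite-false b≡ e , s≤s le , h

  fit-left : ∀ {a b} → a ⊔ b ≤ M → a ≤ M
  fit-left {a} {b} = ℕ.m⊔n≤o⇒m≤o a b

  fit-right : ∀ {a b} → a ⊔ b ≤ M → b ≤ M
  fit-right {a} {b} = ℕ.m⊔n≤o⇒n≤o a b

  -- Induction on the term. `Keeps d` is what carries the induction: a subterm computed in a higher
  -- register leaves the variables and the earlier results in place.
  code-correct : ∀ {m} (t : Term m) {σ d ρ} → Bounded ρ → Below d σ → limit t d ≤ M →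
    Does (code t σ d) ρ (time (cost t)) (Result d (eval t (Vec.map ρ σ)) ρ)
  codes-correct : ∀ {m n} (ts : Vec (Term m) n) {σ d ρ} → Bounded ρ → Below d σ → limits ts d ≤ M →
    Does (codes ts σ d) ρ (time (costs ts))
      (λ ρ′ → Vec.map ρ′ (iota d n) ≡ evals ts (Vec.map ρ σ) × Keeps d ρ ρ′ × Bounded ρ′)

  code-correct (var i) {σ} {d} {ρ} bd bl fit =
    let s<d = below-lookup bl i
        d<M = ℕ.≤-trans (ℕ.n≤1+n _) fit
    in post (does-copy (ℕ.<-trans s<d d<M) d<M fit (ℕ.<⇒≢ s<d) (ℕ.<⇒≢ (ℕ.m≤n⇒m≤1+n s<d))
                (ℕ.<⇒≢ ℕ.≤-refl) bd)
         λ {ρ′} (d≡ , t≡0 , other) →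
           trans d≡ (sym (Vec.lookup-map i ρ σ)) ,
           (λ j j<d → other j (ℕ.<⇒≢ j<d) (ℕ.<⇒≢ (ℕ.m≤n⇒m≤1+n j<d))) ,
           bounded ρ′ d≡ t≡0 other
    where
    bounded : ∀ ρ′ → ρ′ d ≡ ρ (lookup σ i) → ρ′ (suc d) ≡ 0 →
              (∀ j → j ≢ d → j ≢ suc d → ρ′ j ≡ ρ j) → Bounded ρ′
    bounded ρ′ d≡ t≡0 other j with j ℕ.≟ d | j ℕ.≟ suc d
    ... | yes refl | _        = subst (_≤ N) (sym d≡) (bd _)
    ... | no _     | yes refl = subst (_≤ N) (sym t≡0) z≤n
    ... | no a     | no b     = subst (_≤ N) (sym (other j a b)) (bd j)
  code-correct zero bd bl fit = post (does-clear fit bd) (sets⇒result bd z≤n)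
  code-correct (suc t) {σ} {d} {ρ} bd bl fit =
    code-correct t bd bl (fit-left fit) then λ {ρ₁} (eq , k , bd₁) →
    post (does-incr (fit-right fit) bd₁) λ h →
      let (eq′ , k′ , bd′) = sets⇒result bd₁ (ℕ.m⊓n≤m _ _) h
      in trans eq′ (cong (λ v → N ⊓ suc v) eq) , keeps-trans ℕ.≤-refl k k′ , bd′
  code-correct (dec t) {σ} {d} {ρ} bd bl fit =
    code-correct t bd bl (fit-left fit) then λ {ρ₁} (eq , k , bd₁) →
    post (does-decr (fit-right fit) bd₁) λ h →
      let (eq′ , k′ , bd′) = sets⇒result bd₁ (ℕ.≤-trans ℕ.pred[n]≤n (bd₁ d)) h
      in trans eq′ (cong pred eq) , keeps-trans ℕ.≤-refl k k′ , bd′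
  code-correct top bd bl fit = post (does-toEnd fit bd) (sets⇒result bd ℕ.≤-refl)
  code-correct (query f t) {σ} {d} {ρ} bd bl fit =
    code-correct t bd bl (fit-left fit) then λ {ρ₁} (eq , k , bd₁) →
    does-incr (fit-right fit) bd₁ then λ {ρ₂} h →
      let (eq′ , k′ , bd₂) = sets⇒result bd₁ (ℕ.m⊓n≤m _ _) h
          b≡ = trans (sense-config (testDatum f) ρ₂ (fit-right fit)) (sensed (ρ₁ d) (ρ₂ d) eq′ (bd₁ d))
      in branch ρ₁ ρ₂ k k′ bd₂ (trans b≡ (cong answer eq))
    where
    v = eval t (Vec.map ρ σ)
    answer : ℕ → Bool
    answer w = f (x ! w) (u ! w)
    sensed : ∀ w w′ → w′ ≡ N ⊓ suc w → w ≤ N → testDatum f (symbolAt w′) ≡ answer w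
    sensed w w′ eq w≤N with w ℕ.<? N
    ... | yes w<N rewrite trans eq (ℕ.m≥n⇒m⊓n≡n w<N) = testDatum-symbolAt f w
    -- Now `w` is `N`: the increment saturates on the end marker, and both inputs are exhausted at
    -- either position.
    ... | no w≮N  rewrite trans eq (ℕ.m≤n⇒m⊓n≡m (ℕ.m≤n⇒m≤1+n (ℕ.≮⇒≥ w≮N))) = trans (testDatum-symbolAt f n)
          (cong₂ f (trans (!-beyond x (ℕ.m≤m⊔n _ _)) (sym (!-beyond x (ℕ.≤-trans (ℕ.m≤m⊔n _ _) n≤w))))
                   (trans (!-beyond u (ℕ.m≤n⊔m (length x) _)) (sym (!-beyond u (ℕ.≤-trans (ℕ.m≤n⊔m (length x) _) n≤w)))))
      where
      n≤w : n ≤ w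
      n≤w = ℕ.≤-trans (ℕ.n≤1+n n) (ℕ.≮⇒≥ w≮N)
    branch : ∀ ρ₁ ρ₂ → Keeps d ρ ρ₁ → Keeps d ρ₁ ρ₂ → Bounded ρ₂ →
      sense (testDatum f) d (heads (config ρ₂)) ≡ answer v →
      Does (ite (sense (testDatum f) d) (clear d ⨾ incr d) (clear d)) ρ₂ (1 + (loopTime 1 + 2))
        (Result d (if answer v then 1 else 0) ρ)
    branch ρ₁ ρ₂ k k′ bd₂ b≡ with answer v
    ... | true = does-ite-true b≡ (
      does-clear (fit-right fit) bd₂ then λ h₃ →
      let (eq₃ , k₃ , bd₃) = sets⇒result bd₂ z≤n h₃ in
      post (does-incr (fit-right fit) bd₃) λ h₄ →
      let (eq₄ , k₄ , bd₄) = sets⇒result bd₃ (ℕ.m⊓n≤m _ _) h₄ in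
      trans eq₄ (cong suc (trans (cong (n ⊓_) eq₃) (ℕ.⊓-zeroʳ n))) ,
      keeps-trans ℕ.≤-refl k (keeps-trans ℕ.≤-refl k′ (keeps-trans ℕ.≤-refl k₃ k₄)) , bd₄)
    ... | false = does-ite-false b≡ (
      weaken (does-clear (fit-right fit) bd₂) (ℕ.m≤m+n _ 2) λ h₃ →
      let (eq₃ , k₃ , bd₃) = sets⇒result bd₂ z≤n h₃ in
      eq₃ , keeps-trans ℕ.≤-refl k (keeps-trans ℕ.≤-refl k′ k₃) , bd₃)
  code-correct (cond c a b) {σ} {d} {ρ} bd bl fit =
    code-correct c bd bl (fit-left {b = limit a d ⊔ limit b d} (fit-left fit)) then
      λ {ρ₁} (eq , k , bd₁) → branch ρ₁ _ refl eq k bd₁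
    where
    fit-ab : limit a d ⊔ limit b d ≤ M
    fit-ab = fit-right {limit c d} (fit-left fit)
    branch : ∀ ρ₁ w → ρ₁ d ≡ w → w ≡ eval c (Vec.map ρ σ) → Keeps d ρ ρ₁ → Bounded ρ₁ →
      Does (ite (positive d) (code a σ d) (code b σ d)) ρ₁ (1 + (time (cost a) + time (cost b)))
        (Result d (eval (cond c a b) (Vec.map ρ σ)) ρ)
    branch ρ₁ zero d≡ w≡ k bd₁ rewrite sym w≡ =
      does-ite-false (positive-zero {ρ = ρ₁} (fit-right fit) d≡)
        (weaken (code-correct b bd₁ bl (fit-right {limit a d} fit-ab)) (ℕ.m≤n+m _ (time (cost a)))
          λ (eq , k′ , bd₂) → trans eq (cong (eval b) (keeps-map bl k)) , keeps-trans ℕ.≤-refl k k′ , bd₂)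
    branch ρ₁ (suc w) d≡ w≡ k bd₁ rewrite sym w≡ =
      does-ite-true (positive-suc {ρ = ρ₁} (fit-right fit) d≡)
        (weaken (code-correct a bd₁ bl (fit-left {limit a d} fit-ab)) (ℕ.m≤m+n (time (cost a)) _)
          λ (eq , k′ , bd₂) → trans eq (cong (eval a) (keeps-map bl k)) , keeps-trans ℕ.≤-refl k k′ , bd₂)
  code-correct (rec {m} n′ z s) {σ} {d} {ρ} bd bl fit =
    code-correct n′ bd bl (fit-left {b = limit z (1 + d) ⊔ limit s (2 + d)} (fit-left fit)) then
      λ {ρ₁} (eq₁ , k₁ , bd₁) →
    code-correct z {d ∷ σ} bd₁ (ℕ.≤-refl ∷ below-suc bl) (fit-left {limit z (1 + d)} fit-zs) then
      λ {ρ₂} (eq₂ , k₂ , bd₂) →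
    does-while
      -- Instead of describing partial results, the invariant says that the remaining rounds lead
      -- from the accumulator to the final value.
      (λ j ρ′ → ρ′ d ≡ j × iter F j (ρ′ (1 + d)) ≡ target × Keeps d ρ ρ′ × Bounded ρ′)
      (λ (eq , _) → positive-zero d<M eq)
      (λ {j} {ρ₃} (eq , it , k , b) →
        positive-suc d<M eq ,
        (does-left d<M eq (subst (_≤ N) eq (b d)) then λ {ρ₄} h₄ →
         let (eq₄ , k₄ , bd₄) = sets⇒result b (ℕ.≤-trans (ℕ.n≤1+n j) (subst (_≤ N) eq (b d))) h₄ in
         code-correct s {1 + d ∷ d ∷ σ} bd₄ (ℕ.≤-refl ∷ ℕ.m≤n⇒m≤1+n ℕ.≤-refl ∷ below-suc (below-suc bl))
           (fit-right {limit z (1 + d)} fit-zs) then λ {ρ₅} (eq₅ , k₅ , bd₅) →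
         post (does-transfer d2<M d1<M (λ ()) bd₅) λ {ρ₆} h₆ →
         let (eq₆ , k₆ , bd₆) = transfers⇒result bd₅ ℕ.≤-refl h₆
             env : ρ₄ (1 + d) ∷ ρ₄ d ∷ Vec.map ρ₄ σ ≡ ρ₃ (1 + d) ∷ j ∷ Vec.map ρ σ
             env = cong₂ _∷_ (proj₂ h₄ (1 + d) (λ ())) (cong₂ _∷_ eq₄
                     (keeps-map bl (keeps-trans ℕ.≤-refl k k₄)))
         in trans (k₆ d ℕ.≤-refl) (trans (k₅ d (ℕ.m≤n⇒m≤1+n ℕ.≤-refl)) eq₄) ,
            trans (cong (iter F j) (trans eq₆ (trans eq₅ (cong (eval s) env)))) it ,
            keeps-trans ℕ.≤-refl k (keeps-trans ℕ.≤-refl k₄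
              (λ i i<d → let i≤d = ℕ.m≤n⇒m≤1+n i<d in
                trans (k₆ i i≤d) (k₅ i (ℕ.m≤n⇒m≤1+n i≤d)))) ,
            bd₆))
      (bd₂ d)
      (refl ,
       cong₂ (iter F) (trans (k₂ d ℕ.≤-refl) eq₁)
         (trans eq₂ (cong (eval z) (cong₂ _∷_ eq₁ (keeps-map bl k₁)))) ,
       keeps-trans (ℕ.n≤1+n d) k₁ k₂ ,
       bd₂) then
      λ {ρ₃} (eq₃ , it , k₃ , bd₃) →
    post (does-transfer d1<M d<M (λ ()) bd₃) λ h₄ →
    let (eq₄ , k₄ , bd₄) = transfers⇒result bd₃ ℕ.≤-refl h₄ in
    trans eq₄ it , keeps-trans ℕ.≤-refl k₃ k₄ , bd₄
    where
    F : ℕ → ℕ → ℕ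
    F j a = eval s (a ∷ j ∷ Vec.map ρ σ)
    target : ℕ
    target = eval (rec n′ z s) (Vec.map ρ σ)
    fit-zs : limit z (1 + d) ⊔ limit s (2 + d) ≤ M
    fit-zs = fit-right {limit n′ d} (fit-left fit)
    d2<M : 2 + d < M
    d2<M = fit-right fit
    d1<M : 1 + d < M
    d1<M = ℕ.<⇒≤ d2<M
    d<M : d < M
    d<M = ℕ.<⇒≤ d1<M
  code-correct (call {n = n′} f ts) {σ} {d} {ρ} bd bl fit =
    codes-correct ts bd bl (fit-left {limits ts d} (fit-left fit)) then
      λ {ρ₁} (eq₁ , k₁ , bd₁) →
    code-correct f bd₁ (iota-below d (suc n′)) (fit-right {limits ts d} (fit-left fit)) then
      λ {ρ₂} (eq₂ , k₂ , bd₂) →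
    post (does-transfer (fit-right fit) (ℕ.<-trans d<d+n (fit-right fit)) (ℕ.<⇒≢ d<d+n ∘ sym) bd₂) λ h₃ →
    let (eq₃ , k₃ , bd₃) = transfers⇒result bd₂ d<d+n h₃ in
    trans eq₃ (trans eq₂ (cong (eval f) eq₁)) ,
    keeps-trans ℕ.≤-refl k₁ (λ i i<d → trans (k₃ i i<d) (k₂ i (ℕ.<-trans i<d d<d+n))) ,
    bd₃
    where
    d<d+n : d < d + suc n′
    d<d+n = ℕ.m<m+n d (s≤s z≤n)

  codes-correct [] {ρ = ρ} bd bl fit =
    post (does-noop ρ) λ { refl → refl , (λ _ _ → refl) , bd }
  codes-correct (t ∷ ts) {σ} {d} {ρ} bd bl fit =
    code-correct t bd bl (fit-left {limit t d} fit) then λ {ρ₁} (eq₁ , k₁ , bd₁) →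
    post (codes-correct ts bd₁ (below-suc bl) (fit-right {limit t d} fit)) λ {ρ₂} (eq₂ , k₂ , bd₂) →
      cong₂ _∷_ (trans (k₂ d ℕ.≤-refl) eq₁) (trans eq₂ (cong (evals ts) (keeps-map bl k₁))) ,
      keeps-trans (ℕ.n≤1+n d) k₁ k₂ ,
      bd₂

-- Correctness of the first phase

module Setup (x u : List Bool) (M : ℕ) where
  open Word x u
  open Commands M

  tail : List Bool → List Bool
  tail []       = []
  tail (_ ∷ bs) = bs

  -- A head beyond its input scans a blank and goes on doing so, which allows the shorter input to
  -- be scanned along with the longer one.
  suffix : List (Symbol Mark) → List Bool → Tape Mark
  suffix l []       = tape l blank []
  suffix l (b ∷ bs) = tape l (bit b) (List.map bit bs)

  inputTape-suffix : ∀ bs → inputTape bs ≡ suffix [] bs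
  inputTape-suffix []       = refl
  inputTape-suffix (b ∷ bs) = refl

  right-suffix : ∀ l bs → moveHead goRight (suffix l bs) ≡ suffix (scanned (suffix l bs) ∷ l) (tail bs)
  right-suffix l []           = refl
  right-suffix l (b ∷ [])     = refl
  right-suffix l (b ∷ c ∷ bs) = refl

  bitOf-suffix : ∀ l bs → bitOf (scanned (suffix l bs)) ≡ bs ! 0
  bitOf-suffix l []       = refl
  bitOf-suffix l (b ∷ bs) = refl

  tail-! : ∀ bs j → tail bs ! j ≡ bs ! suc j
  tail-! []       j = refl
  tail-! (b ∷ bs) j = refl

  perform-replicate : ∀ m (o : Symbol Mark × HeadMove) t →
    zipWith update (Vec.map (λ _ → o) (Vec.map scanned (Vec.replicate m t))) (Vec.replicate m t)
      ≡ Vec.replicate m (update o t)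
  perform-replicate zero    o t = refl
  perform-replicate (suc m) o t = cong (update o t ∷_) (perform-replicate m o t)

  regs-const : ∀ m v → regs m (λ _ → v) ≡ Vec.replicate m (tapeAt v)
  regs-const zero    v = refl
  regs-const (suc m) v = cong (tapeAt v ∷_) (regs-const m v)

  stage : List (Symbol Mark) → List (Symbol Mark) → List Bool → List Bool → Tape Mark → Tapes
  stage l l′ bs cs t = suffix l bs ∷ suffix l′ cs ∷ Vec.replicate M t

  does-uniform : ∀ w h h′ a b (t : Tape Mark) →
    Exec (uniform w h h′) (a ∷ b ∷ Vec.replicate M t) 1
      (moveHead h a ∷ moveHead h b ∷
       Vec.replicate M (update (work (w (scanned a) (scanned b)) , h′) t))
  does-uniform w h h′ a b t =
    subst (λ ts → Exec (uniform w h h′) (a ∷ b ∷ Vec.replicate M t) 1 (moveHead h a ∷ moveHead h b ∷ ts))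
      (perform-replicate M (work (w (scanned a) (scanned b)) , h′) t) act

  written : ℕ → Tape Mark
  written i = tape (below (suc i)) blank []

  Copy : Program
  Copy = uniform (λ a b → datum (bitOf a) (bitOf b)) goRight goRight

  copy-one : ∀ i l l′ bs cs → (∀ j → bs ! j ≡ x ! (i + j)) → (∀ j → cs ! j ≡ u ! (i + j)) → i < n →
    ∃[ k ] ∃[ k′ ] Exec Copy (stage l l′ bs cs (written i)) 1 (stage k k′ (tail bs) (tail cs) (written (suc i)))
  copy-one i l l′ bs cs hx hu i<n =
    _ , _ , subst (Exec Copy _ 1) eq (does-uniform _ goRight goRight (suffix l bs) (suffix l′ cs) (written i))
    where
    headBit : ∀ l bs (w : List Bool) → (∀ j → bs ! j ≡ w ! (i + j)) → bitOf (scanned (suffix l bs)) ≡ w ! i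
    headBit l bs w h = trans (bitOf-suffix l bs) (trans (h 0) (cong (w !_) (ℕ.+-identityʳ i)))
    eq : moveHead goRight (suffix l bs) ∷ moveHead goRight (suffix l′ cs) ∷
         Vec.replicate M (update (work (datum (bitOf (scanned (suffix l bs))) (bitOf (scanned (suffix l′ cs)))) , goRight) (written i))
         ≡ stage _ _ (tail bs) (tail cs) (written (suc i))
    eq = cong₂ _∷_ (right-suffix l bs) (cong₂ _∷_ (right-suffix l′ cs)
           (cong (λ d → Vec.replicate M (tape (work d ∷ below (suc i)) blank []))
             (trans (cong₂ datum (headBit l bs x hx) (headBit l′ cs u hu)) (sym (content-data i<n)))))

  copy-all : ∀ k i l l′ bs cs → (∀ j → bs ! j ≡ x ! (i + j)) → (∀ j → cs ! j ≡ u ! (i + j)) →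
    k ≡ length bs ⊔ length cs → n ≡ i + k →
    ∃[ xt ] ∃[ ut ] ∃[ m ]
      (Exec (while unread Copy) (stage l l′ bs cs (written i)) m
         (xt ∷ ut ∷ Vec.replicate M (written n)) × m ≤ 1 + k * 2)
  copy-all zero i l l′ [] [] hx hu k≡ n≡ =
    _ , _ , 1 , subst (λ v → Exec _ (stage l l′ [] [] (written i)) 1 (_ ∷ _ ∷ Vec.replicate M (written v)))
                  (sym (trans n≡ (ℕ.+-identityʳ i))) (while-stop refl) , ℕ.≤-refl
  copy-all zero i l l′ []       (_ ∷ _) hx hu () n≡
  copy-all zero i l l′ (_ ∷ _)  []      hx hu () n≡
  copy-all zero i l l′ (_ ∷ _)  (_ ∷ _) hx hu () n≡
  copy-all (suc k) i l l′ bs cs hx hu k≡ n≡ = continued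
    where
    i<n : i < n
    i<n = subst (i <_) (sym n≡) (ℕ.m<m+n i (s≤s z≤n))
    shift! : ∀ bs w → (∀ j → bs ! j ≡ w ! (i + j)) → ∀ j → tail bs ! j ≡ w ! (suc i + j)
    shift! bs w h j = trans (tail-! bs j) (trans (h (suc j)) (cong (w !_) (ℕ.+-suc i j)))
    tails : ∀ bs cs → suc k ≡ length bs ⊔ length cs → k ≡ length (tail bs) ⊔ length (tail cs)
    tails []       (c ∷ cs) eq = ℕ.suc-injective eq
    tails (b ∷ bs) []       eq = trans (ℕ.suc-injective eq) (sym (ℕ.⊔-identityʳ _))
    tails (b ∷ bs) (c ∷ cs) eq = ℕ.suc-injective eq
    going : ∀ bs cs → suc k ≡ length bs ⊔ length cs →
            isBit (scanned (suffix l bs)) ∨ isBit (scanned (suffix l′ cs)) ≡ true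
    going []       (c ∷ cs) eq = refl
    going (b ∷ bs) cs       eq = refl
    continued : ∃[ xt ] ∃[ ut ] ∃[ m ]
      (Exec (while unread Copy) (stage l l′ bs cs (written i)) m
         (xt ∷ ut ∷ Vec.replicate M (written n)) × m ≤ 1 + suc k * 2)
    continued with copy-one i l l′ bs cs hx hu i<n
    ... | _ , _ , e with copy-all k (suc i) _ _ (tail bs) (tail cs) (shift! bs x hx) (shift! cs u hu)
                           (tails bs cs k≡) (trans n≡ (ℕ.+-suc i k))
    ...   | xt , ut , m , e′ , le = xt , ut , _ , while-go (going bs cs k≡) e e′ , s≤s (s≤s le)

  written-end : update (work endMark , stay) (written n) ≡ tapeAt N
  written-end rewrite content-end (ℕ.<-irrefl {n} refl) | ℕ.n∸n≡0 n = refl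

  -- The heads are left on the end marker, so every register begins with the value `N`, not with
  -- zero; `code-correct` accepts any bounded contents.
  setup-correct : ∃[ xt ] ∃[ ut ] ∃[ m ]
    (Exec setup (inputTape x ∷ inputTape u ∷ Vec.replicate M blankTape) m (xt ∷ ut ∷ regs M (λ _ → N))
     × m ≤ 1 + (loopTime 1 + 1))
  setup-correct with copy-all n 0 [] [] x u (λ _ → refl) (λ _ → refl) refl refl
  ... | xt , ut , m , e , le = xt , ut , _ ,
    seq first (seq e last) ,
    ℕ.+-monoʳ-≤ 1 (ℕ.+-monoˡ-≤ 1 (ℕ.≤-trans le
      (s≤s (ℕ.*-monoˡ-≤ 2 (ℕ.≤-trans (ℕ.n≤1+n n) N≤K)))))
    where
    first : Exec _ (inputTape x ∷ inputTape u ∷ Vec.replicate M blankTape) 1 (stage [] [] x u (written 0))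
    first = subst₂ (λ a b → Exec _ (inputTape x ∷ inputTape u ∷ Vec.replicate M blankTape) 1
                              (a ∷ b ∷ Vec.replicate M (written 0)))
              (inputTape-suffix x) (inputTape-suffix u)
              (does-uniform _ stay goRight (inputTape x) (inputTape u) blankTape)
    last : Exec _ (xt ∷ ut ∷ Vec.replicate M (written n)) 1 (xt ∷ ut ∷ regs M (λ _ → N))
    last = subst (λ ts → Exec _ (xt ∷ ut ∷ Vec.replicate M (written n)) 1 (xt ∷ ut ∷ ts))
             (trans (cong (Vec.replicate M) written-end) (sym (regs-const M N)))
             (does-uniform _ stay stay xt ut (written n))

-- The machine that decides a term

isPositive : ℕ → Bool
isPositive zero    = false
isPositive (suc _) = true

module Decider (t : Term 0) where

  M : ℕ
  -- The successor makes it evident that register 0, which holds the verdict, exists.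
  M = suc (limit t 0)

  open Commands M using (positive; setup; _⨾_)
  open Code M using (code)

  verifying : Commands.Program M
  verifying = setup ⨾ code t [] 0

  decider : TuringMachine
  decider = machine Mark finite-Mark M verifying (positive 0)

  deciderTime : Polynomial
  -- The summands pay for the halting transition, the first phase and the evaluation of `t`.
  deciderTime = con 1 ⊕ ((con 1 ⊕ (loopᵖ (con 1) ⊕ con 1)) ⊕ cost t)

  module _ (x u : List Bool) where
    open Word x u
    open Evaluation x u

    Finishes : ℕ → Bool → Set
    Finishes time b = ∃[ m ] ∃[ ts ]
      (Commands.Exec M verifying (inputTape x ∷ inputTape u ∷ Vec.replicate M blankTape) m ts ×
       m < time × positive 0 (Commands.heads M ts) ≡ b)

    finishes⇒run : ∀ {time b} → Finishes time b → TuringMachine.run decider time x u ≡ just b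
    finishes⇒run (m , ts , e , le , refl) = exec⇒run Mark finite-Mark M verifying (positive 0) e le

    finishes : Finishes (⟦ deciderTime ⟧ (length x + length u)) (isPositive (eval t []))
    finishes with Setup.setup-correct x u M
    ... | xt , ut , m , e , le
        with CodeCorrect.code-correct x u M xt ut t {[]} {0} {λ _ → N} (λ _ → ℕ.≤-refl) [] (ℕ.n≤1+n _)
    ...   | m′ , ρ′ , e′ , le′ , (eq , _) =
      m + m′ , xt ∷ ut ∷ regs M ρ′ , Commands.seq e e′ , s≤s (ℕ.+-mono-≤ le le′) ,
      trans (positive-isPositive (ρ′ 0) refl) (cong isPositive eq)
      where
      open Semantics M xt ut using (config; positive-zero; positive-suc; heads)
      positive-isPositive : ∀ v → ρ′ 0 ≡ v → positive 0 (heads (config ρ′)) ≡ isPositive v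
      positive-isPositive zero    eq = positive-zero {ρ = ρ′} (s≤s z≤n) eq
      positive-isPositive (suc v) eq = positive-suc {ρ = ρ′} (s≤s z≤n) eq

    decider-correct : TuringMachine.run decider (⟦ deciderTime ⟧ (length x + length u)) x u
                        ≡ just (isPositive (eval t []))
    decider-correct = finishes⇒run {⟦ deciderTime ⟧ (length x + length u)} {isPositive (eval t [])} finishes

-- Arithmetic terms, exact as long as no value exceeds N

addTerm mulTerm monusTerm : Term 2
-- The start value is read in the environment extended by the value of the bound, so there
-- `var (suc zero)` is the first argument, while in the bound it is the second.
addTerm   = rec (var (suc zero)) (var (suc zero)) (suc (var zero))
mulTerm   = rec (var (suc zero)) zero (call addTerm (var zero ∷ var (suc (suc zero)) ∷ []))
monusTerm = rec (var (suc zero)) (var (suc zero)) (dec (var zero))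

infixl 6 _+ᵗ_ _∸ᵗ_
infixl 7 _*ᵗ_

_+ᵗ_ _*ᵗ_ _∸ᵗ_ : ∀ {m} → Term m → Term m → Term m
s +ᵗ t = call addTerm (s ∷ t ∷ [])
s *ᵗ t = call mulTerm (s ∷ t ∷ [])
s ∸ᵗ t = call monusTerm (s ∷ t ∷ [])

numeral : ∀ {m} → ℕ → Term m
numeral zero    = zero
numeral (suc k) = suc (numeral k)

trueIn : Maybe Bool → Bool
trueIn (just true) = true
trueIn _           = false

module _ (x u : List Bool) where
  open Evaluation x u

  private
    N : ℕ
    N = lastPosition x u

  iter-suc : ∀ b a → a + b ≤ N → iter (λ _ c → N ⊓ suc c) b a ≡ a + b
  iter-suc zero    a _  = sym (ℕ.+-identityʳ a)
  iter-suc (suc b) a le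
    rewrite ℕ.m≥n⇒m⊓n≡n {N} {suc a} (ℕ.≤-trans (s≤s (ℕ.m≤m+n a b)) (subst (_≤ N) (ℕ.+-suc a b) le)) =
    trans (iter-suc b (suc a) (subst (_≤ N) (ℕ.+-suc a b) le)) (sym (ℕ.+-suc a b))

  iter-add : ∀ b a c → c + b * a ≤ N →
             iter (λ _ d → iter (λ _ e → N ⊓ suc e) a d) b c ≡ c + b * a
  iter-add zero    a c _  = sym (ℕ.+-identityʳ c)
  iter-add (suc b) a c le
    rewrite iter-suc a c (ℕ.≤-trans (ℕ.+-monoʳ-≤ c (ℕ.m≤m+n a (b * a))) le) =
    trans (iter-add b a (c + a) (subst (_≤ N) (sym (ℕ.+-assoc c a (b * a))) le)) (ℕ.+-assoc c a (b * a))

  iter-pred : ∀ b a → iter (λ _ c → pred c) b a ≡ a ∸ b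
  iter-pred zero    a       = refl
  iter-pred (suc b) zero    = trans (iter-pred b zero) (ℕ.0∸n≡0 b)
  iter-pred (suc b) (suc a) = iter-pred b a

  eval-∸ : ∀ {m} (s t : Term m) ρ → eval (s ∸ᵗ t) ρ ≡ eval s ρ ∸ eval t ρ
  eval-∸ s t ρ = iter-pred (eval t ρ) (eval s ρ)

  module _ {m} {s t : Term m} {ρ : Vec ℕ m} {a b : ℕ} (s≡ : eval s ρ ≡ a) (t≡ : eval t ρ ≡ b) where

    eval-+ : a + b ≤ N → eval (s +ᵗ t) ρ ≡ a + b
    eval-+ le rewrite s≡ | t≡ = iter-suc b a le

    eval-* : a * b ≤ N → eval (s *ᵗ t) ρ ≡ a * b
    eval-* le rewrite s≡ | t≡ = trans (iter-add b a 0 (subst (_≤ N) (ℕ.*-comm a b) le)) (ℕ.*-comm b a)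

  eval-numeral : ∀ {m} {ρ : Vec ℕ m} k → k ≤ N → eval (numeral k) ρ ≡ k
  eval-numeral zero    _  = refl
  eval-numeral {ρ = ρ} (suc k) le rewrite eval-numeral {ρ = ρ} k (ℕ.<⇒≤ le) = ℕ.m≥n⇒m⊓n≡n le

-- The certificate 1ʷ 0 β, where β consists of w⁴ bits, represents the
-- three-dimensional array whose entry at (g, a, b) is the number of ones in
-- the block of w bits of β with number (g w + b) w + a.

-- The accumulator is itself the position that is read: it advances over the leading ones of the
-- certificate and then stops.
widthTerm : ∀ {m} → Term m
widthTerm = rec top zero (cond (query (λ _ → trueIn) (var zero)) (suc (var zero)) (var zero))

arrayTerm : ℕ → Term 2
arrayTerm g = rec widthTerm zero
  (cond (query (λ _ → trueIn)
          ((((numeral g *ᵗ widthTerm +ᵗ var (suc (suc (suc zero)))) *ᵗ widthTerm +ᵗ var (suc (suc zero)))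
            -- The last summand skips the prefix 1ʷ 0.
            *ᵗ widthTerm +ᵗ var (suc zero)) +ᵗ suc widthTerm))
    (suc (var zero)) (var zero))

Array : Set
Array = ℕ → ℕ → ℕ → ℕ

opaque
  -- Opaque, so that array entries in later types are not unfolded into runs of the evaluator;
  -- whatever depends on the layout goes through `certified-eval`.
  certified : List Bool → List Bool → Array
  certified x u g a b = Evaluation.eval x u (arrayTerm g) (a ∷ b ∷ [])

  certified-eval : ∀ x u g a b → certified x u g a b ≡ Evaluation.eval x u (arrayTerm g) (a ∷ b ∷ [])
  certified-eval x u g a b = refl

iter-bounded : ∀ {F B} → (∀ j a → a ≤ B → F j a ≤ B) → ∀ v {a} → a ≤ B → iter F v a ≤ B
iter-bounded h zero    le = le
iter-bounded h (suc v) le = iter-bounded h v (h v _ le)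

-- An entry is a saturating count, so this holds for malformed certificates too. It makes the
-- successor of any number below an entry exact.
certified-≤ : ∀ x u g a b → certified x u g a b ≤ lastPosition x u
certified-≤ x u g a b = ℕ.≤-trans (ℕ.≤-reflexive (certified-eval x u g a b))
  (iter-bounded (λ j c c≤ → either (trueIn (u ! _)) c c≤) (Evaluation.eval x u {2} widthTerm (a ∷ b ∷ [])) z≤n)
  where
  either : ∀ (t : Bool) c → c ≤ lastPosition x u →
           ifPositive (if t then 1 else 0) (lastPosition x u ⊓ suc c) c ≤ lastPosition x u
  either true  c c≤ = ℕ.m⊓n≤m _ (suc c)
  either false c c≤ = c≤

applyUpTo-! : ∀ {A : Set} (f : ℕ → A) n {i} → i < n → List.applyUpTo f n ! i ≡ just (f i)
applyUpTo-! f (suc n) {zero}  _         = refl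
applyUpTo-! f (suc n) {suc i} (s≤s i<n) = applyUpTo-! (f ∘ suc) n i<n

-- The certificate that tabulates a given array

module Table (w : ℕ) (A : Array) where

  W : ℕ
  W = suc w

  -- In base `W` the position has the digits `g`, `b`, `a`, `j`, from the highest to the lowest;
  -- each block of bits is an entry in unary, ones first.
  entryBit : ℕ → Bool
  entryBit z = (z ℕ.% W) <ᵇ
    A (z ℕ./ W ℕ./ W ℕ./ W) (z ℕ./ W ℕ.% W) (z ℕ./ W ℕ./ W ℕ.% W)

  bits : List Bool
  bits = List.applyUpTo entryBit (W * W * W * W)

  table : List Bool
  table = List.replicate W true List.++ false ∷ bits

  length-table : length table ≡ suc W + W * W * W * W
  length-table = trans (List.length-++ (List.replicate W true))
    (trans (cong₂ (λ a b → a + suc b) (List.length-replicate W) (List.length-applyUpTo entryBit (W * W * W * W)))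
           (ℕ.+-suc W _))

  digit-% : ∀ q {r} → r < W → (q * W + r) ℕ.% W ≡ r
  digit-% q {r} r<W = trans (cong (ℕ._% W) (ℕ.+-comm (q * W) r))
    (trans (ℕ.[m+kn]%n≡m%n r q W) (ℕ.m<n⇒m%n≡m r<W))

  digit-/ : ∀ q {r} → r < W → (q * W + r) ℕ./ W ≡ q
  digit-/ q {r} r<W = trans (ℕ.+-distrib-/-∣ˡ r (ℕ.n∣m*n q))
    (trans (cong₂ _+_ (ℕ.m*n/n≡m q W) (ℕ.m<n⇒m/n≡0 r<W)) (ℕ.+-identityʳ q))

  digit-< : ∀ {q Q r} → q < Q → r < W → q * W + r < Q * W
  digit-< {q} {Q} {r} q<Q r<W = ℕ.≤-trans (ℕ.+-monoʳ-< (q * W) r<W)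
    (ℕ.≤-trans (ℕ.≤-reflexive (ℕ.+-comm (q * W) W)) (ℕ.*-monoˡ-≤ W q<Q))

  ++-! : ∀ (xs ys : List Bool) i → (xs List.++ ys) ! (length xs + i) ≡ ys ! i
  ++-! []       ys i = refl
  ++-! (x ∷ xs) ys i = ++-! xs ys i

  replicate-! : ∀ n (ys : List Bool) {i} → i < n → (List.replicate n true List.++ ys) ! i ≡ just true
  replicate-! (suc n) ys {zero}  _         = refl
  replicate-! (suc n) ys {suc i} (s≤s i<n) = replicate-! n ys i<n

  table-end : table ! W ≡ just false
  table-end = subst (λ k → table ! k ≡ just false)
    (trans (ℕ.+-identityʳ _) (List.length-replicate W)) (++-! (List.replicate W true) (false ∷ bits) 0)

  table-bit : ∀ {z} → z < W * W * W * W → table ! (z + suc W) ≡ just (entryBit z)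
  table-bit {z} z< = trans
    (cong (table !_) (trans (ℕ.+-comm z (suc W))
      (trans (sym (ℕ.+-suc W z)) (cong (_+ suc z) (sym (List.length-replicate W))))))
    (trans (++-! (List.replicate W true) (false ∷ bits) (suc z)) (applyUpTo-! entryBit _ z<))

  module _ (x : List Bool) where
    open Evaluation x table

    private
      N : ℕ
      N = lastPosition x table

    table≤N : suc W + W * W * W * W ≤ N
    table≤N = ℕ.≤-trans (ℕ.≤-reflexive (sym length-table))
      (ℕ.≤-trans (ℕ.m≤n⊔m (length x) (length table)) (ℕ.n≤1+n _))

    W<N : W < N
    W<N = ℕ.≤-trans (ℕ.m≤m+n (suc W) _) table≤N

    iter-width : ∀ k a → a ≤ W → W ≤ k + a →
      iter (λ _ c → ifPositive (if trueIn (table ! c) then 1 else 0) (N ⊓ suc c) c) k a ≡ W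
    iter-width zero    a a≤W W≤ = ℕ.≤-antisym a≤W W≤
    iter-width (suc k) a a≤W W≤ with ℕ.m≤n⇒m<n∨m≡n a≤W
    ... | inj₁ a<W rewrite replicate-! W (false ∷ bits) a<W
                         | ℕ.m≥n⇒m⊓n≡n {N} {suc a} (ℕ.≤-trans a<W (ℕ.<⇒≤ W<N)) =
      iter-width k (suc a) a<W (ℕ.≤-trans W≤ (ℕ.≤-reflexive (sym (ℕ.+-suc k a))))
    ... | inj₂ refl rewrite table-end = iter-width k W a≤W (ℕ.m≤n+m W k)

    eval-width : ∀ {m} (ρ : Vec ℕ m) → eval widthTerm ρ ≡ W
    eval-width ρ = iter-width N 0 z≤n (ℕ.≤-trans (ℕ.<⇒≤ W<N) (ℕ.m≤m+n N 0))

    -- The rounds run through the numbers below `v`, and `v ⊓ c` of them lie below `c`; the count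
    -- stays within `W`, so the successor never saturates.
    iter-count : ∀ (F : ℕ → ℕ → ℕ) v {c} → c ≤ W → v ≤ W →
      (∀ j a → j < W → F j a ≡ ifPositive (if j <ᵇ c then 1 else 0) (N ⊓ suc a) a) →
      ∀ a → a + (v ⊓ c) ≤ W → iter F v a ≡ a + (v ⊓ c)
    iter-count F zero    c≤W v≤W h a le = sym (ℕ.+-identityʳ a)
    iter-count F (suc v) {c} c≤W v<W h a le rewrite h v a v<W with v <ᵇ c in eq
    ... | true =
      trans (cong (iter F v) (ℕ.m≥n⇒m⊓n≡n (ℕ.≤-trans sa≤W (ℕ.<⇒≤ W<N))))
        (trans (iter-count F v c≤W (ℕ.<⇒≤ v<W) h (suc a) (subst (_≤ W) step≡ le)) (sym step≡))
      where
      v<c : v < c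
      v<c = ℕ.<ᵇ⇒< v c (subst T (sym eq) tt)
      step≡ : a + (suc v ⊓ c) ≡ suc a + (v ⊓ c)
      step≡ = trans (cong (a +_) (trans (ℕ.m≤n⇒m⊓n≡m v<c) (cong suc (sym (ℕ.m≤n⇒m⊓n≡m (ℕ.<⇒≤ v<c))))))
                    (ℕ.+-suc a (v ⊓ c))
      sa≤W : suc a ≤ W
      sa≤W = ℕ.≤-trans (ℕ.m≤m+n (suc a) (v ⊓ c)) (subst (_≤ W) step≡ le)
    ... | false = trans (iter-count F v c≤W (ℕ.<⇒≤ v<W) h a (subst (_≤ W) step≡ le)) (sym step≡)
      where
      c≤v : c ≤ v
      c≤v = ℕ.≮⇒≥ λ v<c → subst T eq (ℕ.<⇒<ᵇ v<c)
      step≡ : a + (suc v ⊓ c) ≡ a + (v ⊓ c)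
      step≡ = cong (a +_) (trans (ℕ.m≥n⇒m⊓n≡n (ℕ.m≤n⇒m≤1+n c≤v)) (sym (ℕ.m≥n⇒m⊓n≡n c≤v)))

    certified-table : ∀ {g a b} → g < W → a < W → b < W → A g a b ≤ W → certified x table g a b ≡ A g a b
    certified-table {g} {a} {b} g<W a<W b<W A≤W =
      trans (certified-eval x table g a b) (trans (cong (λ v → iter F v 0) (eval-width {2} (a ∷ b ∷ [])))
        (trans (iter-count F W A≤W ℕ.≤-refl F≡ 0 (ℕ.m⊓n≤m W _)) (ℕ.m≥n⇒m⊓n≡n A≤W)))
      where
      position : ℕ → ℕ
      position j = ((g * W + b) * W + a) * W + j
      body : Term 4
      body = cond (query (λ _ → trueIn)
          ((((numeral g *ᵗ widthTerm +ᵗ var (suc (suc (suc zero)))) *ᵗ widthTerm +ᵗ var (suc (suc zero)))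
            *ᵗ widthTerm +ᵗ var (suc zero)) +ᵗ suc widthTerm))
        (suc (var zero)) (var zero)
      F : ℕ → ℕ → ℕ
      F j c = eval body (c ∷ j ∷ a ∷ b ∷ [])
      entry≡ : ∀ j → j < W → entryBit (position j) ≡ (j <ᵇ A g a b)
      entry≡ j j<W rewrite digit-% ((g * W + b) * W + a) j<W | digit-/ ((g * W + b) * W + a) j<W
                         | digit-% (g * W + b) a<W | digit-/ (g * W + b) a<W
                         | digit-% g b<W | digit-/ g b<W = refl
      position< : ∀ j → j < W → position j < W * W * W * W
      position< j j<W = digit-< (digit-< (digit-< g<W b<W) a<W) j<W
      F≡ : ∀ j c → j < W → F j c ≡ ifPositive (if j <ᵇ A g a b then 1 else 0) (N ⊓ suc c) c
      F≡ j c j<W = cong (λ d → ifPositive (if d then 1 else 0) (N ⊓ suc c) c)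
        (trans (cong (λ p → trueIn (table ! p)) position≡)
          (trans (cong trueIn (table-bit (position< j j<W))) (trans (trueIn-just _) (entry≡ j j<W))))
        where
        trueIn-just : ∀ b → trueIn (just b) ≡ b
        trueIn-just true  = refl
        trueIn-just false = refl
        ρ : Vec ℕ 4
        ρ = c ∷ j ∷ a ∷ b ∷ []
        -- Every intermediate value in the address is at most the address itself, which lies inside
        -- the table; hence no operation saturates.
        total≤N : position j + suc W ≤ N
        total≤N = ℕ.≤-trans (ℕ.+-monoˡ-≤ (suc W) (ℕ.<⇒≤ (position< j j<W)))
          (ℕ.≤-trans (ℕ.≤-reflexive (ℕ.+-comm _ (suc W))) table≤N)
        le₀ : position j ≤ N
        le₀ = ℕ.≤-trans (ℕ.m≤m+n _ _) total≤N
        le₁ : ((g * W + b) * W + a) * W ≤ N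
        le₁ = ℕ.≤-trans (ℕ.m≤m+n _ j) le₀
        le₂ : (g * W + b) * W + a ≤ N
        le₂ = ℕ.≤-trans (ℕ.m≤m*n _ W) le₁
        le₃ : (g * W + b) * W ≤ N
        le₃ = ℕ.≤-trans (ℕ.m≤m+n _ a) le₂
        le₄ : g * W + b ≤ N
        le₄ = ℕ.≤-trans (ℕ.m≤m*n _ W) le₃
        le₅ : g * W ≤ N
        le₅ = ℕ.≤-trans (ℕ.m≤m+n _ b) le₄
        w≡ : eval widthTerm ρ ≡ W
        w≡ = eval-width ρ
        g≡ : eval (numeral g) ρ ≡ g
        g≡ = eval-numeral x table {ρ = ρ} g (ℕ.≤-trans (ℕ.m≤m*n g W) le₅)
        sw≡ : eval (suc widthTerm) ρ ≡ suc W
        sw≡ = trans (cong (λ v → N ⊓ suc v) w≡) (ℕ.m≥n⇒m⊓n≡n W<N)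
        t₁ t₂ t₃ : Term 4
        t₁ = numeral g *ᵗ widthTerm +ᵗ var (suc (suc (suc zero)))
        t₂ = t₁ *ᵗ widthTerm +ᵗ var (suc (suc zero))
        t₃ = t₂ *ᵗ widthTerm +ᵗ var (suc zero)
        t₁≡ : eval t₁ ρ ≡ g * W + b
        t₁≡ = eval-+ x table {s = numeral g *ᵗ widthTerm} {t = var (suc (suc (suc zero)))} {ρ}
                (eval-* x table {s = numeral g} {t = widthTerm} {ρ} g≡ w≡ le₅) refl le₄
        t₂≡ : eval t₂ ρ ≡ (g * W + b) * W + a
        t₂≡ = eval-+ x table {s = t₁ *ᵗ widthTerm} {t = var (suc (suc zero))} {ρ}
                (eval-* x table {s = t₁} {t = widthTerm} {ρ} t₁≡ w≡ le₃) refl le₂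
        t₃≡ : eval t₃ ρ ≡ position j
        t₃≡ = eval-+ x table {s = t₂ *ᵗ widthTerm} {t = var (suc zero)} {ρ}
                (eval-* x table {s = t₂} {t = widthTerm} {ρ} t₂≡ w≡ le₁) refl le₀
        position≡ : eval (t₃ +ᵗ suc widthTerm) ρ ≡ position j + suc W
        position≡ = eval-+ x table {s = t₃} {t = suc widthTerm} {ρ} t₃≡ sw≡ total≤N

-- First-order formulas with bounded quantifiers over the first input and an array

data Expr (m : ℕ) : Set where
  ref     : Fin m → Expr m
  nil     : Expr m
  up down : Expr m → Expr m
  _∸ᵉ_    : Expr m → Expr m → Expr m
  arr     : ℕ → Expr m → Expr m → Expr m

infix  5 _≐_ _≺_ _is_
infixr 3 _∧ᶠ_
infixr 2 _∨ᶠ_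
infixr 1 _⇒ᶠ_

-- Constants enter only through `_is_`, which counts down: a numeral built with `up` would saturate
-- when the word is short. `app` is substitution kept as syntax, so a formula is written once for
-- its own parameters.
data Formula : ℕ → Set where
  _≐_ _≺_        : ∀ {m} → Expr m → Expr m → Formula m
  _is_           : ∀ {m} → Expr m → ℕ → Formula m
  bitAt          : ∀ {m} → Bool → Expr m → Formula m
  _∧ᶠ_ _∨ᶠ_ _⇒ᶠ_ : ∀ {m} → Formula m → Formula m → Formula m
  ¬ᶠ_            : ∀ {m} → Formula m → Formula m
  some every     : ∀ {m} → Expr m → Formula (suc m) → Formula m
  app            : ∀ {m n} → Formula (suc n) → Vec (Expr m) (suc n) → Formula m

module Meaning (x : List Bool) (N : ℕ) (G : Array) where

  value : ∀ {m} → Expr m → Vec ℕ m → ℕ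
  value (ref i)     ρ = lookup ρ i
  value nil         ρ = 0
  value (up e)      ρ = N ⊓ suc (value e ρ)
  value (down e)    ρ = pred (value e ρ)
  value (e ∸ᵉ f)    ρ = value e ρ ∸ value f ρ
  value (arr g e f) ρ = G g (value e ρ) (value f ρ)

  values : ∀ {m n} → Vec (Expr m) n → Vec ℕ m → Vec ℕ n
  values []       ρ = []
  values (e ∷ es) ρ = value e ρ ∷ values es ρ

  Holds : ∀ {m} → Formula m → Vec ℕ m → Set
  Holds (e ≐ f)     ρ = value e ρ ≡ value f ρ
  Holds (e ≺ f)     ρ = value e ρ < value f ρ
  Holds (e is k)    ρ = value e ρ ≡ k
  Holds (bitAt b e) ρ = x ! value e ρ ≡ just b
  Holds (φ ∧ᶠ ψ)    ρ = Holds φ ρ × Holds ψ ρ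
  Holds (φ ∨ᶠ ψ)    ρ = Holds φ ρ ⊎ Holds ψ ρ
  Holds (φ ⇒ᶠ ψ)    ρ = Holds φ ρ → Holds ψ ρ
  Holds (¬ᶠ φ)      ρ = ¬ Holds φ ρ
  Holds (some e φ)  ρ = ∃[ i ] (i < value e ρ × Holds φ (i ∷ ρ))
  Holds (every e φ) ρ = ∀ i → i < value e ρ → Holds φ (i ∷ ρ)
  Holds (app φ es)  ρ = Holds φ (values es ρ)

-- Translation of formulas into terms

exprTerm  : ∀ {m} → Expr m → Term m
exprTerm (ref i)     = var i
exprTerm nil         = zero
exprTerm (up e)      = suc (exprTerm e)
exprTerm (down e)    = dec (exprTerm e)
exprTerm (e ∸ᵉ f)    = exprTerm e ∸ᵗ exprTerm f
exprTerm (arr g e f) = call (arrayTerm g) (exprTerm e ∷ exprTerm f ∷ [])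

exprTerms : ∀ {m n} → Vec (Expr m) n → Vec (Term m) n
exprTerms []       = []
exprTerms (e ∷ es) = exprTerm e ∷ exprTerms es

one : ∀ {m} → Term m
one = suc zero

notTerm : ∀ {m} → Term m → Term m
notTerm t = cond t zero one

isTerm : ∀ {m} → ℕ → Term m → Term m
isTerm zero    t = notTerm t
isTerm (suc k) t = cond t (isTerm k (dec t)) zero

hasBit : Bool → Maybe Bool → Bool
hasBit true  (just true)  = true
hasBit false (just false) = true
hasBit _     _            = false

-- In the body of rec, the accumulator precedes the loop variable.
someTerm : ∀ {m} → Term m → Term (suc m) → Term m
someTerm n t =
  rec n zero (cond (var zero) one (call t (tabulate (λ i → var (suc i)))))

formulaTerm : ∀ {m} → Formula m → Term m
formulaTerm (e ≐ f)     = cond (exprTerm e ∸ᵗ exprTerm f) zero (notTerm (exprTerm f ∸ᵗ exprTerm e))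
formulaTerm (e ≺ f)     = exprTerm f ∸ᵗ exprTerm e
formulaTerm (e is k)    = isTerm k (exprTerm e)
formulaTerm (bitAt b e) = query (λ c _ → hasBit b c) (exprTerm e)
formulaTerm (φ ∧ᶠ ψ)    = cond (formulaTerm φ) (formulaTerm ψ) zero
formulaTerm (φ ∨ᶠ ψ)    = cond (formulaTerm φ) one (formulaTerm ψ)
formulaTerm (φ ⇒ᶠ ψ)    = cond (formulaTerm φ) (formulaTerm ψ) one
formulaTerm (¬ᶠ φ)      = notTerm (formulaTerm φ)
formulaTerm (some e φ)  = someTerm (exprTerm e) (formulaTerm φ)
formulaTerm (every e φ) = notTerm (someTerm (exprTerm e) (notTerm (formulaTerm φ)))
formulaTerm (app φ es)  = call (formulaTerm φ) (exprTerms es)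

-- Ties a value to the proposition it stands for; matching on it yields correctness and a decision
-- at once.
data Truth (P : Set) : ℕ → Set where
  holds : ∀ {v} → P → Truth P (suc v)
  fails : ¬ P → Truth P 0

truth-map : ∀ {P Q : Set} {v} → (P → Q) → (Q → P) → Truth P v → Truth Q v
truth-map f g (holds p)  = holds (f p)
truth-map f g (fails ¬p) = fails (¬p ∘ g)

module Translation (x u : List Bool) where
  open Evaluation x u
  open Meaning x (lastPosition x u) (certified x u)

  exprTerm-correct : ∀ {m} (e : Expr m) ρ → eval (exprTerm e) ρ ≡ value e ρ
  exprTerm-correct (ref i)     ρ = refl
  exprTerm-correct nil         ρ = refl
  exprTerm-correct (up e)      ρ = cong (λ v → lastPosition x u ⊓ suc v) (exprTerm-correct e ρ)
  exprTerm-correct (down e)    ρ = cong pred (exprTerm-correct e ρ)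
  exprTerm-correct (e ∸ᵉ f)    ρ = trans (eval-∸ x u (exprTerm e) (exprTerm f) ρ)
    (cong₂ _∸_ (exprTerm-correct e ρ) (exprTerm-correct f ρ))
  exprTerm-correct (arr g e f) ρ = trans (sym (certified-eval x u g _ _)) (cong₂ (certified x u g) (exprTerm-correct e ρ) (exprTerm-correct f ρ))

  exprTerms-correct : ∀ {m n} (es : Vec (Expr m) n) ρ → evals (exprTerms es) ρ ≡ values es ρ
  exprTerms-correct []       ρ = refl
  exprTerms-correct (e ∷ es) ρ = cong₂ _∷_ (exprTerm-correct e ρ) (exprTerms-correct es ρ)

  evals-tabulate : ∀ {m n} (f : Fin n → Fin m) ρ →
                   evals (tabulate (λ i → var (f i))) ρ ≡ tabulate (λ i → lookup ρ (f i))
  evals-tabulate {n = zero}  f ρ = refl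
  evals-tabulate {n = suc n} f ρ = cong (lookup ρ (f zero) ∷_) (evals-tabulate (f ∘ suc) ρ)

  truth-∸ : ∀ {v w} z → z ≡ w ∸ v → Truth (v < w) z
  truth-∸ {v} {w} zero    eq = fails λ v<w → ℕ.<⇒≱ v<w (ℕ.m∸n≡0⇒m≤n (sym eq))
  truth-∸ {v} {w} (suc z) eq = holds (ℕ.≰⇒> λ w≤v → case trans eq (ℕ.m≤n⇒m∸n≡0 w≤v) of λ ())

  truth-eq : ∀ {v w} z z′ → z ≡ v ∸ w → z′ ≡ w ∸ v →
             Truth (v ≡ w) (ifPositive z 0 (ifPositive z′ 0 1))
  truth-eq {v} {w} zero    zero    eq eq′ =
    holds (ℕ.≤-antisym (ℕ.m∸n≡0⇒m≤n (sym eq)) (ℕ.m∸n≡0⇒m≤n (sym eq′)))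
  truth-eq {v}     zero    (suc z) eq eq′ = fails λ { refl → case trans eq′ (ℕ.n∸n≡0 v) of λ () }
  truth-eq {v}     (suc z) z′      eq eq′ = fails λ { refl → case trans eq (ℕ.n∸n≡0 v) of λ () }

  truth-one : ∀ {P : Set} → P → Truth P (lastPosition x u ⊓ 1)
  truth-one p rewrite ℕ.⊓-zeroʳ (wordLength x u) = holds p

  truth-not : ∀ {P v} → Truth P v → Truth (¬ P) (ifPositive v 0 (lastPosition x u ⊓ 1))
  truth-not (holds p)  = fails (λ ¬p → ¬p p)
  truth-not (fails ¬p) = truth-one ¬p

  truth-is : ∀ k {m} (t : Term m) ρ → Truth (eval t ρ ≡ k) (eval (isTerm k t) ρ)
  truth-is zero t ρ with eval t ρ
  ... | zero  = truth-one refl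
  ... | suc v = fails λ ()
  truth-is (suc k) t ρ with eval t ρ | truth-is k (dec t) ρ
  ... | zero  | _  = fails λ ()
  ... | suc v | th = truth-map (cong suc) ℕ.suc-injective th

  truth-bit : ∀ b c → Truth (c ≡ just b) (if hasBit b c then 1 else 0)
  truth-bit true  (just true)  = holds refl
  truth-bit true  (just false) = fails λ ()
  truth-bit true  nothing      = fails λ ()
  truth-bit false (just true)  = fails λ ()
  truth-bit false (just false) = holds refl
  truth-bit false nothing      = fails λ ()

  -- `A` is what the accumulator already stands for. It has to vary, because each round first
  -- absorbs `P v` into the accumulator and then iterates on.
  truth-iter : ∀ {P : ℕ → Set} (F : ℕ → ℕ → ℕ) (f : ℕ → ℕ) → (∀ j → Truth (P j) (f j)) →
    (∀ j a → F j a ≡ ifPositive a (lastPosition x u ⊓ 1) (f j)) →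
    ∀ v {A a} → Truth A a → Truth (A ⊎ ∃[ i ] (i < v × P i)) (iter F v a)
  truth-iter F f th F≡ zero ta = truth-map inj₁ (λ { (inj₁ a) → a ; (inj₂ (_ , () , _)) }) ta
  truth-iter {P} F f th F≡ (suc v) {A} {a} ta =
    truth-map split join (truth-iter F f th F≡ v (subst (Truth (A ⊎ P v)) (sym (F≡ v a)) (step′ ta (th v))))
    where
    step′ : ∀ {a b} → Truth A a → Truth (P v) b → Truth (A ⊎ P v) (ifPositive a (lastPosition x u ⊓ 1) b)
    step′ (holds a)  tb = truth-one (inj₁ a)
    step′ (fails ¬a) tb = truth-map inj₂ [ (λ a → contradiction a ¬a) , id ]′ tb
    split : (A ⊎ P v) ⊎ ∃[ i ] (i < v × P i) → A ⊎ ∃[ i ] (i < suc v × P i)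
    split (inj₁ (inj₁ a))       = inj₁ a
    split (inj₁ (inj₂ p))       = inj₂ (v , ℕ.≤-refl , p)
    split (inj₂ (i , i<v , p)) = inj₂ (i , ℕ.m≤n⇒m≤1+n i<v , p)
    join : A ⊎ ∃[ i ] (i < suc v × P i) → (A ⊎ P v) ⊎ ∃[ i ] (i < v × P i)
    join (inj₁ a) = inj₁ (inj₁ a)
    join (inj₂ (i , s≤s i≤v , p)) with ℕ.m≤n⇒m<n∨m≡n i≤v
    ... | inj₁ i<v  = inj₂ (i , i<v , p)
    ... | inj₂ refl = inj₁ (inj₂ p)

  truth-some : ∀ {m} (n : Term m) (t : Term (suc m)) ρ {P : ℕ → Set} →
    (∀ j → Truth (P j) (eval t (j ∷ ρ))) →
    Truth (∃[ i ] (i < eval n ρ × P i)) (eval (someTerm n t) ρ)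
  truth-some n t ρ th =
    truth-map (λ { (inj₁ ()) ; (inj₂ p) → p }) inj₂
      (truth-iter _ (λ j → eval t (j ∷ ρ)) th
        (λ j a → cong (ifPositive a (lastPosition x u ⊓ 1))
          (cong (eval t) (trans (evals-tabulate suc (a ∷ j ∷ ρ)) (Vec.tabulate∘lookup (j ∷ ρ)))))
        (eval n ρ) (fails {⊥} id))

  truth-formula : ∀ {m} (φ : Formula m) ρ → Truth (Holds φ ρ) (eval (formulaTerm φ) ρ)
  truth-formula (e ≐ f) ρ =
    subst (Truth (value e ρ ≡ value f ρ))
      (cong (λ k → ifPositive (eval (exprTerm e ∸ᵗ exprTerm f) ρ) 0 (ifPositive (eval (exprTerm f ∸ᵗ exprTerm e) ρ) 0 k))
        (cong suc (sym (ℕ.⊓-zeroʳ (wordLength x u)))))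
      (truth-eq _ _ (difference e f) (difference f e))
    where
    difference : ∀ e f → eval (exprTerm e ∸ᵗ exprTerm f) ρ ≡ value e ρ ∸ value f ρ
    difference e f = exprTerm-correct (e ∸ᵉ f) ρ
  truth-formula (e ≺ f)     ρ = truth-∸ _ (exprTerm-correct (f ∸ᵉ e) ρ)
  truth-formula (e is k)    ρ = subst (λ v → Truth (v ≡ k) (eval (isTerm k (exprTerm e)) ρ))
                                  (exprTerm-correct e ρ) (truth-is k (exprTerm e) ρ)
  truth-formula (bitAt b e) ρ rewrite exprTerm-correct e ρ = truth-bit b (x ! value e ρ)
  truth-formula (φ ∧ᶠ ψ)    ρ with eval (formulaTerm φ) ρ | truth-formula φ ρ
  ... | _ | holds p  = truth-map (p ,_) proj₂ (truth-formula ψ ρ)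
  ... | _ | fails ¬p = fails (¬p ∘ proj₁)
  truth-formula (φ ∨ᶠ ψ)    ρ with eval (formulaTerm φ) ρ | truth-formula φ ρ
  ... | _ | holds p  = truth-one (inj₁ p)
  ... | _ | fails ¬p = truth-map inj₂ [ (λ p → contradiction p ¬p) , id ]′ (truth-formula ψ ρ)
  truth-formula (φ ⇒ᶠ ψ)    ρ with eval (formulaTerm φ) ρ | truth-formula φ ρ
  ... | _ | holds p  = truth-map (λ q _ → q) (λ f → f p) (truth-formula ψ ρ)
  ... | _ | fails ¬p = truth-one (λ p → contradiction p ¬p)
  truth-formula (¬ᶠ φ)      ρ = truth-not (truth-formula φ ρ)
  truth-formula (some e φ)  ρ =
    subst (λ v → Truth (∃[ i ] (i < v × Holds φ (i ∷ ρ))) (eval (formulaTerm (some e φ)) ρ))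
      (exprTerm-correct e ρ)
      (truth-some (exprTerm e) (formulaTerm φ) ρ (λ j → truth-formula φ (j ∷ ρ)))
  truth-formula (every e φ) ρ =
    truth-map
      (λ none i i< → stable (truth-formula φ (i ∷ ρ)) λ ¬p → none (i , subst (i <_) (sym (exprTerm-correct e ρ)) i< , ¬p))
      (λ { all (i , i< , ¬p) → ¬p (all i (subst (i <_) (exprTerm-correct e ρ) i<)) })
      (truth-not (truth-some (exprTerm e) (notTerm (formulaTerm φ)) ρ
        (λ j → truth-not (truth-formula φ (j ∷ ρ)))))
    where
    stable : ∀ {P v} → Truth P v → ¬ ¬ P → P
    stable (holds p)  ¬¬p = p
    stable (fails ¬p) ¬¬p = contradiction ¬p ¬¬p
  truth-formula (app φ es)  ρ rewrite exprTerms-correct es ρ = truth-formula φ (values es ρ)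

  -- The game states a move by two implications, `shiftedF` by a disjunction; `shifted-iff` passes
  -- from one to the other by this decision.
  holds? : ∀ {m} (φ : Formula m) ρ → Dec (Holds φ ρ)
  holds? φ ρ with eval (formulaTerm φ) ρ | truth-formula φ ρ
  ... | _ | holds p  = yes p
  ... | _ | fails ¬p = no ¬p

-- Formulas about the level and the states stored in the array.  The
-- displacement of block i at time t is stored with the number of rows or
-- columns added, so that it is a natural number.  The tuple above a formula lists
-- its parameters.

v0 : ∀ {m} → Expr (1 + m)
v0 = ref zero
v1 : ∀ {m} → Expr (2 + m)
v1 = ref (suc zero)
v2 : ∀ {m} → Expr (3 + m)
v2 = ref (suc (suc zero))
v3 : ∀ {m} → Expr (4 + m)
v3 = ref (suc (suc (suc zero)))
v4 : ∀ {m} → Expr (5 + m)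
v4 = ref (suc (suc (suc (suc zero))))
v5 : ∀ {m} → Expr (6 + m)
v5 = ref (suc (suc (suc (suc (suc zero)))))
v6 : ∀ {m} → Expr (7 + m)
v6 = ref (suc (suc (suc (suc (suc (suc zero))))))
v7 : ∀ {m} → Expr (8 + m)
v7 = ref (suc (suc (suc (suc (suc (suc (suc zero)))))))

-- A tag is the first index of the array. The entries with `Pos` in their name are the input
-- positions at which the codes of parts of the level begin.
pattern rowsTag      = 0
pattern colsTag      = 1
pattern countTag     = 2
pattern lastTag      = 3
pattern tileTag      = 4
pattern tilePosTag   = 5
pattern blockPosTag  = 6
pattern kindTag      = 7
pattern colourTag    = 8
pattern directionTag = 9
pattern topTag       = 10
pattern leftTag      = 11
pattern heightTag    = 12
pattern widthTag     = 13
pattern sizeTag      = 14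
pattern cellRowTag   = 15
pattern cellColTag   = 16
pattern cellPosTag   = 17
pattern stateRowTag  = 18
pattern stateColTag  = 19
pattern bloomedTag   = 20

rowsᵉ colsᵉ countᵉ lastᵉ : ∀ {m} → Expr m
rowsᵉ  = arr rowsTag nil nil
colsᵉ  = arr colsTag nil nil
countᵉ = arr countTag nil nil
lastᵉ  = arr lastTag nil nil

infix 4 _⟺_
_⟺_ : Set → Set → Set
A ⟺ B = (A → B) × (B → A)

-- The decoders are total, with all large numbers in the last case. The formulas about the game draw
-- the same line, for instance by `nil ≺ down (down e)` in `byDirection`.
directionOf : ℕ → Direction
directionOf 0 = up
directionOf 1 = down
directionOf 2 = left
directionOf (suc (suc (suc _))) = right

colourOf : ℕ → Colour
colourOf 0 = red
colourOf 1 = blue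
colourOf (suc (suc _)) = yellow

tileOf : ℕ → Tile
tileOf 0 = empty
tileOf 1 = wall
tileOf (suc (suc v)) = flower (colourOf v)

someCell everyCell : ∀ {m} → Formula (2 + m) → Formula m
someCell φ  = some rowsᵉ (some colsᵉ φ)
everyCell φ = every rowsᵉ (every colsᵉ φ)

byDirection : ∀ {m} → (Direction → Formula m) → Expr m → Formula m
byDirection φ e =
  e is 0 ∧ᶠ φ up ∨ᶠ e is 1 ∧ᶠ φ down ∨ᶠ e is 2 ∧ᶠ φ left ∨ᶠ nil ≺ down (down e) ∧ᶠ φ right

opaque
  -- (r , c , r′ , c′)
  stepF : Direction → Formula 4
  stepF up    = nil ≺ v0 ∧ᶠ v2 ≐ down v0 ∧ᶠ v3 ≐ v1
  stepF down  = nil ≺ v2 ∧ᶠ v0 ≐ down v2 ∧ᶠ v3 ≐ v1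
  stepF left  = nil ≺ v1 ∧ᶠ v3 ≐ down v1 ∧ᶠ v2 ≐ v0
  stepF right = nil ≺ v3 ∧ᶠ v1 ≐ down v3 ∧ᶠ v2 ≐ v0

  adjacentF : Formula 4
  adjacentF = stepF up ∨ᶠ stepF down ∨ᶠ stepF left ∨ᶠ stepF right

  sameColourF : Formula 2
  sameColourF = v0 is 0 ∧ᶠ v1 is 0 ∨ᶠ v0 is 1 ∧ᶠ v1 is 1 ∨ᶠ nil ≺ down v0 ∧ᶠ nil ≺ down v1

  -- (a , b , c , d) with a + b = c + d, without forming the sums
  balanceF : Formula 4
  balanceF = v0 ∸ᵉ v2 ≐ v3 ∸ᵉ v1 ∧ᶠ v2 ∸ᵉ v0 ≐ v1 ∸ᵉ v3

  -- (r , c)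
  emptyF wallF : Formula 2
  emptyF = v0 ≺ rowsᵉ ∧ᶠ v1 ≺ colsᵉ ∧ᶠ arr tileTag v0 v1 is 0
  wallF  = v0 ≺ rowsᵉ ∧ᶠ v1 ≺ colsᵉ ∧ᶠ arr tileTag v0 v1 is 1

  -- (colour , r , c)
  flowerF : Formula 3
  flowerF = v1 ≺ rowsᵉ ∧ᶠ v2 ≺ colsᵉ ∧ᶠ nil ≺ down (arr tileTag v1 v2) ∧ᶠ
            app sameColourF (down (down (arr tileTag v1 v2)) ∷ v0 ∷ [])

  -- (i , r , c)
  footF : Formula 3
  footF =
    arr kindTag v0 nil is 0 ∧ᶠ
      some (arr sizeTag v0 nil) (arr cellRowTag v1 v0 ≐ v2 ∧ᶠ arr cellColTag v1 v0 ≐ v3) ∨ᶠ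
    nil ≺ arr kindTag v0 nil ∧ᶠ
      ¬ᶠ (v1 ≺ arr topTag v0 nil) ∧ᶠ v1 ∸ᵉ arr topTag v0 nil ≺ arr heightTag v0 nil ∧ᶠ
      ¬ᶠ (v2 ≺ arr leftTag v0 nil) ∧ᶠ v2 ∸ᵉ arr leftTag v0 nil ≺ arr widthTag v0 nil

opaque
  -- (t , i , r , c)
  bodyF : Formula 4
  bodyF = someCell (
    app footF (v3 ∷ v1 ∷ v0 ∷ []) ∧ᶠ
    -- The stored displacement exceeds the true one by the number of rows, which therefore reappears
    -- on the other side.
    app balanceF (v1 ∷ arr stateRowTag v2 v3 ∷ v4 ∷ rowsᵉ ∷ []) ∧ᶠ
    app balanceF (v0 ∷ arr stateColTag v2 v3 ∷ v5 ∷ colsᵉ ∷ []))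

opaque
  -- (t , i , r , c)
  besideF : Direction → Formula 4
  besideF d =
    ¬ᶠ bodyF ∧ᶠ
    someCell (app (stepF d) (v1 ∷ v0 ∷ v4 ∷ v5 ∷ []) ∧ᶠ app bodyF (v2 ∷ v3 ∷ v1 ∷ v0 ∷ []))

opaque
  petalF : Formula 4
  petalF = nil ≺ arr bloomedTag v0 v1 ∧ᶠ nil ≺ arr kindTag v1 nil ∧ᶠ
           byDirection besideF (arr directionTag v1 nil)

  occupiesF : Formula 4
  occupiesF = bodyF ∨ᶠ petalF

  -- (t , colour , r , c)
  flowerAtF : Formula 4
  flowerAtF =
    app flowerF (v1 ∷ v2 ∷ v3 ∷ []) ∨ᶠ
    some countᵉ (app sameColourF (arr colourTag v0 nil ∷ v2 ∷ []) ∧ᶠ app petalF (v1 ∷ v0 ∷ v3 ∷ v4 ∷ []))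

opaque
  -- (t , j , i)
  restsOnF : Formula 3
  restsOnF =
    ¬ᶠ (v1 ≐ v2) ∧ᶠ
    someCell (app occupiesF (v2 ∷ v3 ∷ v1 ∷ v0 ∷ []) ∧ᶠ
      someCell (app (stepF down) (v3 ∷ v2 ∷ v1 ∷ v0 ∷ []) ∧ᶠ app occupiesF (v4 ∷ v6 ∷ v1 ∷ v0 ∷ [])))

  -- (t , i)
  onGridF : Formula 2
  onGridF =
    someCell (app occupiesF (v2 ∷ v3 ∷ v1 ∷ v0 ∷ []) ∧ᶠ
      ¬ᶠ (someCell (app (stepF down) (v3 ∷ v2 ∷ v1 ∷ v0 ∷ []) ∧ᶠ app emptyF (v1 ∷ v0 ∷ []))))

-- The parameters of base are (l , t , i) and those of edge are (j , l , t , i),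
-- where the edge leads from j to l.
reachF : Formula 3 → Formula 4 → ℕ → Formula 3
reachF base edge zero    = base
reachF base edge (suc n) =
  base ∨ᶠ some countᵉ (edge ∧ᶠ app (reachF base edge n) (v0 ∷ v2 ∷ v3 ∷ []))

opaque
  supportBaseF carryBaseF : Formula 3
  supportBaseF = app onGridF (v1 ∷ v0 ∷ [])
  carryBaseF   = v0 ≐ v2

  pushBaseF : Direction → Formula 3
  pushBaseF d = someCell (app (besideF d) (v3 ∷ v4 ∷ v1 ∷ v0 ∷ []) ∧ᶠ app occupiesF (v3 ∷ v2 ∷ v1 ∷ v0 ∷ []))

  supportEdgeF : Formula 4
  supportEdgeF = app restsOnF (v2 ∷ v1 ∷ v0 ∷ [])

  horizontalF : ∀ {m} → Direction → Formula m
  horizontalF up    = nil ≺ nil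
  horizontalF down  = nil ≺ nil
  horizontalF left  = nil ≐ nil
  horizontalF right = nil ≐ nil

  pushEdgeF : Direction → Formula 4
  pushEdgeF d =
    someCell (app occupiesF (v4 ∷ v2 ∷ v1 ∷ v0 ∷ []) ∧ᶠ
      someCell (app (stepF d) (v3 ∷ v2 ∷ v1 ∷ v0 ∷ []) ∧ᶠ app occupiesF (v6 ∷ v5 ∷ v1 ∷ v0 ∷ []))) ∨ᶠ
    horizontalF d ∧ᶠ app restsOnF (v2 ∷ v1 ∷ v0 ∷ []) ∧ᶠ ¬ᶠ (v1 ≐ v3)

supportF carryF : ℕ → Formula 3
supportF k = reachF supportBaseF supportEdgeF k
carryF k   = reachF carryBaseF supportEdgeF k

pushF : ℕ → Direction → Formula 3
pushF k d = reachF (pushBaseF d) (pushEdgeF d) k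

opaque
  -- (t , i), where the parameters of the moving set are (j , t , i)
  roomF : Formula 3 → Direction → Formula 2
  roomF moving d =
    every countᵉ (moving ⇒ᶠ
      everyCell (app occupiesF (v3 ∷ v2 ∷ v1 ∷ v0 ∷ []) ⇒ᶠ
        someCell (app (stepF d) (v3 ∷ v2 ∷ v1 ∷ v0 ∷ []) ∧ᶠ app emptyF (v1 ∷ v0 ∷ []) ∧ᶠ
          every countᵉ (app occupiesF (v6 ∷ v0 ∷ v2 ∷ v1 ∷ []) ⇒ᶠ app moving (v0 ∷ v6 ∷ v7 ∷ [])))))

  -- (t , t′ , j)
  sameBloomF : Formula 3
  sameBloomF =
    arr bloomedTag v0 v2 is 0 ∧ᶠ arr bloomedTag v1 v2 is 0 ∨ᶠ
    nil ≺ arr bloomedTag v0 v2 ∧ᶠ nil ≺ arr bloomedTag v1 v2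

  samePlaceF : Formula 3
  samePlaceF = arr stateRowTag v1 v2 ≐ arr stateRowTag v0 v2 ∧ᶠ arr stateColTag v1 v2 ≐ arr stateColTag v0 v2

opaque
  movedF : Direction → Formula 3
  movedF d =
    app (stepF d) (arr stateRowTag v0 v2 ∷ arr stateColTag v0 v2 ∷
                   arr stateRowTag v1 v2 ∷ arr stateColTag v1 v2 ∷ []) ∧ᶠ sameBloomF

  keptF : Formula 3
  keptF = samePlaceF ∧ᶠ sameBloomF

  -- (t , i)
  contactF : Formula 2
  contactF = someCell (app bodyF (v2 ∷ v3 ∷ v1 ∷ v0 ∷ []) ∧ᶠ
    someCell (app adjacentF (v3 ∷ v2 ∷ v1 ∷ v0 ∷ []) ∧ᶠ
      app flowerAtF (v4 ∷ arr colourTag v5 nil ∷ v1 ∷ v0 ∷ [])))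

  clearSideF : Direction → Formula 2
  clearSideF d = everyCell (app bodyF (v2 ∷ v3 ∷ v1 ∷ v0 ∷ []) ⇒ᶠ
    someCell (app (stepF d) (v3 ∷ v2 ∷ v1 ∷ v0 ∷ []) ∧ᶠ app emptyF (v1 ∷ v0 ∷ [])))

opaque
  -- (t , i)
  bloomsInF : ℕ → Direction → Formula 2
  bloomsInF k d =
    contactF ∧ᶠ clearSideF d ∧ᶠ ¬ᶠ (app (pushF k d) (v1 ∷ v0 ∷ v1 ∷ [])) ∧ᶠ roomF (pushF k d) d

opaque
  canBloomF : ℕ → Formula 2
  canBloomF k =
    nil ≺ arr kindTag v1 nil ∧ᶠ arr bloomedTag v0 v1 is 0 ∧ᶠ
    byDirection (bloomsInF k) (arr directionTag v1 nil)

opaque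
  -- (t)
  noBloomF : ℕ → Formula 1
  noBloomF k = every countᵉ (¬ᶠ (app (canBloomF k) (v1 ∷ v0 ∷ [])))

  allSupportedF : ℕ → Formula 1
  allSupportedF k = every countᵉ (app (supportF k) (v0 ∷ v1 ∷ v0 ∷ []))

  allBloomedF : Formula 1
  allBloomedF = every countᵉ (nil ≺ arr kindTag v0 nil ⇒ᶠ nil ≺ arr bloomedTag v1 v0)

  -- (j , t , i , t′)
  shiftedF : Formula 3 → Direction → Formula 4
  shiftedF moving d =
    app moving (v0 ∷ v1 ∷ v2 ∷ []) ∧ᶠ app (movedF d) (v1 ∷ v3 ∷ v0 ∷ []) ∨ᶠ
    ¬ᶠ (app moving (v0 ∷ v1 ∷ v2 ∷ [])) ∧ᶠ app keptF (v1 ∷ v3 ∷ v0 ∷ [])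

  blossomF : Formula 3
  blossomF = samePlaceF ∧ᶠ nil ≺ arr bloomedTag v1 v2

settledF : ℕ → Formula 1
settledF k = noBloomF k ∧ᶠ allSupportedF k

opaque
  -- (i , t , t′)
  bloomF : ℕ → Direction → Formula 3
  bloomF k d =
    app (bloomsInF k d) (v1 ∷ v0 ∷ []) ∧ᶠ
    every countᵉ (
      v0 ≐ v1 ∧ᶠ app blossomF (v2 ∷ v3 ∷ v0 ∷ []) ∨ᶠ
      ¬ᶠ (v0 ≐ v1) ∧ᶠ app (shiftedF (pushF k d) d) (v0 ∷ v2 ∷ v1 ∷ v3 ∷ []))

  slideF : ℕ → Direction → Formula 3
  slideF k d =
    app (roomF (carryF k) d) (v1 ∷ v0 ∷ []) ∧ᶠ
    every countᵉ (app (shiftedF (carryF k) d) (v0 ∷ v2 ∷ v1 ∷ v3 ∷ []))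

opaque
  -- (t , t′)
  bloomStepF fallStepF slideStepF : ℕ → Formula 2
  bloomStepF k = some countᵉ (
    nil ≺ arr kindTag v0 nil ∧ᶠ arr bloomedTag v1 v0 is 0 ∧ᶠ
    byDirection (bloomF k) (arr directionTag v0 nil))
  fallStepF k =
    app (noBloomF k) (v0 ∷ []) ∧ᶠ
    some countᵉ (¬ᶠ (app (supportF k) (v0 ∷ v1 ∷ v0 ∷ []))) ∧ᶠ
    every countᵉ (app (shiftedF (¬ᶠ (supportF k)) down) (v0 ∷ v1 ∷ v0 ∷ v2 ∷ []))
  slideStepF k = app (settledF k) (v0 ∷ []) ∧ᶠ (some countᵉ (slideF k left) ∨ᶠ some countᵉ (slideF k right))

microF : ℕ → Formula 2
microF k = bloomStepF k ∨ᶠ fallStepF k ∨ᶠ slideStepF k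

opaque
  pathF : ℕ → Formula 0
  pathF k =
    every countᵉ (arr stateRowTag nil v0 ≐ rowsᵉ ∧ᶠ arr stateColTag nil v0 ≐ colsᵉ ∧ᶠ arr bloomedTag nil v0 is 0) ∧ᶠ
    every lastᵉ (app (microF k) (v0 ∷ up v0 ∷ [])) ∧ᶠ
    app (settledF k) (lastᵉ ∷ []) ∧ᶠ app allBloomedF (lastᵉ ∷ [])

-- Calculus of equivalences

iff-refl : ∀ {A : Set} → A ⟺ A
iff-refl = id , id

infixr 4 _iff-then_
_iff-then_ : ∀ {A B C : Set} → A ⟺ B → B ⟺ C → A ⟺ C
(f , g) iff-then (h , k) = h ∘ f , g ∘ k

iff-sym : ∀ {A B : Set} → A ⟺ B → B ⟺ A
iff-sym (f , g) = g , f

iff-× : ∀ {A B C D : Set} → A ⟺ B → C ⟺ D → (A × C) ⟺ (B × D)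
iff-× (f , g) (h , k) = (λ (a , c) → f a , h c) , (λ (b , d) → g b , k d)

iff-⊎ : ∀ {A B C D : Set} → A ⟺ B → C ⟺ D → (A ⊎ C) ⟺ (B ⊎ D)
iff-⊎ (f , g) (h , k) = [ inj₁ ∘ f , inj₂ ∘ h ]′ , [ inj₁ ∘ g , inj₂ ∘ k ]′

iff-→ : ∀ {A B C D : Set} → A ⟺ B → C ⟺ D → (A → C) ⟺ (B → D)
iff-→ (f , g) (h , k) = (λ i b → h (i (g b))) , (λ j a → k (j (f a)))

iff-¬ : ∀ {A B : Set} → A ⟺ B → (¬ A) ⟺ (¬ B)
iff-¬ (f , g) = (λ ¬a → ¬a ∘ g) , (λ ¬b → ¬b ∘ f)

-- Geometry of cells

cell-injective : ∀ {r c r′ c′} → cell (r , c) ≡ cell (r′ , c′) → r ≡ r′ × c ≡ c′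
cell-injective refl = refl , refl

step-opposite : ∀ d p → step (opposite d) (step d p) ≡ p
step-opposite up    (r , c) = cong (_, c) (ℤ.suc-pred r)
step-opposite down  (r , c) = cong (_, c) (ℤ.pred-suc r)
step-opposite left  (r , c) = cong (r ,_) (ℤ.suc-pred c)
step-opposite right (r , c) = cong (r ,_) (ℤ.pred-suc c)

opposite-step : ∀ d p → step d (step (opposite d) p) ≡ p
opposite-step up    (r , c) = cong (_, c) (ℤ.pred-suc r)
opposite-step down  (r , c) = cong (_, c) (ℤ.suc-pred r)
opposite-step left  (r , c) = cong (r ,_) (ℤ.pred-suc c)
opposite-step right (r , c) = cong (r ,_) (ℤ.suc-pred c)

step-+ᶜ : ∀ d p q → step d (p +ᶜ q) ≡ step d p +ᶜ q
step-+ᶜ up    (r , c) (r′ , c′) = cong (_, (c ℤ.+ c′)) (sym (ℤ.+-assoc ℤ.-1ℤ r r′))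
step-+ᶜ down  (r , c) (r′ , c′) = cong (_, (c ℤ.+ c′)) (sym (ℤ.+-assoc ℤ.1ℤ r r′))
step-+ᶜ left  (r , c) (r′ , c′) = cong ((r ℤ.+ r′) ,_) (sym (ℤ.+-assoc ℤ.-1ℤ c c′))
step-+ᶜ right (r , c) (r′ , c′) = cong ((r ℤ.+ r′) ,_) (sym (ℤ.+-assoc ℤ.1ℤ c c′))

+ᶜ-cancelʳ : ∀ p q o → p +ᶜ o ≡ q +ᶜ o → p ≡ q
+ᶜ-cancelʳ (r , c) (r′ , c′) (a , b) eq =
  cong₂ _,_ (∙-cancelʳ a r r′ (,-injectiveˡ eq)) (∙-cancelʳ b c c′ (,-injectiveʳ eq))

-- Connects displaced cells, with the true displacement `b - d`, to the equation of natural numbers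
-- that `balanceF` tests.
shifted-sum : ∀ a b c d → (pos a ℤ.+ (pos b ℤ.+ ℤ.- pos d) ≡ pos c) ⟺ (a + b ≡ c + d)
shifted-sum a b c d =
  (λ eq → ℤ.+-injective (begin
     pos (a + b)                         ≡⟨ ℤ.+-identityʳ _ ⟨
     pos (a + b) ℤ.+ pos 0                 ≡⟨ cong (λ z → pos (a + b) ℤ.+ z) (ℤ.+-inverseˡ (pos d)) ⟨
     pos (a + b) ℤ.+ (ℤ.- pos d ℤ.+ pos d)   ≡⟨ ℤ.+-assoc (pos (a + b)) (ℤ.- pos d) (pos d) ⟨
     pos (a + b) ℤ.+ ℤ.- pos d ℤ.+ pos d     ≡⟨ cong (ℤ._+ pos d) (ℤ.+-assoc (pos a) (pos b) (ℤ.- pos d)) ⟩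
     pos a ℤ.+ (pos b ℤ.+ ℤ.- pos d) ℤ.+ pos d ≡⟨ cong (ℤ._+ pos d) eq ⟩
     pos (c + d)                         ∎)) ,
  (λ eq → begin
     pos a ℤ.+ (pos b ℤ.+ ℤ.- pos d) ≡⟨ ℤ.+-assoc (pos a) (pos b) (ℤ.- pos d) ⟨
     pos (a + b) ℤ.+ ℤ.- pos d     ≡⟨ cong (λ n → pos n ℤ.+ ℤ.- pos d) eq ⟩
     pos (c + d) ℤ.+ ℤ.- pos d     ≡⟨ ℤ.+-assoc (pos c) (pos d) (ℤ.- pos d) ⟩
     pos c ℤ.+ (pos d ℤ.+ ℤ.- pos d) ≡⟨ cong (λ z → pos c ℤ.+ z) (ℤ.+-inverseʳ (pos d)) ⟩
     pos c ℤ.+ pos 0               ≡⟨ ℤ.+-identityʳ _ ⟩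
     pos c                       ∎)
  where open ≡-Reasoning

‼-inside : ∀ {A : Set} {n} (xs : Vec A n) z {a} → xs ‼ z ≡ just a → ∃[ m ] (z ≡ pos m × m < n)
‼-inside (x ∷ xs) (pos zero)  eq = 0 , refl , s≤s z≤n
‼-inside (x ∷ xs) (pos (suc m)) eq with ‼-inside xs (pos m) eq
... | _ , refl , m<n = suc m , refl , s≤s m<n

module Grid (L : Level) where
  open Level L
  open Game L

  Inside : Cell → Set
  Inside p = ∃[ r ] ∃[ c ] (r < rows × c < cols × p ≡ cell (r , c))

  tile-inside : ∀ p {τ} → tileAt p ≡ just τ → Inside p
  tile-inside (r , c) eq with grid ‼ r in eqr
  ... | just row with ‼-inside grid r eqr | ‼-inside row c eq
  ...   | m , refl , m< | m′ , refl , m′< = m , m′ , m< , m′< , refl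

  free-inside : ∀ {p} → Free p → Inside p
  free-inside {p} = tile-inside p

  free? : ∀ p → Dec (Free p)
  free? p with tileAt p
  ... | just empty      = yes refl
  ... | just wall       = no λ ()
  ... | just (flower _) = no λ ()
  ... | nothing         = no λ ()

  free-stable : ∀ {p} → ¬ ¬ Free p → Free p
  free-stable {p} = decidable-stable (free? p)

-- The level and the states stored in an array

blockOf : Array → ℕ → Block
blockOf G i =
  ifPositive (G kindTag i 0)
    (coloured (colourOf (G colourTag i 0)) (directionOf (G directionTag i 0))
       (G topTag i 0) (G leftTag i 0) (G heightTag i 0) (G widthTag i 0))
    (gray (List.applyUpTo (λ j → G cellRowTag i j , G cellColTag i j) (G sizeTag i 0)))

-- A relation rather than a function, because it is needed for the level read off an arbitrary array
-- and for a given level with the array made from it.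
record Describes (L : Level) (G : Array) : Set where
  open Level L
  open Game L
  field
    rows≡  : G rowsTag 0 0 ≡ rows
    cols≡  : G colsTag 0 0 ≡ cols
    count≡ : G countTag 0 0 ≡ length blocks
    tile≡  : ∀ {r c} → r < rows → c < cols → tileAt (cell (r , c)) ≡ just (tileOf (G tileTag r c))
    block≡ : ∀ i → block i ≡ blockOf G (toℕ i)

offset : Array → Cell
offset G = ℤ.- pos (G rowsTag 0 0) , ℤ.- pos (G colsTag 0 0)

stateOf : Array → ℕ → ℕ → BlockState
stateOf G t i =
  blockState (cell (G stateRowTag t i , G stateColTag t i) +ᶜ offset G) (isPositive (G bloomedTag t i))

isPositive-iff : ∀ v → (0 < v) ⟺ (isPositive v ≡ true)
isPositive-iff zero    = (λ ()) , (λ ())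
isPositive-iff (suc v) = (λ _ → refl) , (λ _ → s≤s z≤n)

module Described (x u : List Bool) (L : Level) (described : Describes L (certified x u)) where
  open Level L
  open Game L
  open Grid L
  open Describes described
  open Meaning x (lastPosition x u) (certified x u) public
  open Translation x u using (holds?) public

  G : Array
  G = certified x u

  -- The relations H stand for the meaning of a formula in an environment, from
  -- which formula and environment could not be inferred.
  someCell-iff : ∀ {H : ℕ → ℕ → Set} {P : Cell → Set} → (∀ {p} → P p → Inside p) →
    (∀ r c → H r c ⟺ P (cell (r , c))) →
    (∃[ r ] (r < G rowsTag 0 0 × ∃[ c ] (c < G colsTag 0 0 × H r c))) ⟺ ∃ P
  someCell-iff {H} {P} inside h =
    (λ (r , _ , c , _ , p) → cell (r , c) , proj₁ (h r c) p) , back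
    where
    back : ∃ P → ∃[ r ] (r < G rowsTag 0 0 × ∃[ c ] (c < G colsTag 0 0 × H r c))
    back (p , Pp) with inside Pp
    ... | r , c , r< , c< , refl =
      r , subst (r <_) (sym rows≡) r< , c , subst (c <_) (sym cols≡) c< , proj₂ (h r c) Pp

  -- `P` confines its cells to the grid, so the bounded quantifier reaches every integer cell that
  -- matters.
  everyCell-iff : ∀ {H H′ : ℕ → ℕ → Set} {P Q : Cell → Set} → (∀ {p} → P p → Inside p) →
    (∀ r c → H r c ⟺ P (cell (r , c))) → (∀ r c → H′ r c ⟺ Q (cell (r , c))) →
    (∀ r → r < G rowsTag 0 0 → ∀ c → c < G colsTag 0 0 → H r c → H′ r c) ⟺ (∀ {p} → P p → Q p)
  everyCell-iff {H} {H′} {P} {Q} inside h h′ =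
    forth , (λ f r _ c _ p → proj₂ (h′ r c) (f (proj₁ (h r c) p)))
    where
    forth : (∀ r → r < G rowsTag 0 0 → ∀ c → c < G colsTag 0 0 → H r c → H′ r c) → ∀ {p} → P p → Q p
    forth f Pp with inside Pp
    ... | r , c , r< , c< , refl =
      proj₁ (h′ r c) (f r (subst (r <_) (sym rows≡) r<) c (subst (c <_) (sym cols≡) c<) (proj₂ (h r c) Pp))

  index : ∀ {i} → i < G countTag 0 0 → ∃[ j ] (toℕ {length blocks} j ≡ i)
  index i< = fromℕ< (subst (_ <_) count≡ i<) , toℕ-fromℕ< _

  index< : ∀ (i : Index) → toℕ i < G countTag 0 0
  index< i = subst (toℕ i <_) (sym count≡) (toℕ<n i)

  someIndex-iff : ∀ {H : ℕ → Set} {P : Index → Set} → (∀ i → H (toℕ i) ⟺ P i) →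
    (∃[ i ] (i < G countTag 0 0 × H i)) ⟺ ∃ P
  someIndex-iff {H} {P} h = forth , λ (i , p) → toℕ i , index< i , proj₂ (h i) p
    where
    forth : ∃[ i ] (i < G countTag 0 0 × H i) → ∃ P
    forth (i , i< , p) with index i<
    ... | j , refl = j , proj₁ (h j) p

  everyIndex-iff : ∀ {H : ℕ → Set} {P : Index → Set} → (∀ i → H (toℕ i) ⟺ P i) →
    (∀ i → i < G countTag 0 0 → H i) ⟺ (∀ i → P i)
  everyIndex-iff {H} {P} h = (λ f i → proj₁ (h i) (f (toℕ i) (index< i))) , back
    where
    back : (∀ i → P i) → ∀ i → i < G countTag 0 0 → H i
    back f i i< with index i<
    ... | j , refl = proj₂ (h j) (f j)

  byDirection-iff : ∀ (H : Direction → Set) v →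
    (v ≡ 0 × H up ⊎ v ≡ 1 × H down ⊎ v ≡ 2 × H left ⊎ 0 < pred (pred v) × H right) ⟺ H (directionOf v)
  byDirection-iff H 0 =
    (λ { (inj₁ (_ , h)) → h ; (inj₂ (inj₁ ())) ; (inj₂ (inj₂ (inj₁ ()))) ; (inj₂ (inj₂ (inj₂ ()))) }) ,
    (λ h → inj₁ (refl , h))
  byDirection-iff H 1 =
    (λ { (inj₁ ()) ; (inj₂ (inj₁ (_ , h))) → h ; (inj₂ (inj₂ (inj₁ ()))) ; (inj₂ (inj₂ (inj₂ ()))) }) ,
    (λ h → inj₂ (inj₁ (refl , h)))
  byDirection-iff H 2 =
    (λ { (inj₁ ()) ; (inj₂ (inj₁ ())) ; (inj₂ (inj₂ (inj₁ (_ , h)))) → h ; (inj₂ (inj₂ (inj₂ ()))) }) ,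
    (λ h → inj₂ (inj₂ (inj₁ (refl , h))))
  byDirection-iff H (suc (suc (suc v))) =
    (λ { (inj₁ ()) ; (inj₂ (inj₁ ())) ; (inj₂ (inj₂ (inj₁ ()))) ; (inj₂ (inj₂ (inj₂ (_ , h)))) → h }) ,
    (λ h → inj₂ (inj₂ (inj₂ (s≤s z≤n , h))))

  opaque
    unfolding stepF

    step-iff : ∀ d r c r′ c′ → Holds (stepF d) (r ∷ c ∷ r′ ∷ c′ ∷ []) ⟺ (step d (cell (r , c)) ≡ cell (r′ , c′))
    step-iff up zero    c r′ c′ = (λ ()) , (λ ())
    step-iff up (suc r) c r′ c′ = (λ { (_ , refl , refl) → refl }) , (λ { refl → s≤s z≤n , refl , refl })
    step-iff down r c zero     c′ = (λ ()) , (λ ())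
    step-iff down r c (suc r′) c′ = (λ { (_ , refl , refl) → refl }) , (λ { refl → s≤s z≤n , refl , refl })
    step-iff left r zero    r′ c′ = (λ ()) , (λ ())
    step-iff left r (suc c) r′ c′ = (λ { (_ , refl , refl) → refl }) , (λ { refl → s≤s z≤n , refl , refl })
    step-iff right r c r′ zero     = (λ ()) , (λ ())
    step-iff right r c r′ (suc c′) = (λ { (_ , refl , refl) → refl }) , (λ { refl → s≤s z≤n , refl , refl })

    adjacent-iff : ∀ r c r′ c′ →
      Holds adjacentF (r ∷ c ∷ r′ ∷ c′ ∷ []) ⟺ (∃[ d ] (step d (cell (r , c)) ≡ cell (r′ , c′)))
    adjacent-iff r c r′ c′ =
      (λ { (inj₁ h) → up , proj₁ (iff up) h
         ; (inj₂ (inj₁ h)) → down , proj₁ (iff down) h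
         ; (inj₂ (inj₂ (inj₁ h))) → left , proj₁ (iff left) h
         ; (inj₂ (inj₂ (inj₂ h))) → right , proj₁ (iff right) h }) ,
      (λ { (up , h) → inj₁ (proj₂ (iff up) h)
         ; (down , h) → inj₂ (inj₁ (proj₂ (iff down) h))
         ; (left , h) → inj₂ (inj₂ (inj₁ (proj₂ (iff left) h)))
         ; (right , h) → inj₂ (inj₂ (inj₂ (proj₂ (iff right) h))) })
      where
      iff : ∀ d → Holds (stepF d) (r ∷ c ∷ r′ ∷ c′ ∷ []) ⟺ (step d (cell (r , c)) ≡ cell (r′ , c′))
      iff d = step-iff d r c r′ c′

    sameColour-iff : ∀ v w → Holds sameColourF (v ∷ w ∷ []) ⟺ (colourOf v ≡ colourOf w)
    sameColour-iff v w = forth v w , back v w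
      where
      forth : ∀ v w → Holds sameColourF (v ∷ w ∷ []) → colourOf v ≡ colourOf w
      forth .0 .0 (inj₁ (refl , refl)) = refl
      forth .1 .1 (inj₂ (inj₁ (refl , refl))) = refl
      forth (suc (suc v)) (suc (suc w)) (inj₂ (inj₂ _)) = refl
      forth 0 w (inj₂ (inj₂ (() , _)))
      forth 1 w (inj₂ (inj₂ (() , _)))
      forth (suc (suc v)) 0 (inj₂ (inj₂ (_ , ())))
      forth (suc (suc v)) 1 (inj₂ (inj₂ (_ , ())))
      back : ∀ v w → colourOf v ≡ colourOf w → Holds sameColourF (v ∷ w ∷ [])
      back 0 0 _ = inj₁ (refl , refl)
      back 1 1 _ = inj₂ (inj₁ (refl , refl))
      back (suc (suc v)) (suc (suc w)) _ = inj₂ (inj₂ (s≤s z≤n , s≤s z≤n))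
      back 0 1 ()
      back 0 (suc (suc w)) ()
      back 1 0 ()
      back 1 (suc (suc w)) ()
      back (suc (suc v)) 0 ()
      back (suc (suc v)) 1 ()

    balance-iff : ∀ a b c d → Holds balanceF (a ∷ b ∷ c ∷ d ∷ []) ⟺ (a + b ≡ c + d)
    balance-iff a b c d = forth , back
      where
      -- As `c ∸ a` is zero, the second equation gives `b ≤ d`; so the truncated differences in the
      -- first equation are true ones.
      add : ∀ a b c d → c ≤ a → a ∸ c ≡ d ∸ b → c ∸ a ≡ b ∸ d → a + b ≡ c + d
      add a b c d c≤a eq eq′ = begin
        a + b               ≡⟨ cong (_+ b) (ℕ.m+[n∸m]≡n c≤a) ⟨
        c + (a ∸ c) + b     ≡⟨ ℕ.+-assoc c (a ∸ c) b ⟩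
        c + (a ∸ c + b)     ≡⟨ cong (λ e → c + (e + b)) eq ⟩
        c + (d ∸ b + b)     ≡⟨ cong (λ e → c + e) (ℕ.m∸n+n≡m (ℕ.m∸n≡0⇒m≤n (trans (sym eq′) (ℕ.m≤n⇒m∸n≡0 c≤a)))) ⟩
        c + d               ∎
        where open ≡-Reasoning
      forth : Holds balanceF (a ∷ b ∷ c ∷ d ∷ []) → a + b ≡ c + d
      forth (eq , eq′) with ℕ.≤-total c a
      ... | inj₁ c≤a = add a b c d c≤a eq eq′
      ... | inj₂ a≤c = sym (add c d a b a≤c eq′ eq)
      back : a + b ≡ c + d → Holds balanceF (a ∷ b ∷ c ∷ d ∷ [])
      back eq =
        trans (sym (ℕ.[m+n]∸[m+o]≡n∸o b a c)) (trans (cong₂ _∸_ (trans (ℕ.+-comm b a) eq) (ℕ.+-comm b c)) (ℕ.[m+n]∸[m+o]≡n∸o c d b)) ,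
        trans (sym (ℕ.[m+n]∸[m+o]≡n∸o d c a)) (trans (cong₂ _∸_ (trans (ℕ.+-comm d c) (sym eq)) (ℕ.+-comm d a)) (ℕ.[m+n]∸[m+o]≡n∸o a b d))

    tileCase : ∀ {r c τ} (P : ℕ → Set) → (∀ v → P v ⟺ (tileOf v ≡ τ)) →
      (r < G rowsTag 0 0 × c < G colsTag 0 0 × P (G tileTag r c)) ⟺ (tileAt (cell (r , c)) ≡ just τ)
    tileCase {r} {c} {τ} P h =
      (λ (r< , c< , p) → trans (tile≡ (subst (r <_) rows≡ r<) (subst (c <_) cols≡ c<)) (cong just (proj₁ (h _) p))) ,
      back
      where
      back : tileAt (cell (r , c)) ≡ just τ → r < G rowsTag 0 0 × c < G colsTag 0 0 × P (G tileTag r c)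
      back eq with tile-inside (cell (r , c)) eq
      ... | _ , _ , r< , c< , refl =
        subst (r <_) (sym rows≡) r< , subst (c <_) (sym cols≡) c< ,
        proj₂ (h _) (just-injective (trans (sym (tile≡ r< c<)) eq))

    empty-iff : ∀ r c → Holds emptyF (r ∷ c ∷ []) ⟺ Free (cell (r , c))
    empty-iff r c = tileCase (_≡ 0) λ
      { 0 → (λ _ → refl) , (λ _ → refl) ; 1 → (λ ()) , (λ ()) ; (suc (suc v)) → (λ ()) , (λ ()) }

    wall-iff : ∀ r c → Holds wallF (r ∷ c ∷ []) ⟺ (tileAt (cell (r , c)) ≡ just wall)
    wall-iff r c = tileCase (_≡ 1) λ
      { 0 → (λ ()) , (λ ()) ; 1 → (λ _ → refl) , (λ _ → refl) ; (suc (suc v)) → (λ ()) , (λ ()) }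

    flower-iff : ∀ v r c → Holds flowerF (v ∷ r ∷ c ∷ []) ⟺ (tileAt (cell (r , c)) ≡ just (flower (colourOf v)))
    flower-iff v r c = tileCase (λ w → 0 < pred w × Holds sameColourF (pred (pred w) ∷ v ∷ [])) λ
      { 0 → (λ ()) , (λ ()) ; 1 → (λ ()) , (λ ())
      ; (suc (suc w)) → (λ (_ , h) → cong flower (proj₁ (sameColour-iff w v) h)) ,
                        (λ eq → s≤s z≤n , proj₂ (sameColour-iff w v) (flower-injective eq)) }
      where
      flower-injective : ∀ {a b} → flower a ≡ flower b → a ≡ b
      flower-injective refl = refl

    GrayFoot ColouredFoot : ℕ → ℕ → ℕ → Set
    GrayFoot i r c = ∃[ j ] (j < G sizeTag i 0 × G cellRowTag i j ≡ r × G cellColTag i j ≡ c)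
    ColouredFoot i r c =
      ¬ (r < G topTag i 0) × r ∸ G topTag i 0 < G heightTag i 0 ×
      ¬ (c < G leftTag i 0) × c ∸ G leftTag i 0 < G widthTag i 0

    gray-foot : ∀ i r c → GrayFoot i r c ⟺
      (cell (r , c) ∈ List.map cell (List.applyUpTo (λ j → G cellRowTag i j , G cellColTag i j) (G sizeTag i 0)))
    gray-foot i r c = (λ { (j , j< , refl , refl) → ∈-map⁺ cell (∈-applyUpTo⁺ cells j<) }) , back
      where
      cells : ℕ → ℕ × ℕ
      cells j = G cellRowTag i j , G cellColTag i j
      back : cell (r , c) ∈ List.map cell (List.applyUpTo cells (G sizeTag i 0)) → GrayFoot i r c
      back h with ∈-map⁻ cell h
      ... | _ , h′ , refl with ∈-applyUpTo⁻ cells h′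
      ...   | j , j< , refl = j , j< , refl , refl

    interval-iff : ∀ t h r → (¬ (r < t) × r ∸ t < h) ⟺ (r ∈ List.map (λ j → t + j) (List.upTo h))
    interval-iff t h r =
      (λ (r≮t , r<) → subst (_∈ List.map (λ j → t + j) (List.upTo h)) (ℕ.m+[n∸m]≡n (ℕ.≮⇒≥ r≮t))
                        (∈-map⁺ (λ j → t + j) (∈-upTo⁺ r<))) ,
      back
      where
      back : r ∈ List.map (λ j → t + j) (List.upTo h) → ¬ (r < t) × r ∸ t < h
      back m with ∈-map⁻ (λ j → t + j) m
      ... | j , j∈ , refl = ℕ.m+n≮m t j , subst (_< h) (sym (ℕ.m+n∸m≡n t j)) (∈-upTo⁻ j∈)

    coloured-foot : ∀ i r c {a d} → ColouredFoot i r c ⟺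
      (cell (r , c) ∈ footprint (coloured a d (G topTag i 0) (G leftTag i 0) (G heightTag i 0) (G widthTag i 0)))
    coloured-foot i r c =
      (λ (r≮t , r< , c≮l , c<) →
         ∈-map⁺ cell (∈-cartesianProduct⁺ (proj₁ (interval-iff _ _ r) (r≮t , r<)) (proj₁ (interval-iff _ _ c) (c≮l , c<)))) ,
      back
      where
      rs cs : List ℕ
      rs = List.map (λ j → G topTag i 0 + j) (List.upTo (G heightTag i 0))
      cs = List.map (λ j → G leftTag i 0 + j) (List.upTo (G widthTag i 0))
      back : cell (r , c) ∈ List.map cell (List.cartesianProduct rs cs) → ColouredFoot i r c
      back h with ∈-map⁻ cell h
      ... | _ , h′ , refl with ∈-cartesianProduct⁻ rs cs h′
      ...   | r∈ , c∈ with proj₂ (interval-iff (G topTag i 0) (G heightTag i 0) r) r∈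
                         | proj₂ (interval-iff (G leftTag i 0) (G widthTag i 0) c) c∈
      ...     | r≮t , r< | c≮l , c< = r≮t , r< , c≮l , c<

    foot-iff : ∀ (i : Index) r c → Holds footF (toℕ i ∷ r ∷ c ∷ []) ⟺ (cell (r , c) ∈ footprint (block i))
    foot-iff i r c rewrite block≡ i with G kindTag (toℕ i) 0
    ... | zero  =
      (λ { (inj₁ (_ , h)) → proj₁ (gray-foot (toℕ i) r c) h ; (inj₂ (() , _)) }) ,
      (λ h → inj₁ (refl , proj₂ (gray-foot (toℕ i) r c) h))
    ... | suc _ =
      (λ { (inj₁ (() , _)) ; (inj₂ (_ , h)) → proj₁ (coloured-foot (toℕ i) r c {colourOf (G colourTag (toℕ i) 0)} {directionOf (G directionTag (toℕ i) 0)}) h }) ,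
      (λ h → inj₂ (s≤s z≤n , proj₂ (coloured-foot (toℕ i) r c {colourOf (G colourTag (toℕ i) 0)} {directionOf (G directionTag (toℕ i) 0)}) h))

  mark-iff : ∀ (i : Index) {c d} → (mark (block i) ≡ just (c , d)) ⟺
    (0 < G kindTag (toℕ i) 0 × colourOf (G colourTag (toℕ i) 0) ≡ c × directionOf (G directionTag (toℕ i) 0) ≡ d)
  mark-iff i rewrite block≡ i with G kindTag (toℕ i) 0
  ... | zero  = (λ ()) , (λ ())
  ... | suc _ = (λ { refl → s≤s z≤n , refl , refl }) , (λ { (_ , refl , refl) → refl })

-- Reachability and the shortening of paths

module _ {A : Set} where

  -- The common form of being supported, carried and pushed.
  data Reach (base : A → Set) (edge : A → A → Set) : A → Set where
    here  : ∀ {a} → base a → Reach base edge a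
    along : ∀ {a b} → edge a b → Reach base edge a → Reach base edge b

  -- Cutting out the part of a path v between two equal vertices, the first of
  -- which has number i and the second number i + e
  module Cut (v : ℕ → A) (i e : ℕ) (loop : v i ≡ v (i + e)) where

    jump : ℕ → ℕ
    jump t with t ℕ.≤? i
    ... | yes _ = t
    ... | no _  = t + e

    jump-low : ∀ {t} → t ≤ i → jump t ≡ t
    jump-low {t} t≤i with t ℕ.≤? i
    ... | yes _  = refl
    ... | no t≰i = contradiction t≤i t≰i

    jump-high : ∀ {t} → i < t → jump t ≡ t + e
    jump-high {t} i<t with t ℕ.≤? i
    ... | yes t≤i = contradiction t≤i (ℕ.<⇒≱ i<t)
    ... | no _    = refl

    -- Also at t = i, where both formulas give the same vertex.
    vertex-high : ∀ {t} → i ≤ t → v (jump t) ≡ v (t + e)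
    vertex-high {t} i≤t with ℕ.m≤n⇒m<n∨m≡n i≤t
    ... | inj₁ i<t  = cong v (jump-high i<t)
    ... | inj₂ refl = trans (cong v (jump-low ℕ.≤-refl)) loop

    jump-≤ : ∀ {t m} → t ≤ m → jump t ≤ m + e
    jump-≤ {t} {m} t≤m with t ℕ.≤? i
    ... | yes _ = ℕ.≤-trans t≤m (ℕ.m≤m+n m e)
    ... | no _  = ℕ.+-monoˡ-≤ e t≤m

    cut-edges : ∀ {R : A → A → Set} {m} → (∀ t → t < m + e → R (v t) (v (suc t))) →
                ∀ t → t < m → R (v (jump t)) (v (jump (suc t)))
    cut-edges {R} {m} edges t t<m with ℕ.<-≤-connex t i
    ... | inj₁ t<i = subst₂ (λ a b → R (v a) (v b)) (sym (jump-low (ℕ.<⇒≤ t<i))) (sym (jump-low t<i))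
                       (edges t (ℕ.≤-trans t<m (ℕ.m≤m+n m e)))
    ... | inj₂ i≤t = subst₂ R (sym (vertex-high i≤t)) (sym (cong v (jump-high (s≤s i≤t))))
                       (edges (t + e) (ℕ.+-monoˡ-≤ e t<m))

  record ShortPath (R : A → A → Set) (B : ℕ) (v : ℕ → A) (m : ℕ) : Set where
    field
      size   : ℕ
      short  : size < B
      vertex : ℕ → A
      first  : vertex 0 ≡ v 0
      last   : vertex size ≡ v m
      edges  : ∀ t → t < size → R (vertex t) (vertex (suc t))

  -- A path with `B` or more edges repeats a code, and the loop in between is cut out. The code has
  -- to be injective on the path only, since codes of states tell apart only tame ones. The lemma
  -- serves twice: for walks among blocks and for sequences of states.
  shorten : ∀ {R : A → A → Set} {B} (code : A → Fin B) fuel m (v : ℕ → A) → m ≤ fuel →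
    (∀ i j → i ≤ m → j ≤ m → code (v i) ≡ code (v j) → v i ≡ v j) →
    (∀ t → t < m → R (v t) (v (suc t))) → ShortPath R B v m
  shorten {R} {B} code fuel m v m≤fuel inj edges with m ℕ.<? B
  ... | yes m<B = record { size = m ; short = m<B ; vertex = v ; first = refl ; last = refl ; edges = edges }
  ... | no m≮B with Fin.pigeonhole (s≤s (ℕ.≮⇒≥ m≮B)) (λ (t : Fin (suc m)) → code (v (toℕ t)))
  ...   | a , b , a<b , same = descend fuel m≤fuel
    where
    i e m′ : ℕ
    i  = toℕ a
    e  = toℕ b ∸ i
    m′ = m ∸ e
    b≤m : toℕ b ≤ m
    b≤m = ℕ.≤-pred (toℕ<n b)
    i+e : i + e ≡ toℕ b
    i+e = ℕ.m+[n∸m]≡n (ℕ.<⇒≤ a<b)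
    m′+e : m′ + e ≡ m
    m′+e = ℕ.m∸n+n≡m (ℕ.≤-trans (ℕ.m∸n≤m (toℕ b) i) b≤m)
    i≤m′ : i ≤ m′
    i≤m′ = ℕ.m+n≤o⇒m≤o∸n i (ℕ.≤-trans (ℕ.≤-reflexive i+e) b≤m)
    loop : v i ≡ v (i + e)
    loop = trans (inj i (toℕ b) (ℕ.≤-trans (ℕ.<⇒≤ a<b) b≤m) b≤m same) (cong v (sym i+e))
    open Cut v i e loop
    smaller : m′ < m
    smaller = ℕ.∸-monoʳ-< {m} {e} {0} (ℕ.m<n⇒0<n∸m a<b) (ℕ.≤-trans (ℕ.m∸n≤m (toℕ b) i) b≤m)
    le : ∀ {t} → t ≤ m′ → jump t ≤ m
    le t≤m′ = ℕ.≤-trans (jump-≤ t≤m′) (ℕ.≤-reflexive m′+e)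
    descend : ∀ fuel → m ≤ fuel → ShortPath R B v m
    descend zero        m≤0 = contradiction (ℕ.≤-trans smaller m≤0) ℕ.n≮0
    descend (suc fuel′) m≤  = record
      { size = size ; short = short ; vertex = vertex
      ; first = trans first (cong v (jump-low z≤n))
      ; last = trans last (trans (vertex-high i≤m′) (cong v m′+e))
      ; edges = steps
      }
      where
      path : ShortPath R B (v ∘ jump) m′
      path = shorten code fuel′ m′ (v ∘ jump) (ℕ.≤-pred (ℕ.≤-trans smaller m≤))
        (λ i j i≤ j≤ → inj (jump i) (jump j) (le i≤) (le j≤))
        (cut-edges {R} {m′} (λ t t< → edges t (ℕ.≤-trans t< (ℕ.≤-reflexive m′+e))))
      open ShortPath path renaming (edges to steps)

iff-pair : ∀ {A B : Set} {a a′ : A} {b b′ : B} → (a ≡ a′ × b ≡ b′) ⟺ ((a , b) ≡ (a′ , b′))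
iff-pair = (λ { (refl , refl) → refl }) , (λ { refl → refl , refl })

module _ (L : Level) where
  open Level L
  open Game L

  Placed : Set
  Placed = ∀ i {p} → p ∈ footprint (block i) → Free p

  -- It makes occupied cells cells of the grid, within reach of the bounded quantifiers, and it
  -- confines the displacements.
  Safe : State → Set
  Safe s = ∀ {i p} → Occupies s i p → Free p

  Represents : Array → ℕ → State → Set
  Represents G t s = ∀ i → lookup s i ≡ stateOf G t (toℕ i)

module Reaching (x u : List Bool) (L : Level) (described : Describes L (certified x u))
  (k : ℕ) (few : length (Level.blocks L) ≤ k)
  (base : Formula 3) (edge : Formula 4) (t i₀ : ℕ)
  (P : Game.Index L → Set) (E : Game.Index L → Game.Index L → Set)
  (base-iff : ∀ l → Meaning.Holds x (lastPosition x u) (certified x u) base (toℕ l ∷ t ∷ i₀ ∷ []) ⟺ P l)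
  (edge-iff : ∀ j l → Meaning.Holds x (lastPosition x u) (certified x u) edge (toℕ j ∷ toℕ l ∷ t ∷ i₀ ∷ []) ⟺ E j l)
  where
  open Game L
  open Described x u L described

  sound : ∀ n l → Holds (reachF base edge n) (toℕ l ∷ t ∷ i₀ ∷ []) → Reach P E l
  sound zero    l h        = here (proj₁ (base-iff l) h)
  sound (suc n) l (inj₁ h) = here (proj₁ (base-iff l) h)
  sound (suc n) l (inj₂ (i , i< , h , h′)) with index i<
  ... | j , refl = along (proj₁ (edge-iff j l) h) (sound n j h′)

  -- Listed from the target back to the base, the order in which `reachF` unfolds.
  record Walk (l : Index) : Set where
    field
      size   : ℕ
      vertex : ℕ → Index
      first  : vertex 0 ≡ l
      last   : P (vertex size)
      edges  : ∀ n → n < size → E (vertex (suc n)) (vertex n)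

  walk : ∀ {l} → Reach P E l → Walk l
  walk {l} (here p) = record { size = 0 ; vertex = λ _ → l ; first = refl ; last = p ; edges = λ _ () }
  walk {l} (along e r) with walk r
  ... | record { size = m ; vertex = w ; first = refl ; last = p ; edges = es } = record
    { size = suc m ; vertex = λ { zero → l ; (suc n) → w n } ; first = refl ; last = p
    ; edges = λ { zero _ → e ; (suc n) (s≤s n<m) → es n n<m } }

  complete : ∀ n m (w : ℕ → Index) → m ≤ n → P (w m) → (∀ j → j < m → E (w (suc j)) (w j)) →
             Holds (reachF base edge n) (toℕ (w 0) ∷ t ∷ i₀ ∷ [])
  complete zero    zero    w _ p es = proj₂ (base-iff _) p
  complete (suc n) zero    w _ p es = inj₁ (proj₂ (base-iff _) p)
  complete (suc n) (suc m) w (s≤s m≤n) p es =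
    inj₂ (toℕ (w 1) , index< (w 1) , proj₂ (edge-iff _ _) (es 0 (s≤s z≤n)) ,
          complete n m (w ∘ suc) m≤n p (λ j j<m → es (suc j) (s≤s j<m)))

  -- A walk shortened with the identity as code has fewer edges than there are blocks, so it fits
  -- into `k` rounds.
  reach-iff : ∀ l → Holds (reachF base edge k) (toℕ l ∷ t ∷ i₀ ∷ []) ⟺ Reach P E l
  reach-iff l = sound k l , λ r →
    let open Walk (walk r)
        path = shorten {R = λ a b → E b a} id size size vertex ℕ.≤-refl (λ _ _ _ _ eq → eq) edges
        module S = ShortPath path
    in subst (λ a → Holds (reachF base edge k) (toℕ a ∷ t ∷ i₀ ∷ [])) (trans S.first first)
         (complete k S.size S.vertex (ℕ.≤-trans (ℕ.<⇒≤ S.short) few) (subst P (sym S.last) last) S.edges)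

-- Meaning of the formulas in a single safe state

module At (x u : List Bool) (L : Level) (described : Describes L (certified x u))
  (k : ℕ) (few : length (Level.blocks L) ≤ k) (placed : Placed L)
  (t : ℕ) (s : Game.State L) (st : Represents L (certified x u) t s) (safe : Safe L s) where
  open Level L
  open Game L
  open Grid L
  open Described x u L described
  open Describes described

  occupied-inside : ∀ {i p} → Occupies s i p → Inside p
  occupied-inside = free-inside ∘ safe

  body-inside : ∀ {i p} → Body s i p → Inside p
  body-inside = occupied-inside ∘ inj₁

  bloomed-iff : ∀ i → (0 < G bloomedTag t (toℕ i)) ⟺ (bloomed (lookup s i) ≡ true)
  bloomed-iff i rewrite st i = isPositive-iff _

  opaque
    unfolding bodyF

    body-iff : ∀ i r c → Holds bodyF (t ∷ toℕ i ∷ r ∷ c ∷ []) ⟺ Body s i (cell (r , c))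
    body-iff i r c =
      someCell-iff {P = λ f → f ∈ footprint (block i) × f +ᶜ place ≡ cell (r , c)} (λ (f∈ , _) → free-inside (placed i f∈))
        (λ fr fc → iff-× (foot-iff i fr fc)
          (iff-× (balance-iff fr a r R iff-then iff-sym (shifted-sum fr a r R))
                 (balance-iff fc b c C iff-then iff-sym (shifted-sum fc b c C)) iff-then iff-pair))
      iff-then (forth , back)
      where
      R C a b : ℕ
      R = G rowsTag 0 0
      C = G colsTag 0 0
      a = G stateRowTag t (toℕ i)
      b = G stateColTag t (toℕ i)
      place : Cell
      place = cell (a , b) +ᶜ offset G
      forth : ∃[ f ] (f ∈ footprint (block i) × f +ᶜ place ≡ cell (r , c)) → Body s i (cell (r , c))
      forth (f , f∈ , eq) rewrite st i = subst (_∈ _) eq (∈-map⁺ (_+ᶜ place) f∈)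
      back : Body s i (cell (r , c)) → ∃[ f ] (f ∈ footprint (block i) × f +ᶜ place ≡ cell (r , c))
      back h rewrite st i with ∈-map⁻ (_+ᶜ place) h
      ... | f , f∈ , eq = f , f∈ , sym eq

  opaque
    unfolding besideF

    beside-iff : ∀ d i r c → Holds (besideF d) (t ∷ toℕ i ∷ r ∷ c ∷ []) ⟺ Beside s i d (cell (r , c))
    beside-iff d i r c = iff-× (iff-¬ (body-iff i r c))
      (someCell-iff {P = λ q → step d q ≡ cell (r , c) × Body s i q} (λ (_ , b) → body-inside b)
         (λ r′ c′ → iff-× (step-iff d r′ c′ r c) (body-iff i r′ c′))
       iff-then
       (λ (q , eq , b) → subst (Body s i) (trans (sym (step-opposite d q)) (cong (step (opposite d)) eq)) b) ,
       (λ b → _ , opposite-step d _ , b))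

  opaque
    unfolding occupiesF

    petal-iff : ∀ i r c → Holds petalF (t ∷ toℕ i ∷ r ∷ c ∷ []) ⟺ Petal s i (colourOf (G colourTag (toℕ i) 0)) (cell (r , c))
    petal-iff i r c =
      iff-× (bloomed-iff i)
        ((λ (k>0 , h) → _ , proj₂ (mark-iff i) (k>0 , refl , refl) ,
            proj₁ (beside-iff _ i r c) (proj₁ (byDirection-iff (λ d → Holds (besideF d) (t ∷ toℕ i ∷ r ∷ c ∷ [])) (G directionTag (toℕ i) 0)) h)) ,
         (λ (d , m , b) → let (k>0 , _ , eq) = proj₁ (mark-iff i) m in
            k>0 , proj₂ (byDirection-iff (λ d → Holds (besideF d) (t ∷ toℕ i ∷ r ∷ c ∷ [])) (G directionTag (toℕ i) 0))
              (subst (λ d → Holds (besideF d) (t ∷ toℕ i ∷ r ∷ c ∷ [])) (sym eq) (proj₂ (beside-iff d i r c) b))))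

    petal-colour : ∀ {i c p} → Petal s i c p → colourOf (G colourTag (toℕ i) 0) ≡ c
    petal-colour {i} (_ , _ , m , _) = proj₁ (proj₂ (proj₁ (mark-iff i) m))

    occupies-iff : ∀ i r c → Holds occupiesF (t ∷ toℕ i ∷ r ∷ c ∷ []) ⟺ Occupies s i (cell (r , c))
    occupies-iff i r c = iff-⊎ (body-iff i r c)
      ((λ h → _ , proj₁ (petal-iff i r c) h) ,
       (λ (a , p) → proj₂ (petal-iff i r c) (subst (λ a → Petal s i a (cell (r , c))) (sym (petal-colour p)) p)))

    flowerAt-iff : ∀ v r c → Holds flowerAtF (t ∷ v ∷ r ∷ c ∷ []) ⟺ FlowerAt s (colourOf v) (cell (r , c))
    flowerAt-iff v r c = iff-⊎ (flower-iff v r c)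
      (someIndex-iff {P = λ j → Petal s j (colourOf v) (cell (r , c))} λ j →
        (λ (same , h) → subst (λ a → Petal s j a (cell (r , c)))
          (proj₁ (sameColour-iff (G colourTag (toℕ j) 0) v) same) (proj₁ (petal-iff j r c) h)) ,
        (λ p → proj₂ (sameColour-iff (G colourTag (toℕ j) 0) v) (petal-colour p) ,
               proj₂ (petal-iff j r c) (subst (λ a → Petal s j a (cell (r , c))) (sym (petal-colour p)) p)))

  -- A one-point rule: the quantified cell is determined by `stepF`. If the neighbour lies off the
  -- grid, both sides fail.
  next-iff : ∀ d {H : ℕ → ℕ → Set} {r c} {Q : Cell → Set} → (∀ {q} → Q q → Inside q) →
    (∀ r′ c′ → H r′ c′ ⟺ Q (cell (r′ , c′))) →
    (∃[ r′ ] (r′ < G rowsTag 0 0 × ∃[ c′ ] (c′ < G colsTag 0 0 ×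
      Holds (stepF d) (r ∷ c ∷ r′ ∷ c′ ∷ []) × H r′ c′))) ⟺ Q (step d (cell (r , c)))
  next-iff d {H} {r} {c} {Q} inside h =
    someCell-iff {P = λ q → step d (cell (r , c)) ≡ q × Q q} (λ (_ , q) → inside q)
      (λ r′ c′ → iff-× (step-iff d r c r′ c′) (h r′ c′))
    iff-then (λ { (_ , refl , q) → q }) , (λ q → _ , refl , q)

  same-index : ∀ (i j : Index) → (toℕ i ≡ toℕ j) ⟺ (i ≡ j)
  same-index i j = toℕ-injective , cong toℕ

  OnGrid : Index → Set
  OnGrid i = ∃[ p ] (Occupies s i p × ¬ Free (step down p))

  opaque
    unfolding restsOnF

    restsOn-iff : ∀ j i → Holds restsOnF (t ∷ toℕ j ∷ toℕ i ∷ []) ⟺ RestsOn s j i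
    restsOn-iff j i = iff-× (iff-¬ (same-index j i))
      (someCell-iff (λ (o , _) → occupied-inside o) λ r c →
        iff-× (occupies-iff j r c) (next-iff down {Q = Occupies s i} occupied-inside (occupies-iff i)))

    onGrid-iff : ∀ i → Holds onGridF (t ∷ toℕ i ∷ []) ⟺ OnGrid i
    onGrid-iff i = someCell-iff (λ (o , _) → occupied-inside o) λ r c →
      iff-× (occupies-iff i r c) (iff-¬ (someCell-iff {P = λ q → step down (cell (r , c)) ≡ q × Free q} (λ (_ , f) → free-inside f)
        (λ r′ c′ → iff-× (step-iff down r c r′ c′) (empty-iff r′ c′))
        iff-then (λ { (_ , refl , q) → q }) , (λ q → _ , refl , q)))

  PushBase : Index → Direction → Index → Set
  PushBase i d l = ∃[ p ] (Beside s i d p × Occupies s l p)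

  PushEdge : Index → Direction → Index → Index → Set
  PushEdge i d j l =
    (∃[ p ] (Occupies s j p × Occupies s l (step d p))) ⊎ (Horizontal d × RestsOn s l j × l ≢ i)

  opaque
    unfolding supportBaseF

    horizontal-iff : ∀ {m} d {ρ : Vec ℕ m} → Holds (horizontalF d) ρ ⟺ Horizontal d
    horizontal-iff up    = (λ ()) , (λ ())
    horizontal-iff down  = (λ ()) , (λ ())
    horizontal-iff left  = (λ _ → left) , (λ _ → refl)
    horizontal-iff right = (λ _ → right) , (λ _ → refl)

    supportBase-iff : ∀ i₀ i → Holds supportBaseF (toℕ i ∷ t ∷ i₀ ∷ []) ⟺ OnGrid i
    supportBase-iff i₀ i = onGrid-iff i

    supportEdge-iff : ∀ i₀ j l → Holds supportEdgeF (toℕ j ∷ toℕ l ∷ t ∷ i₀ ∷ []) ⟺ RestsOn s l j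
    supportEdge-iff i₀ j l = restsOn-iff l j

    carryBase-iff : ∀ (i l : Index) → Holds carryBaseF (toℕ l ∷ t ∷ toℕ i ∷ []) ⟺ (l ≡ i)
    carryBase-iff i l = same-index l i

    pushBase-iff : ∀ i d l → Holds (pushBaseF d) (toℕ l ∷ t ∷ toℕ i ∷ []) ⟺ PushBase i d l
    pushBase-iff i d l = someCell-iff (λ (_ , o) → occupied-inside o) λ r c →
      iff-× (beside-iff d i r c) (occupies-iff l r c)

    pushEdge-iff : ∀ i d j l → Holds (pushEdgeF d) (toℕ j ∷ toℕ l ∷ t ∷ toℕ i ∷ []) ⟺ PushEdge i d j l
    pushEdge-iff i d j l = iff-⊎
      (someCell-iff (λ (o , _) → occupied-inside o) λ r c →
        iff-× (occupies-iff j r c) (next-iff d occupied-inside (occupies-iff l)))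
      (iff-× (horizontal-iff d) (iff-× (restsOn-iff l j) (iff-¬ (same-index l i))))

  supported-iff : ∀ i₀ i → Holds (supportF k) (toℕ i ∷ t ∷ i₀ ∷ []) ⟺ Supported s i
  supported-iff i₀ i =
    Reaching.reach-iff x u L described k few supportBaseF supportEdgeF t i₀ _ _ (supportBase-iff i₀) (supportEdge-iff i₀) i
    iff-then forth , back
    where
    forth : ∀ {i} → Reach OnGrid (λ j l → RestsOn s l j) i → Supported s i
    forth (here (p , o , ¬f)) = on-grid o ¬f
    forth (along e r)         = on-block e (forth r)
    back : ∀ {i} → Supported s i → Reach OnGrid (λ j l → RestsOn s l j) i
    back (on-grid o ¬f) = here (_ , o , ¬f)
    back (on-block e r) = along e (back r)

  carried-iff : ∀ i l → Holds (carryF k) (toℕ l ∷ t ∷ toℕ i ∷ []) ⟺ Carried s i l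
  carried-iff i l =
    Reaching.reach-iff x u L described k few carryBaseF supportEdgeF t (toℕ i) _ _ (carryBase-iff i) (supportEdge-iff (toℕ i)) l
    iff-then forth , back
    where
    forth : ∀ {l} → Reach (_≡ i) (λ j l → RestsOn s l j) l → Carried s i l
    forth (here refl)  = itself
    forth (along e r)  = rider (forth r) e
    back : ∀ {l} → Carried s i l → Reach (_≡ i) (λ j l → RestsOn s l j) l
    back itself      = here refl
    back (rider r e) = along e (back r)

  pushed-iff : ∀ i d l → Holds (pushF k d) (toℕ l ∷ t ∷ toℕ i ∷ []) ⟺ Pushed s i d l
  pushed-iff i d l =
    Reaching.reach-iff x u L described k few (pushBaseF d) (pushEdgeF d) t (toℕ i) _ _ (pushBase-iff i d) (pushEdge-iff i d) l
    iff-then forth , back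
    where
    forth : ∀ {l} → Reach (PushBase i d) (PushEdge i d) l → Pushed s i d l
    forth (here (p , b , o))                = by-flower b o
    forth (along (inj₁ (p , o , o′)) r)     = by-block (forth r) o o′
    forth (along (inj₂ (h , e , l≢i)) r)    = rider h (forth r) e l≢i
    back : ∀ {l} → Pushed s i d l → Reach (PushBase i d) (PushEdge i d) l
    back (by-flower b o)     = here (_ , b , o)
    back (by-block r o o′)   = along (inj₁ (_ , o , o′)) (back r)
    back (rider h r e l≢i)   = along (inj₂ (h , e , l≢i)) (back r)

  opaque
    unfolding roomF

    room-iff : ∀ moving d i₀ {M : Index → Set} → (∀ j → Holds moving (toℕ j ∷ t ∷ i₀ ∷ []) ⟺ M j) →
               Holds (roomF moving d) (t ∷ i₀ ∷ []) ⟺ Room s M d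
    room-iff moving d i₀ {M} m =
      everyIndex-iff {P = λ j → M j → ∀ {p} → Occupies s j p → Q (step d p)} (λ j → iff-→ (m j)
        (everyCell-iff occupied-inside (occupies-iff j) λ r c →
          next-iff d {Q = Q} (λ (f , _) → free-inside f) λ r′ c′ →
            iff-× (empty-iff r′ c′) (everyIndex-iff λ l → iff-→ (occupies-iff l r′ c′) (m l))))
      iff-then (λ f {j} {p} mj o → let (free , all) = f j mj o in free , λ {l} → all l) ,
               (λ room j mj {p} o → let (free , all) = room mj o in free , λ l → all {l})
      where
      Q : Cell → Set
      Q q = Free q × (∀ l → Occupies s l q → M l)

  opaque
    unfolding movedF

    contact-iff : ∀ i → Holds contactF (t ∷ toℕ i ∷ []) ⟺ Contact s i (colourOf (G colourTag (toℕ i) 0))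
    contact-iff i =
      someCell-iff {P = λ p → Body s i p × ∃[ q ] ((∃[ d ] (step d p ≡ q)) × FlowerAt s a q)} (λ (b , _) → body-inside b)
        (λ r c → iff-× (body-iff i r c) (someCell-iff (λ {q} (_ , f) → flower-inside q f) λ r′ c′ →
          iff-× (adjacent-iff r c r′ c′) (flowerAt-iff _ r′ c′)))
      iff-then (λ { (p , b , _ , (d , refl) , f) → p , d , b , f }) ,
               (λ { (p , d , b , f) → p , b , _ , (d , refl) , f })
      where
      a : Colour
      a = colourOf (G colourTag (toℕ i) 0)
      flower-inside : ∀ q → FlowerAt s a q → Inside q
      flower-inside q (inj₁ eq)      = tile-inside q eq
      flower-inside q (inj₂ (j , p)) = occupied-inside (inj₂ (_ , p))

    -- The formula demands that the cell beyond every body cell be empty. Where that cell belongs to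
    -- the body itself, safety already makes it free.
    clearSide-iff : ∀ i d → Holds (clearSideF d) (t ∷ toℕ i ∷ []) ⟺ (∀ {p} → Beside s i d p → Free p)
    clearSide-iff i d =
      everyCell-iff body-inside (body-iff i) (λ r c → next-iff d {Q = Free} free-inside empty-iff)
      iff-then (λ f {p} (_ , b) → subst Free (opposite-step d p) (f b)) ,
               (λ f {p} b → clear f b)
      where
      clear : (∀ {p} → Beside s i d p → Free p) → ∀ {p} → Body s i p → Free (step d p)
      clear f {p} b = free-stable {step d p} λ ¬free → ¬free
        (f ((λ b′ → ¬free (safe (inj₁ b′))) , subst (Body s i) (sym (step-opposite d p)) b))

-- Steps from one state to the next

iff-blockState : ∀ {a b p q} → (p ≡ q × a ≡ b) ⟺ (blockState p a ≡ blockState q b)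
iff-blockState = (λ { (refl , refl) → refl }) , (λ { refl → refl , refl })

same-positive : ∀ v w → (v ≡ 0 × w ≡ 0 ⊎ 0 < v × 0 < w) ⟺ (isPositive w ≡ isPositive v)
same-positive zero    zero    = (λ _ → refl) , (λ _ → inj₁ (refl , refl))
same-positive zero    (suc w) = (λ { (inj₁ (_ , ())) ; (inj₂ (() , _)) }) , (λ ())
same-positive (suc v) zero    = (λ { (inj₁ (() , _)) ; (inj₂ (_ , ())) }) , (λ ())
same-positive (suc v) (suc w) = (λ _ → refl) , (λ _ → inj₂ (s≤s z≤n , s≤s z≤n))

isZero-iff : ∀ v → (v ≡ 0) ⟺ (isPositive v ≡ false)
isZero-iff zero    = (λ _ → refl) , (λ _ → refl)
isZero-iff (suc v) = (λ ()) , (λ ())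

lookup-extensional : ∀ {A : Set} {n} (xs ys : Vec A n) → (∀ i → lookup xs i ≡ lookup ys i) → xs ≡ ys
lookup-extensional xs ys h =
  trans (sym (Vec.tabulate∘lookup xs)) (trans (Vec.tabulate-cong h) (Vec.tabulate∘lookup ys))

module _ (L : Level) where
  open Game L

  -- One step of the game, whether it is made by the player or not
  Micro : State → State → Set
  Micro s s′ = s ↝ s′ ⊎ (Settled s × Slide s s′)

  setBloomed : BlockState → BlockState
  setBloomed b = record b { bloomed = true }

  -- The rule `bloom` without its intermediate state, as the array records only the states before
  -- and after.
  Blossoms : State → State → Index → Direction → Set
  Blossoms s s′ i d = CanBloom s i d × (∀ j →
    (j ≡ i × lookup s′ j ≡ setBloomed (lookup s j)) ⊎
    (j ≢ i × (Pushed s i d j → lookup s′ j ≡ shift d (lookup s j)) × (¬ Pushed s i d j → lookup s′ j ≡ lookup s j)))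

  blossoms⇒↝ : ∀ {s s′ i d} → Blossoms s s′ i d → s ↝ s′
  blossoms⇒↝ {s} {s′} {i} {d} (can , h) = subst (s ↝_) (lookup-extensional _ _ same) (bloom {s′ = s₁} can shifted)
    where
    s₁ : State
    -- The intermediate state is recovered by closing the flower again; block `i` itself has not
    -- moved.
    s₁ = s′ Vec.[ i ]≔ lookup s i
    shifted : Shifted (Pushed s i d) d s s₁
    shifted j with h j
    ... | inj₁ (refl , _) =
      (λ p → contradiction p (CanBloom.unmoved can)) , (λ _ → Vec.lookup∘update i s′ _)
    ... | inj₂ (j≢i , f , g) =
      (λ p → trans (Vec.lookup∘update′ j≢i s′ _) (f p)) , (λ ¬p → trans (Vec.lookup∘update′ j≢i s′ _) (g ¬p))
    same : ∀ j → lookup (s₁ Vec.[ i ]%= setBloomed) j ≡ lookup s′ j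
    same j with h j
    ... | inj₁ (refl , eq) = trans (Vec.lookup∘updateAt i s₁) (trans (cong setBloomed (Vec.lookup∘update i s′ _)) (sym eq))
    ... | inj₂ (j≢i , _)   = trans (Vec.lookup∘updateAt′ j i j≢i s₁) (Vec.lookup∘update′ j≢i s′ _)

  bloom⇒blossoms : ∀ {s s₁ i d} → CanBloom s i d → Shifted (Pushed s i d) d s s₁ →
                   Blossoms s (s₁ Vec.[ i ]%= setBloomed) i d
  bloom⇒blossoms {s} {s₁} {i} {d} can shifted = can , λ j → at-index j (j Fin.≟ i)
    where
    at-index : ∀ j → Dec (j ≡ i) →
      (j ≡ i × lookup (s₁ Vec.[ i ]%= setBloomed) j ≡ setBloomed (lookup s j)) ⊎
      (j ≢ i × (Pushed s i d j → lookup (s₁ Vec.[ i ]%= setBloomed) j ≡ shift d (lookup s j)) ×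
               (¬ Pushed s i d j → lookup (s₁ Vec.[ i ]%= setBloomed) j ≡ lookup s j))
    at-index j (yes refl) = inj₁ (refl , trans (Vec.lookup∘updateAt i s₁)
      (cong setBloomed (proj₂ (shifted i) (CanBloom.unmoved can))))
    at-index j (no j≢i) = inj₂ (j≢i ,
      (λ p → trans (Vec.lookup∘updateAt′ j i j≢i s₁) (proj₁ (shifted j) p)) ,
      (λ ¬p → trans (Vec.lookup∘updateAt′ j i j≢i s₁) (proj₂ (shifted j) ¬p)))

-- Meaning of the formulas about blooming, falling and sliding

module Blooming (x u : List Bool) (L : Level) (described : Describes L (certified x u))
  (k : ℕ) (few : length (Level.blocks L) ≤ k) (placed : Placed L)
  (t : ℕ) (s : Game.State L) (st : Represents L (certified x u) t s) (safe : Safe L s) where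
  open Level L
  open Game L
  open Described x u L described
  open At x u L described k few placed t s st safe

  BloomsIn : Index → Direction → Set
  BloomsIn i d = Contact s i (colourOf (G colourTag (toℕ i) 0)) × (∀ {p} → Beside s i d p → Free p) ×
                 (¬ Pushed s i d i) × Room s (Pushed s i d) d

  opaque
    unfolding bloomsInF

    bloomsIn-iff : ∀ d i → Holds (bloomsInF k d) (t ∷ toℕ i ∷ []) ⟺ BloomsIn i d
    bloomsIn-iff d i = iff-× (contact-iff i) (iff-× (clearSide-iff i d)
      (iff-× (iff-¬ (pushed-iff i d i)) (room-iff (pushF k d) d (toℕ i) (pushed-iff i d))))

  unbloomed-iff : ∀ i → (G bloomedTag t (toℕ i) ≡ 0) ⟺ (bloomed (lookup s i) ≡ false)
  unbloomed-iff i rewrite st i = isZero-iff _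

  Coloured : Index → Set
  Coloured i = 0 < G kindTag (toℕ i) 0

  canBloom-iff : ∀ i d → CanBloom s i d ⟺
    (Coloured i × bloomed (lookup s i) ≡ false × directionOf (G directionTag (toℕ i) 0) ≡ d × BloomsIn i d)
  canBloom-iff i d =
    (λ can → let open CanBloom can ; (k>0 , c≡ , d≡) = proj₁ (mark-iff i) marked in
       k>0 , unbloomed , d≡ , subst (Contact s i) (sym c≡) contact , free , unmoved , room) ,
    (λ (k>0 , un , d≡ , touch , fr , unm , ro) → record
       { colour = _ ; marked = proj₂ (mark-iff i) (k>0 , refl , d≡) ; unbloomed = un ; contact = touch
       ; free = fr ; unmoved = unm ; room = ro })

  opaque
    unfolding canBloomF

    canBloomF-iff : ∀ i → Holds (canBloomF k) (t ∷ toℕ i ∷ []) ⟺ (∃[ d ] CanBloom s i d)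
    canBloomF-iff i =
      iff-× iff-refl (iff-× (unbloomed-iff i)
        (byDirection-iff (λ d → Holds (bloomsInF k d) (t ∷ toℕ i ∷ [])) (G directionTag (toℕ i) 0)
         iff-then bloomsIn-iff _ i))
      iff-then (λ (k>0 , un , b) → _ , proj₂ (canBloom-iff i _) (k>0 , un , refl , b)) ,
               (λ (d , can) → forth d (proj₁ (canBloom-iff i d) can))
      where
      forth : ∀ d → Coloured i × bloomed (lookup s i) ≡ false × directionOf (G directionTag (toℕ i) 0) ≡ d × BloomsIn i d →
              Coloured i × bloomed (lookup s i) ≡ false × BloomsIn i (directionOf (G directionTag (toℕ i) 0))
      forth d (k>0 , un , refl , b) = k>0 , un , b

  opaque
    unfolding noBloomF

    noBloom-iff : Holds (noBloomF k) (t ∷ []) ⟺ NoBloom s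
    noBloom-iff = everyIndex-iff (λ i → iff-¬ (canBloomF-iff i))
      iff-then (λ h i d can → h i (d , can)) , (λ h i (d , can) → h i d can)

    allSupported-iff : Holds (allSupportedF k) (t ∷ []) ⟺ (∀ i → Supported s i)
    allSupported-iff = everyIndex-iff (λ i → supported-iff (toℕ i) i)

    allBloomed-iff : Holds allBloomedF (t ∷ []) ⟺ AllBloomed s
    allBloomed-iff = everyIndex-iff (λ i → iff-→ iff-refl (bloomed-iff i))
      iff-then (λ h i {c} {d} m → h i (proj₁ (proj₁ (mark-iff i {c} {d}) m))) ,
               (λ h i k>0 → h i {_} {_} (proj₂ (mark-iff i) (k>0 , refl , refl)))

  settled-iff : Holds (settledF k) (t ∷ []) ⟺ Settled s
  settled-iff = iff-× noBloom-iff allSupported-iff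

  module Stepping (t′ : ℕ) (s′ : State) (st′ : Represents L (certified x u) t′ s′) where

    opaque
      unfolding roomF

      sameBloom-iff : ∀ j → Holds sameBloomF (t ∷ t′ ∷ j ∷ []) ⟺ (isPositive (G bloomedTag t′ j) ≡ isPositive (G bloomedTag t j))
      sameBloom-iff j = same-positive (G bloomedTag t j) (G bloomedTag t′ j)

      samePlace-iff : ∀ j → Holds samePlaceF (t ∷ t′ ∷ j ∷ []) ⟺
        (cell (G stateRowTag t′ j , G stateColTag t′ j) +ᶜ offset G ≡ cell (G stateRowTag t j , G stateColTag t j) +ᶜ offset G)
      samePlace-iff j =
        (λ (eq , eq′) → cong₂ (λ a b → cell (a , b) +ᶜ offset G) eq eq′) ,
        (λ eq → cell-injective (+ᶜ-cancelʳ _ _ (offset G) eq))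

    opaque
      unfolding movedF

      moved-iff : ∀ d j → Holds (movedF d) (t ∷ t′ ∷ toℕ j ∷ []) ⟺ (lookup s′ j ≡ shift d (lookup s j))
      moved-iff d j rewrite st j | st′ j =
        iff-× (step-iff d _ _ _ _ iff-then
                 (λ eq → trans (cong (_+ᶜ offset G) (sym eq)) (sym (step-+ᶜ d _ (offset G)))) ,
                 (λ eq → sym (+ᶜ-cancelʳ _ _ (offset G) (trans eq (step-+ᶜ d _ (offset G))))))
              (sameBloom-iff (toℕ j))
        iff-then iff-blockState

      kept-iff : ∀ j → Holds keptF (t ∷ t′ ∷ toℕ j ∷ []) ⟺ (lookup s′ j ≡ lookup s j)
      kept-iff j rewrite st j | st′ j = iff-× (samePlace-iff (toℕ j)) (sameBloom-iff (toℕ j)) iff-then iff-blockState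

    ShiftedAt : (Index → Set) → Direction → Index → Set
    ShiftedAt M d j = (M j → lookup s′ j ≡ shift d (lookup s j)) × (¬ M j → lookup s′ j ≡ lookup s j)

    opaque
      unfolding noBloomF

      shifted-iff : ∀ moving d i₀ {M : Index → Set} j → Holds moving (toℕ j ∷ t ∷ i₀ ∷ []) ⟺ M j →
                    Holds (shiftedF moving d) (toℕ j ∷ t ∷ i₀ ∷ t′ ∷ []) ⟺ ShiftedAt M d j
      shifted-iff moving d i₀ {M} j m =
        iff-⊎ (iff-× m (moved-iff d j)) (iff-× (iff-¬ m) (kept-iff j)) iff-then forth , back (holds? moving (toℕ j ∷ t ∷ i₀ ∷ []))
        where
        forth : M j × lookup s′ j ≡ shift d (lookup s j) ⊎ (¬ M j) × lookup s′ j ≡ lookup s j → ShiftedAt M d j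
        forth (inj₁ (mj , eq))  = (λ _ → eq) , (λ ¬mj → contradiction mj ¬mj)
        forth (inj₂ (¬mj , eq)) = (λ mj → contradiction mj ¬mj) , (λ _ → eq)
        back : Dec (Holds moving (toℕ j ∷ t ∷ i₀ ∷ [])) → ShiftedAt M d j →
               M j × lookup s′ j ≡ shift d (lookup s j) ⊎ (¬ M j) × lookup s′ j ≡ lookup s j
        back (yes h) (f , g) = inj₁ (proj₁ m h , f (proj₁ m h))
        back (no ¬h) (f , g) = inj₂ (¬h ∘ proj₂ m , g (¬h ∘ proj₂ m))

      blossom-iff : ∀ j → Holds blossomF (t ∷ t′ ∷ toℕ j ∷ []) ⟺ (lookup s′ j ≡ setBloomed L (lookup s j))
      blossom-iff j rewrite st j | st′ j = iff-× (samePlace-iff (toℕ j)) (isPositive-iff _) iff-then iff-blockState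

    opaque
      unfolding bloomF

      bloom-iff : ∀ d i → Holds (bloomF k d) (toℕ i ∷ t ∷ t′ ∷ []) ⟺
        (BloomsIn i d × (∀ j → (j ≡ i × lookup s′ j ≡ setBloomed L (lookup s j)) ⊎ (j ≢ i × ShiftedAt (Pushed s i d) d j)))
      bloom-iff d i = iff-× (bloomsIn-iff d i) (everyIndex-iff λ j →
        iff-⊎ (iff-× (same-index j i) (blossom-iff j))
              (iff-× (iff-¬ (same-index j i)) (shifted-iff (pushF k d) d (toℕ i) {M = Pushed s i d} j (pushed-iff i d j))))

      slide-iff : ∀ d i → Holds (slideF k d) (toℕ i ∷ t ∷ t′ ∷ []) ⟺
                  (Room s (Carried s i) d × Shifted (Carried s i) d s s′)
      slide-iff d i = iff-× (room-iff (carryF k) d (toℕ i) (carried-iff i))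
        (everyIndex-iff λ j → shifted-iff (carryF k) d (toℕ i) {M = Carried s i} j (carried-iff i j))

    opaque
      unfolding bloomStepF

      bloomStep-iff : Holds (bloomStepF k) (t ∷ t′ ∷ []) ⟺ (∃[ i ] ∃[ d ] Blossoms L s s′ i d)
      bloomStep-iff = someIndex-iff λ i →
        iff-× iff-refl (iff-× (unbloomed-iff i)
          (byDirection-iff (λ d → Holds (bloomF k d) (toℕ i ∷ t ∷ t′ ∷ [])) (G directionTag (toℕ i) 0)
           iff-then bloom-iff _ i))
        iff-then (λ (k>0 , un , b , h) → _ , proj₂ (canBloom-iff i _) (k>0 , un , refl , b) , h) ,
                 (λ (d , can , h) → forth i d (proj₁ (canBloom-iff i d) can) h)
        where
        Rest : Index → Direction → Set
        Rest i d = ∀ j → (j ≡ i × lookup s′ j ≡ setBloomed L (lookup s j)) ⊎ (j ≢ i × ShiftedAt (Pushed s i d) d j)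
        forth : ∀ i d → Coloured i × bloomed (lookup s i) ≡ false × directionOf (G directionTag (toℕ i) 0) ≡ d × BloomsIn i d →
                Rest i d → Coloured i × bloomed (lookup s i) ≡ false ×
                BloomsIn i (directionOf (G directionTag (toℕ i) 0)) × Rest i (directionOf (G directionTag (toℕ i) 0))
        forth i d (k>0 , un , refl , b) h = k>0 , un , b , h

      fallStep-iff : Holds (fallStepF k) (t ∷ t′ ∷ []) ⟺
        (NoBloom s × ∃ (Unsupported s) × Shifted (Unsupported s) down s s′)
      fallStep-iff = iff-× noBloom-iff (iff-×
        (someIndex-iff λ i → iff-¬ (supported-iff (toℕ i) i))
        (everyIndex-iff λ j → shifted-iff (¬ᶠ (supportF k)) down (toℕ j) {M = Unsupported s} j (iff-¬ (supported-iff (toℕ j) j))))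

      slideStep-iff : Holds (slideStepF k) (t ∷ t′ ∷ []) ⟺ (Settled s × Slide s s′)
      slideStep-iff = iff-× settled-iff (iff-⊎ (someIndex-iff (slide-iff left)) (someIndex-iff (slide-iff right))
        iff-then (λ { (inj₁ (i , h)) → i , left , left , h ; (inj₂ (i , h)) → i , right , right , h }) ,
                 (λ { (i , _ , left , h) → inj₁ (i , h) ; (i , _ , right , h) → inj₂ (i , h) }))

    micro-iff : Holds (microF k) (t ∷ t′ ∷ []) ⟺ Micro L s s′
    micro-iff = iff-⊎ bloomStep-iff (iff-⊎ fallStep-iff slideStep-iff) iff-then forth , back
      where
      forth : (∃[ i ] ∃[ d ] Blossoms L s s′ i d) ⊎
              (NoBloom s × ∃ (Unsupported s) × Shifted (Unsupported s) down s s′) ⊎ (Settled s × Slide s s′) → Micro L s s′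
      forth (inj₁ (_ , _ , b))                     = inj₁ (blossoms⇒↝ L b)
      forth (inj₂ (inj₁ (none , (_ , un) , sh)))   = inj₁ (fall none un sh)
      forth (inj₂ (inj₂ h))                        = inj₂ h
      back : Micro L s s′ → (∃[ i ] ∃[ d ] Blossoms L s s′ i d) ⊎
             (NoBloom s × ∃ (Unsupported s) × Shifted (Unsupported s) down s s′) ⊎ (Settled s × Slide s s′)
      back (inj₁ (bloom {s′ = s₁} can sh))    = inj₁ (_ , _ , bloom⇒blossoms L {s₁ = s₁} can sh)
      back (inj₁ (fall none un sh)) = inj₂ (inj₁ (none , (_ , un) , sh))
      back (inj₂ h)                 = inj₂ (inj₂ h)

-- Safety during play, and plays as traces of single steps

step-comm : ∀ d e p → step d (step e p) ≡ step e (step d p)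
step-comm up    up    p = refl
step-comm up    down  (r , c) = cong (_, c) (trans (ℤ.pred-suc r) (sym (ℤ.suc-pred r)))
step-comm up    left  p = refl
step-comm up    right p = refl
step-comm down  up    (r , c) = cong (_, c) (trans (ℤ.suc-pred r) (sym (ℤ.pred-suc r)))
step-comm down  down  p = refl
step-comm down  left  p = refl
step-comm down  right p = refl
step-comm left  up    p = refl
step-comm left  down  p = refl
step-comm left  left  p = refl
step-comm left  right (r , c) = cong (r ,_) (trans (ℤ.pred-suc c) (sym (ℤ.suc-pred c)))
step-comm right up    p = refl
step-comm right down  p = refl
step-comm right left  (r , c) = cong (r ,_) (trans (ℤ.suc-pred c) (sym (ℤ.pred-suc c)))
step-comm right right p = refl

+ᶜ-step : ∀ d p q → p +ᶜ step d q ≡ step d (p +ᶜ q)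
+ᶜ-step d p q = trans (comm p (step d q)) (trans (sym (step-+ᶜ d q p)) (cong (step d) (comm q p)))
  where
  comm : ∀ p q → p +ᶜ q ≡ q +ᶜ p
  comm (r , c) (r′ , c′) = cong₂ _,_ (ℤ.+-comm r r′) (ℤ.+-comm c c′)

+ᶜ-identityʳ : ∀ p → p +ᶜ (pos 0 , pos 0) ≡ p
+ᶜ-identityʳ (r , c) = cong₂ _,_ (ℤ.+-identityʳ r) (ℤ.+-identityʳ c)

module Safety (L : Level) (placed : Placed L) where
  open Level L
  open Game L
  open Grid L

  -- Dependence on the state of one block only lets occupation be transported along equations
  -- between block states.
  BodyOf : Index → BlockState → Cell → Set
  BodyOf i b p = p ∈ List.map (_+ᶜ displacement b) (footprint (block i))

  OccupiesOf : Index → BlockState → Cell → Set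
  OccupiesOf i b p = BodyOf i b p ⊎ (∃[ c ] (bloomed b ≡ true × ∃[ d ] (mark (block i) ≡ just (c , d) ×
    ¬ BodyOf i b p × BodyOf i b (step (opposite d) p))))

  initial-safe : Safe L initial
  initial-safe {i} = safe (Vec.lookup-replicate i _)
    where
    safe : ∀ {b p} → b ≡ blockState (pos 0 , pos 0) false → OccupiesOf i b p → Free p
    safe refl (inj₁ b) with ∈-map⁻ (_+ᶜ (pos 0 , pos 0)) b
    ... | f , f∈ , refl = subst Free (sym (+ᶜ-identityʳ f)) (placed i f∈)
    safe refl (inj₂ (_ , () , _))

  body-shift : ∀ {i} d b {q} → BodyOf i (shift d b) (step d q) → BodyOf i b q
  body-shift d b {q} h with ∈-map⁻ (_+ᶜ step d (displacement b)) h
  ... | f , f∈ , eq = subst (_∈ _) (sym q≡) (∈-map⁺ (_+ᶜ displacement b) f∈)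
    where
    q≡ : q ≡ f +ᶜ displacement b
    q≡ = trans (sym (step-opposite d q))
      (trans (cong (step (opposite d)) (trans eq (+ᶜ-step d f (displacement b)))) (step-opposite d _))

  body-unshift : ∀ {i} d b {q} → BodyOf i b q → BodyOf i (shift d b) (step d q)
  body-unshift d b {q} h with ∈-map⁻ (_+ᶜ displacement b) h
  ... | f , f∈ , refl = subst (_∈ _) (+ᶜ-step d f (displacement b)) (∈-map⁺ (_+ᶜ step d (displacement b)) f∈)

  occupies-shift : ∀ {i} d b {q} → OccupiesOf i (shift d b) (step d q) → OccupiesOf i b q
  occupies-shift d b (inj₁ h) = inj₁ (body-shift d b h)
  occupies-shift {i} d b {q} (inj₂ (c , bl , e , m , ¬b , h)) = inj₂ (c , bl , e , m , (λ h′ → ¬b (body-unshift d b h′)) ,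
    body-shift d b (subst (BodyOf i (shift d b)) (step-comm (opposite e) d q) h))

  -- No decidability of M is needed, since being free is stable.
  shifted-safe : ∀ {M : Set} d s s′ {j p} → (∀ {q} → M → Occupies s j q → Free (step d q)) → Safe L s →
    (M → lookup s′ j ≡ shift d (lookup s j)) → (¬ M → lookup s′ j ≡ lookup s j) →
    Occupies s′ j p → Free p
  shifted-safe {M} d s s′ {j} {p} room safe f g o = free-stable {p} λ ¬free →
    let ¬m = λ m → ¬free (subst Free (opposite-step d p) (room m (occupies-shift d (lookup s j)
               (subst₂ (OccupiesOf j) (f m) (sym (opposite-step d p)) o))))
    in ¬free (safe (subst (λ b → OccupiesOf j b p) (g ¬m) o))

  blossom-safe : ∀ s s′ {i d} → Blossoms L s s′ i d → Safe L s → Safe L s′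
  blossom-safe s s′ {i} {d} (can , h) safe {j} {p} o with h j
  ... | inj₂ (_ , f , g) = shifted-safe d s s′ (λ m o → proj₁ (CanBloom.room can m o)) safe f g o
  ... | inj₁ (refl , eq) = opened (subst (λ b → OccupiesOf i b p) eq o)
    where
    opened : OccupiesOf i (setBloomed L (lookup s i)) p → Free p
    opened (inj₁ b) = safe (inj₁ b)
    opened (inj₂ (c , _ , e , m , beside)) with just-injective (trans (sym m) (CanBloom.marked can))
    ... | refl = CanBloom.free can beside

  micro-safe : ∀ {s s′} → Micro L s s′ → Safe L s → Safe L s′
  micro-safe {s} {s′} (inj₁ (bloom {s′ = s₁} can sh)) safe = blossom-safe s s′ (bloom⇒blossoms L {s₁ = s₁} can sh) safe
  micro-safe {s} (inj₁ (fall {s′ = s′} none un sh)) safe {j} =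
    -- A falling block has only free cells below it, since any other cell would support it by
    -- `on-grid`.
    shifted-safe down s s′ (λ {q} m o → free-stable {step down q} λ ¬free → m (on-grid o ¬free)) safe (proj₁ (sh j)) (proj₂ (sh j))
  micro-safe {s} {s′} (inj₂ (_ , i , d , _ , room , sh)) safe {j} =
    shifted-safe d s s′ (λ m o → proj₁ (room m o)) safe (proj₁ (sh j)) (proj₂ (sh j))

  record Trace : Set where
    field
      size    : ℕ
      state   : ℕ → State
      start   : state 0 ≡ initial
      steps   : ∀ t → t < size → Micro L (state t) (state (suc t))
      settled : Settled (state size)
      won     : AllBloomed (state size)

  trace-safe : (tr : Trace) → ∀ t → t ≤ Trace.size tr → Safe L (Trace.state tr t)
  trace-safe tr zero    _  = subst (Safe L) (sym (Trace.start tr)) initial-safe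
  trace-safe tr (suc t) t< = micro-safe (Trace.steps tr t t<) (trace-safe tr t (ℕ.<⇒≤ t<))

  solvable⇒star : Solvable → ∃[ s ] (Star (Micro L) initial s × Settled s × AllBloomed s)
  solvable⇒star (s , s′ , (calm , settled) , moves , won) =
    let (star , settled′) = go settled moves in s′ , Star.map inj₁ calm ◅◅ star , settled′ , won
    where
    go : ∀ {s s′} → Settled s → Star Move s s′ → Star (Micro L) s s′ × Settled s′
    go settled ε = ε , settled
    go settled ((s₁ , slide , calm , settled₁) ◅ moves) =
      let (star , settled′) = go settled₁ moves
      in inj₂ (settled , slide) ◅ (Star.map inj₁ calm ◅◅ star) , settled′

  solvable⇒trace : Solvable → Trace
  solvable⇒trace sol =
    let (s , star , settled , won) = solvable⇒star sol
        (m , v , first , last , steps) = path star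
    in record { size = m ; state = v ; start = first ; steps = steps
              ; settled = subst Settled (sym last) settled ; won = subst AllBloomed (sym last) won }
    where
    path : ∀ {s s′} → Star (Micro L) s s′ →
      ∃[ m ] Σ[ v ∈ (ℕ → State) ] (v 0 ≡ s × v m ≡ s′ × (∀ t → t < m → Micro L (v t) (v (suc t))))
    path {s} ε = 0 , (λ _ → s) , refl , refl , λ _ ()
    path {s} (μ ◅ star) with path star
    ... | m , v , refl , last , steps =
      suc m , (λ { zero → s ; (suc t) → v t }) , refl , last ,
      λ { zero _ → μ ; (suc t) (s≤s t<m) → steps t t<m }

  -- Read from the end: an automatic step is prepended to the settling phase collected so far, and a
  -- slide closes that phase into a move, beginning a new, empty one.
  trace⇒solvable : Trace → Solvable
  trace⇒solvable tr =
    let (s , s′ , settles , moves , won′) = from size 0 refl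
    in s , s′ , subst (λ i → Settles i s) start settles , moves , won′
    where
    open Trace tr
    from : ∀ r t → t + r ≡ size → ∃[ s ] ∃[ s′ ] (Settles (state t) s × Star Move s s′ × AllBloomed s′)
    from zero t eq with trans (sym (ℕ.+-identityʳ t)) eq
    ... | refl = state t , state t , (ε , settled) , ε , won
    from (suc r) t eq with from r (suc t) (trans (sym (ℕ.+-suc t r)) eq)
                         | steps t (subst (t <_) eq (ℕ.m<m+n t (s≤s z≤n)))
    ... | s , s′ , (calm , settled₁) , moves , won′ | inj₁ e = s , s′ , (e ◅ calm , settled₁) , moves , won′
    ... | s , s′ , settles , moves , won′ | inj₂ (settled₁ , slide) =
      state t , s′ , (ε , settled₁) , (state (suc t) , slide , settles) ◅ moves , won′

  -- Counting the states that can occur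

  rowOf colOf : BlockState → ℕ
  rowOf b = ℤ.∣ proj₁ (displacement b) ℤ.+ pos rows ∣
  colOf b = ℤ.∣ proj₂ (displacement b) ℤ.+ pos cols ∣

  record Tame (b : BlockState) : Set where
    field
      row≡ : proj₁ (displacement b) ≡ pos (rowOf b) ℤ.+ ℤ.- pos rows
      col≡ : proj₂ (displacement b) ≡ pos (colOf b) ℤ.+ ℤ.- pos cols
      row< : rowOf b < rows + rows
      col< : colOf b < cols + cols

  -- A cell that is in the grid before and after its displacement by `z` makes `z + R = r + (R - f)`
  -- a natural number below `2R`.
  coordinate : ∀ {R f r z} → f < R → r < R → pos f ℤ.+ z ≡ pos r →
               z ≡ pos ℤ.∣ z ℤ.+ pos R ∣ ℤ.+ ℤ.- pos R × ℤ.∣ z ℤ.+ pos R ∣ < R + R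
  coordinate {R} {f} {r} {z} f<R r<R eq =
    sym (trans (cong (λ y → pos ℤ.∣ y ∣ ℤ.+ ℤ.- pos R) shifted) (trans (cong (ℤ._+ ℤ.- pos R) (sym shifted)) cancel)) ,
    subst (_< R + R) (sym (cong ℤ.∣_∣ shifted)) (ℕ.+-mono-<-≤ r<R (ℕ.m∸n≤m R f))
    where
    open ≡-Reasoning
    cancel : z ℤ.+ pos R ℤ.+ ℤ.- pos R ≡ z
    cancel = trans (ℤ.+-assoc z (pos R) (ℤ.- pos R)) (trans (cong (λ y → z ℤ.+ y) (ℤ.+-inverseʳ (pos R))) (ℤ.+-identityʳ z))
    shifted : z ℤ.+ pos R ≡ pos (r + (R ∸ f))
    shifted = begin
      z ℤ.+ pos R                       ≡⟨ cong (λ n → z ℤ.+ pos n) (ℕ.m+[n∸m]≡n (ℕ.<⇒≤ f<R)) ⟨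
      z ℤ.+ (pos f ℤ.+ pos (R ∸ f))     ≡⟨ ℤ.+-assoc z (pos f) (pos (R ∸ f)) ⟨
      z ℤ.+ pos f ℤ.+ pos (R ∸ f)       ≡⟨ cong (ℤ._+ pos (R ∸ f)) (trans (ℤ.+-comm z (pos f)) eq) ⟩
      pos (r + (R ∸ f))                 ∎

  safe⇒tame : ∀ {s} → (∀ i → ∃[ p ] (p ∈ footprint (block i))) → Safe L s → ∀ i → Tame (lookup s i)
  safe⇒tame {s} inhabited safe i with inhabited i
  ... | p , p∈ = tame p (p +ᶜ displacement (lookup s i)) refl (free-inside (placed i p∈))
                   (free-inside (safe (inj₁ (∈-map⁺ (_+ᶜ displacement (lookup s i)) p∈))))
    where
    tame : ∀ p q → p +ᶜ displacement (lookup s i) ≡ q → Inside p → Inside q → Tame (lookup s i)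
    tame _ _ eq (fr , fc , fr< , fc< , refl) (r , c , r< , c< , refl) =
      let (row≡ , row<) = coordinate fr< r< (,-injectiveˡ eq)
          (col≡ , col<) = coordinate fc< c< (,-injectiveʳ eq)
      in record { row≡ = row≡ ; col≡ = col≡ ; row< = row< ; col< = col< }

  module Codes (D : ℕ) (rows≤ : rows + rows ≤ suc D) (cols≤ : cols + cols ≤ suc D) where

    blockCodes : ℕ
    blockCodes = suc D * suc D * 2

    -- Reduction modulo `suc D` makes the code total; on tame block states, where it must be
    -- injective, it changes nothing.
    code : BlockState → Fin blockCodes
    code b = Fin.combine (Fin.combine (rowOf b ℕ.mod suc D) (colOf b ℕ.mod suc D)) (if bloomed b then suc zero else zero)

    codes : ∀ {n} → Vec BlockState n → Fin (blockCodes ^ n)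
    codes []       = zero
    codes (b ∷ bs) = Fin.combine (code b) (codes bs)

    mod-injective : ∀ {a b} → a < suc D → b < suc D → a ℕ.mod suc D ≡ b ℕ.mod suc D → a ≡ b
    mod-injective {a} {b} a< b< eq = trans (sym (residue a<)) (trans (cong toℕ eq) (residue b<))
      where
      residue : ∀ {a} → a < suc D → toℕ (a ℕ.mod suc D) ≡ a
      residue {a} a< = trans (Fin.toℕ-fromℕ< (ℕ.m%n<n a (suc D))) (ℕ.m<n⇒m%n≡m a<)

    code-injective : ∀ {b b′} → Tame b → Tame b′ → code b ≡ code b′ → b ≡ b′
    code-injective {b} {b′} t t′ eq with Fin.combine-injective _ (bl b) _ (bl b′) eq
      where
      bl : BlockState → Fin 2
      bl b = if bloomed b then suc zero else zero
    ... | place , bloom≡ with Fin.combine-injective (rowOf b ℕ.mod suc D) _ (rowOf b′ ℕ.mod suc D) _ place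
    ...   | row , col = cong₂ blockState
      (cong₂ _,_ (trans T.row≡ (trans (cong (λ n → pos n ℤ.+ ℤ.- pos rows)
                    (mod-injective (ℕ.≤-trans T.row< rows≤) (ℕ.≤-trans T′.row< rows≤) row)) (sym T′.row≡)))
                 (trans T.col≡ (trans (cong (λ n → pos n ℤ.+ ℤ.- pos cols)
                    (mod-injective (ℕ.≤-trans T.col< cols≤) (ℕ.≤-trans T′.col< cols≤) col)) (sym T′.col≡))))
      (bools (bloomed b) (bloomed b′) bloom≡)
      where
      module T  = Tame t
      module T′ = Tame t′
      bools : ∀ a a′ → (Fin 2 ∋ (if a then suc zero else zero)) ≡ (if a′ then suc zero else zero) → a ≡ a′
      bools true  true  _ = refl
      bools false false _ = refl
      bools true  false ()
      bools false true  ()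

    codes-injective : ∀ {n} (bs bs′ : Vec BlockState n) → (∀ i → Tame (lookup bs i)) → (∀ i → Tame (lookup bs′ i)) →
                      codes bs ≡ codes bs′ → bs ≡ bs′
    codes-injective []       []         _ _  _  = refl
    codes-injective (b ∷ bs) (b′ ∷ bs′) t t′ eq with Fin.combine-injective (code b) (codes bs) (code b′) (codes bs′) eq
    ... | eq₁ , eq₂ = cong₂ _∷_ (code-injective (t zero) (t′ zero) eq₁)
                                (codes-injective bs bs′ (t ∘ suc) (t′ ∘ suc) eq₂)

    short-trace : (∀ i → ∃[ p ] (p ∈ footprint (block i))) → Trace →
                  Σ[ tr ∈ Trace ] Trace.size tr < blockCodes ^ length blocks
    short-trace inhabited tr = record
      { size = P.size ; state = P.vertex ; start = trans P.first start ; steps = P.edges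
      ; settled = subst Settled (sym P.last) settled ; won = subst AllBloomed (sym P.last) won } , P.short
      where
      open Trace tr
      tame : ∀ t → t ≤ size → ∀ i → Tame (lookup (state t) i)
      tame t t≤ = safe⇒tame {state t} inhabited (trace-safe tr t t≤)
      path : ShortPath (Micro L) (blockCodes ^ length blocks) state size
      path = shorten codes size size state ℕ.≤-refl
        (λ i j i≤ j≤ → codes-injective (state i) (state j) (tame i i≤) (tame j j≤)) steps
      module P = ShortPath path

-- Spelling of a level code by the first input

-- The word w is read at the positions from p up to q, q excluded.
Spells : List Bool → List Bool → ℕ → ℕ → Set
Spells x []      p q = p ≡ q
Spells x (b ∷ w) p q = x ! p ≡ just b × Spells x w (suc p) q

module _ {A : Set} where

  !-just : ∀ (as : List A) {i a} → as ! i ≡ just a → i < length as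
  !-just (c ∷ as) {zero}  _ = s≤s z≤n
  !-just (c ∷ as) {suc i} h = s≤s (!-just as h)

  !-nothing : ∀ (as : List A) {i} → (∀ a → as ! i ≢ just a) → length as ≤ i
  !-nothing []       h = z≤n
  !-nothing (c ∷ as) {zero}  h = contradiction refl (h c)
  !-nothing (c ∷ as) {suc i} h = s≤s (!-nothing as h)

  !-lookup : ∀ (as : List A) i → as ! toℕ i ≡ just (List.lookup as i)
  !-lookup (a ∷ as) zero    = refl
  !-lookup (a ∷ as) (suc i) = !-lookup as i

  !-index : ∀ (as : List A) {j a} → as ! j ≡ just a → ∃[ i ] (toℕ i ≡ j × List.lookup as i ≡ a)
  !-index (a ∷ as) {zero}  refl = zero , refl , refl
  !-index (a ∷ as) {suc j} h with !-index as h
  ... | i , eq , eq′ = suc i , cong suc eq , eq′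

  !-total : ∀ (as : List A) {j} → j < length as → ∃[ a ] (as ! j ≡ just a)
  !-total (a ∷ as) {zero}  _       = a , refl
  !-total (a ∷ as) {suc j} (s≤s h) = !-total as h

  !-toList : ∀ {n} (as : Vec A n) j → as ‼ pos j ≡ Vec.toList as ! j
  !-toList []       j       = refl
  !-toList (a ∷ as) zero    = refl
  !-toList (a ∷ as) (suc j) = !-toList as j

module _ {x : List Bool} where

  spells-end : ∀ w {p q} → Spells x w p q → q ≡ p + length w
  spells-end []      refl    = sym (ℕ.+-identityʳ _)
  spells-end (b ∷ w) (_ , s) = trans (spells-end w s) (sym (ℕ.+-suc _ (length w)))

  spells-join : ∀ v {w p m q} → Spells x v p m → Spells x w m q → Spells x (v ++ w) p q
  spells-join []      refl    s′ = s′
  spells-join (b ∷ v) (h , s) s′ = h , spells-join v s s′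

  spells-split : ∀ v {w p q} → Spells x (v ++ w) p q →
                 Spells x v p (p + length v) × Spells x w (p + length v) q
  spells-split []      {w} {p} {q} s = sym (ℕ.+-identityʳ _) , subst (λ m → Spells x w m q) (sym (ℕ.+-identityʳ p)) s
  spells-split (b ∷ v) {w} {p} {q} (h , s) with spells-split v {w} s
  ... | s₁ , s₂ rewrite ℕ.+-suc p (length v) = (h , s₁) , s₂

  spells-≤ : ∀ w {p q} → Spells x w p q → p ≤ length x → q ≤ length x
  spells-≤ []      refl    p≤ = p≤
  spells-≤ (b ∷ w) (h , s) p≤ = spells-≤ w s (!-just x h)

spells-self : ∀ x → Spells x x 0 (length x)
spells-self x = go x 0 (λ j → refl)
  where
  go : ∀ bs p → (∀ j → bs ! j ≡ x ! (p + j)) → Spells x bs p (p + length bs)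
  go []       p h = sym (ℕ.+-identityʳ p)
  go (b ∷ bs) p h =
    trans (cong (x !_) (sym (ℕ.+-identityʳ p))) (sym (h 0)) ,
    subst (Spells x bs (suc p)) (sym (ℕ.+-suc p (length bs)))
      (go bs (suc p) (λ j → trans (h (suc j)) (cong (x !_) (ℕ.+-suc p j))))

spells-whole : ∀ x w → Spells x w 0 (length x) → w ≡ x
spells-whole x w s = go w x 0 (λ j → refl) s (sym (spells-end w s))
  where
  go : ∀ w bs p → (∀ j → bs ! j ≡ x ! (p + j)) → ∀ {q} → Spells x w p q → length w ≡ length bs → w ≡ bs
  go []      []       p h s       _  = refl
  go (b ∷ w) (c ∷ bs) p h (e , s) eq = cong₂ _∷_
    (just-injective (trans (sym e) (trans (cong (x !_) (sym (ℕ.+-identityʳ p))) (sym (h 0)))))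
    (go w bs (suc p) (λ j → trans (h (suc j)) (cong (x !_) (ℕ.+-suc p j))) s (ℕ.suc-injective eq))

module _ {A : Set} (f : A → List Bool) where

  offsetOf : List A → ℕ → ℕ
  offsetOf []       _       = 0
  offsetOf (a ∷ as) zero    = 0
  offsetOf (a ∷ as) (suc j) = length (f a) + offsetOf as j

  offsetOf-zero : ∀ as → offsetOf as 0 ≡ 0
  offsetOf-zero []      = refl
  offsetOf-zero (_ ∷ _) = refl

  offsetOf-length : ∀ as → offsetOf as (length as) ≡ length (concatMap f as)
  offsetOf-length []       = refl
  offsetOf-length (a ∷ as) = trans (cong (length (f a) +_) (offsetOf-length as)) (sym (List.length-++ (f a)))

  module _ {x : List Bool} where

    spells-items : ∀ as {p q} → Spells x (concatMap f as) p q → ∀ {j a} → as ! j ≡ just a →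
      Spells x (f a) (p + offsetOf as j) (p + offsetOf as (suc j))
    spells-items (a ∷ as) {p} s {zero} refl with spells-split (f a) s
    ... | s₁ , _ = subst₂ (Spells x (f a)) (sym (ℕ.+-identityʳ p))
      (cong (p +_) (trans (sym (ℕ.+-identityʳ _)) (cong (length (f a) +_) (sym (offsetOf-zero as))))) s₁
    spells-items (a ∷ as) {p} s {suc j} h with spells-split (f a) s
    ... | _ , s₂ = subst₂ (Spells x (f _)) (ℕ.+-assoc p _ _) (ℕ.+-assoc p _ _) (spells-items as s₂ h)

    -- For positions prescribed by a certificate: it suffices that each item ends where the next one
    -- is claimed to begin.
    items-spell : ∀ as (P : ℕ → ℕ) → (∀ {j a} → as ! j ≡ just a → Spells x (f a) (P j) (P (suc j))) →
      Spells x (concatMap f as) (P 0) (P (length as))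
    items-spell []       P h = refl
    items-spell (a ∷ as) P h = spells-join (f a) (h {0} refl) (items-spell as (P ∘ suc) (λ {j} → h {suc j}))

encodeCell : ℕ × ℕ → List Bool
encodeCell (r , c) = encodeℕ r ++ encodeℕ c

encodeRow : ∀ {n} → Vec Tile n → List Bool
encodeRow row = concatMap encodeTile (Vec.toList row)

wordF : List Bool → Formula 2
wordF []      = v0 ≐ v1
wordF (b ∷ w) = bitAt b v0 ∧ᶠ app (wordF w) (up v0 ∷ v1 ∷ [])

opaque
  -- (v , p , q)
  unaryF tileCodeF colourCodeF directionCodeF : Formula 3
  -- The terminating zero stands at `down v2`, because `v2` is the position after the code.
  unaryF = v1 ≺ v2 ∧ᶠ down v2 ∸ᵉ v1 ≐ v0 ∧ᶠ every (down v2) (¬ᶠ (v0 ≺ v2) ⇒ᶠ bitAt true v0) ∧ᶠ bitAt false (down v2)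
  tileCodeF =
    v0 is 0 ∧ᶠ app (wordF (encodeTile empty)) (v1 ∷ v2 ∷ []) ∨ᶠ
    v0 is 1 ∧ᶠ app (wordF (encodeTile wall)) (v1 ∷ v2 ∷ []) ∨ᶠ
    v0 is 2 ∧ᶠ app (wordF (encodeTile (flower red))) (v1 ∷ v2 ∷ []) ∨ᶠ
    v0 is 3 ∧ᶠ app (wordF (encodeTile (flower blue))) (v1 ∷ v2 ∷ []) ∨ᶠ
    v0 is 4 ∧ᶠ app (wordF (encodeTile (flower yellow))) (v1 ∷ v2 ∷ [])
  colourCodeF =
    v0 is 0 ∧ᶠ app (wordF (encodeColour red)) (v1 ∷ v2 ∷ []) ∨ᶠ
    v0 is 1 ∧ᶠ app (wordF (encodeColour blue)) (v1 ∷ v2 ∷ []) ∨ᶠ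
    v0 is 2 ∧ᶠ app (wordF (encodeColour yellow)) (v1 ∷ v2 ∷ [])
  directionCodeF =
    v0 is 0 ∧ᶠ app (wordF (encodeDirection up)) (v1 ∷ v2 ∷ []) ∨ᶠ
    v0 is 1 ∧ᶠ app (wordF (encodeDirection down)) (v1 ∷ v2 ∷ []) ∨ᶠ
    v0 is 2 ∧ᶠ app (wordF (encodeDirection left)) (v1 ∷ v2 ∷ []) ∨ᶠ
    v0 is 3 ∧ᶠ app (wordF (encodeDirection right)) (v1 ∷ v2 ∷ [])

opaque
  -- (i , p , q)
  grayF colouredF : Formula 3
  grayF =
    arr kindTag v0 nil is 0 ∧ᶠ bitAt false v1 ∧ᶠ
    app unaryF (arr sizeTag v0 nil ∷ up v1 ∷ arr cellPosTag v0 nil ∷ []) ∧ᶠ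
    every (arr sizeTag v0 nil) (some (arr cellPosTag v1 (up v0)) (
      app unaryF (arr cellRowTag v2 v1 ∷ arr cellPosTag v2 v1 ∷ v0 ∷ []) ∧ᶠ
      app unaryF (arr cellColTag v2 v1 ∷ v0 ∷ arr cellPosTag v2 (up v1) ∷ []))) ∧ᶠ
    arr cellPosTag v0 (arr sizeTag v0 nil) ≐ v2
  -- The end points of the fields are bound from the last one to the first.
  colouredF =
    arr kindTag v0 nil is 1 ∧ᶠ bitAt true v1 ∧ᶠ
    some v2 (app unaryF (arr widthTag v1 nil ∷ v0 ∷ v3 ∷ []) ∧ᶠ
    some v0 (app unaryF (arr heightTag v2 nil ∷ v0 ∷ v1 ∷ []) ∧ᶠ
    some v0 (app unaryF (arr leftTag v3 nil ∷ v0 ∷ v1 ∷ []) ∧ᶠ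
    some v0 (app unaryF (arr topTag v4 nil ∷ v0 ∷ v1 ∷ []) ∧ᶠ
    some v0 (app directionCodeF (arr directionTag v5 nil ∷ v0 ∷ v1 ∷ []) ∧ᶠ
             app colourCodeF (arr colourTag v5 nil ∷ up v6 ∷ v0 ∷ []))))))

opaque
  codeF : Formula 0
  codeF =
    some (arr tilePosTag nil nil) (
      app unaryF (rowsᵉ ∷ nil ∷ v0 ∷ []) ∧ᶠ app unaryF (colsᵉ ∷ v0 ∷ arr tilePosTag nil nil ∷ [])) ∧ᶠ
    every rowsᵉ (
      every colsᵉ (app tileCodeF (arr tileTag v1 v0 ∷ arr tilePosTag v1 v0 ∷ arr tilePosTag v1 (up v0) ∷ [])) ∧ᶠ
      arr tilePosTag v0 colsᵉ ≐ arr tilePosTag (up v0) nil) ∧ᶠ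
    app unaryF (countᵉ ∷ arr tilePosTag rowsᵉ nil ∷ arr blockPosTag nil nil ∷ []) ∧ᶠ
    every countᵉ (
      app grayF (v0 ∷ arr blockPosTag v0 nil ∷ arr blockPosTag (up v0) nil ∷ []) ∨ᶠ
      app colouredF (v0 ∷ arr blockPosTag v0 nil ∷ arr blockPosTag (up v0) nil ∷ [])) ∧ᶠ
    -- No bit can be read after the last block, so the input ends there.
    ¬ᶠ (bitAt true (arr blockPosTag countᵉ nil)) ∧ᶠ ¬ᶠ (bitAt false (arr blockPosTag countᵉ nil))

tileCode : Tile → ℕ
tileCode empty           = 0
tileCode wall            = 1
tileCode (flower red)    = 2
tileCode (flower blue)   = 3
tileCode (flower yellow) = 4

colourCode : Colour → ℕ
colourCode red    = 0
colourCode blue   = 1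
colourCode yellow = 2

directionCode : Direction → ℕ
directionCode up    = 0
directionCode down  = 1
directionCode left  = 2
directionCode right = 3

module Spelling (x u : List Bool) where
  open Meaning x (lastPosition x u) (certified x u)

  N : ℕ
  N = lastPosition x u

  length≤ : length x ≤ wordLength x u
  length≤ = ℕ.m≤m⊔n _ _

  up-exact : ∀ {p q} → p < q → q ≤ N → N ⊓ suc p ≡ suc p
  up-exact p<q q≤N = ℕ.m≥n⇒m⊓n≡n (ℕ.≤-trans p<q q≤N)

  word-iff : ∀ w p q → Holds (wordF w) (p ∷ q ∷ []) ⟺ Spells x w p q
  word-iff []      p q = iff-refl
  word-iff (b ∷ w) p q =
    (λ (h , s) → h , subst (λ m → Spells x w m q) (exact h) (proj₁ (word-iff w _ q) s)) ,
    (λ (h , s) → h , proj₂ (word-iff w _ q) (subst (λ m → Spells x w m q) (sym (exact h)) s))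
    where
    exact : x ! p ≡ just b → N ⊓ suc p ≡ suc p
    exact h = up-exact (!-just x h) (ℕ.≤-trans length≤ (ℕ.n≤1+n _))

  Unary : ℕ → ℕ → ℕ → Set
  Unary v p q = Spells x (encodeℕ v) p q

  opaque
    unfolding unaryF

    unary-iff : ∀ v p q → Holds unaryF (v ∷ p ∷ q ∷ []) ⟺ Unary v p q
    unary-iff v p q = forth , back
      where
      ones : ∀ v p → (∀ j → p ≤ j → j < p + v → x ! j ≡ just true) → x ! (p + v) ≡ just false → Unary v p (suc (p + v))
      ones zero    p h e = trans (cong (x !_) (sym (ℕ.+-identityʳ p))) e , cong suc (sym (ℕ.+-identityʳ p))
      ones (suc v) p h e =
        h p ℕ.≤-refl (ℕ.m<m+n p (s≤s z≤n)) ,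
        subst (λ m → Unary v (suc p) (suc m)) (sym (ℕ.+-suc p v))
          (ones v (suc p) (λ j p<j j< → h j (ℕ.<⇒≤ p<j) (subst (j <_) (sym (ℕ.+-suc p v)) j<))
            (trans (cong (x !_) (sym (ℕ.+-suc p v))) e))
      forth : Holds unaryF (v ∷ p ∷ q ∷ []) → Unary v p q
      forth (p<q , eq , h , e) = subst (Unary v p) (trans (cong suc p+v) suc-pred) (ones v p
        (λ j p≤j j< → h j (subst (j <_) p+v j<) (ℕ.≤⇒≯ p≤j)) (trans (cong (x !_) p+v) e))
        where
        suc-pred : suc (pred q) ≡ q
        suc-pred = positive-pred p<q
          where
          positive-pred : ∀ {a b} → a < b → suc (pred b) ≡ b
          positive-pred (s≤s _) = refl
        p+v : p + v ≡ pred q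
        p+v = trans (cong (p +_) (sym eq)) (ℕ.m+[n∸m]≡n (ℕ.≤-pred (subst (p <_) (sym suc-pred) p<q)))
      bits : ∀ v p q → Unary v p q →
        q ≡ suc (p + v) × (∀ j → p ≤ j → j < p + v → x ! j ≡ just true) × x ! (p + v) ≡ just false
      bits zero    p q (e , refl) = cong suc (sym (ℕ.+-identityʳ p)) ,
        (λ j p≤j j< → contradiction (ℕ.≤-trans j< (ℕ.≤-trans (ℕ.≤-reflexive (ℕ.+-identityʳ p)) p≤j)) (ℕ.<-irrefl refl)) ,
        trans (cong (x !_) (ℕ.+-identityʳ p)) e
      bits (suc v) p q (e , s) with bits v (suc p) q s
      ... | q≡ , h , e′ = trans q≡ (cong suc (sym (ℕ.+-suc p v))) , all , trans (cong (x !_) (ℕ.+-suc p v)) e′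
        where
        all : ∀ j → p ≤ j → j < p + suc v → x ! j ≡ just true
        all j p≤j j< with ℕ.m≤n⇒m<n∨m≡n p≤j
        ... | inj₁ p<j  = h j p<j (subst (j <_) (ℕ.+-suc p v) j<)
        ... | inj₂ refl = e
      back : Unary v p q → Holds unaryF (v ∷ p ∷ q ∷ [])
      back s with bits v p q s
      ... | refl , h , e = s≤s (ℕ.m≤m+n p v) , ℕ.m+n∸m≡n p v , (λ j j< ¬< → h j (ℕ.≮⇒≥ ¬<) j<) , e

    tileCode-sound : ∀ v p q → Holds tileCodeF (v ∷ p ∷ q ∷ []) → Spells x (encodeTile (tileOf v)) p q
    tileCode-sound _ p q (inj₁ (refl , h)) = proj₁ (word-iff (encodeTile empty) p q) h
    tileCode-sound _ p q (inj₂ (inj₁ (refl , h))) = proj₁ (word-iff (encodeTile wall) p q) h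
    tileCode-sound _ p q (inj₂ (inj₂ (inj₁ (refl , h)))) = proj₁ (word-iff (encodeTile (flower red)) p q) h
    tileCode-sound _ p q (inj₂ (inj₂ (inj₂ (inj₁ (refl , h))))) = proj₁ (word-iff (encodeTile (flower blue)) p q) h
    tileCode-sound _ p q (inj₂ (inj₂ (inj₂ (inj₂ (refl , h))))) = proj₁ (word-iff (encodeTile (flower yellow)) p q) h

    tileCode-complete : ∀ τ p q → Spells x (encodeTile τ) p q → Holds tileCodeF (tileCode τ ∷ p ∷ q ∷ [])
    tileCode-complete empty           p q s = inj₁ (refl , proj₂ (word-iff (encodeTile empty) p q) s)
    tileCode-complete wall            p q s = inj₂ (inj₁ (refl , proj₂ (word-iff (encodeTile wall) p q) s))
    tileCode-complete (flower red)    p q s = inj₂ (inj₂ (inj₁ (refl , proj₂ (word-iff (encodeTile (flower red)) p q) s)))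
    tileCode-complete (flower blue)   p q s =
      inj₂ (inj₂ (inj₂ (inj₁ (refl , proj₂ (word-iff (encodeTile (flower blue)) p q) s))))
    tileCode-complete (flower yellow) p q s =
      inj₂ (inj₂ (inj₂ (inj₂ (refl , proj₂ (word-iff (encodeTile (flower yellow)) p q) s))))

    colourCode-sound : ∀ v p q → Holds colourCodeF (v ∷ p ∷ q ∷ []) → Spells x (encodeColour (colourOf v)) p q
    colourCode-sound _ p q (inj₁ (refl , h)) = proj₁ (word-iff (encodeColour red) p q) h
    colourCode-sound _ p q (inj₂ (inj₁ (refl , h))) = proj₁ (word-iff (encodeColour blue) p q) h
    colourCode-sound _ p q (inj₂ (inj₂ (refl , h))) = proj₁ (word-iff (encodeColour yellow) p q) h

    colourCode-complete : ∀ a p q → Spells x (encodeColour a) p q → Holds colourCodeF (colourCode a ∷ p ∷ q ∷ [])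
    colourCode-complete red    p q s = inj₁ (refl , proj₂ (word-iff (encodeColour red) p q) s)
    colourCode-complete blue   p q s = inj₂ (inj₁ (refl , proj₂ (word-iff (encodeColour blue) p q) s))
    colourCode-complete yellow p q s = inj₂ (inj₂ (refl , proj₂ (word-iff (encodeColour yellow) p q) s))

    directionCode-sound : ∀ v p q → Holds directionCodeF (v ∷ p ∷ q ∷ []) → Spells x (encodeDirection (directionOf v)) p q
    directionCode-sound _ p q (inj₁ (refl , h)) = proj₁ (word-iff (encodeDirection up) p q) h
    directionCode-sound _ p q (inj₂ (inj₁ (refl , h))) = proj₁ (word-iff (encodeDirection down) p q) h
    directionCode-sound _ p q (inj₂ (inj₂ (inj₁ (refl , h)))) = proj₁ (word-iff (encodeDirection left) p q) h
    directionCode-sound _ p q (inj₂ (inj₂ (inj₂ (refl , h)))) = proj₁ (word-iff (encodeDirection right) p q) h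

    directionCode-complete : ∀ d p q → Spells x (encodeDirection d) p q → Holds directionCodeF (directionCode d ∷ p ∷ q ∷ [])
    directionCode-complete up    p q s = inj₁ (refl , proj₂ (word-iff (encodeDirection up) p q) s)
    directionCode-complete down  p q s = inj₂ (inj₁ (refl , proj₂ (word-iff (encodeDirection down) p q) s))
    directionCode-complete left  p q s = inj₂ (inj₂ (inj₁ (refl , proj₂ (word-iff (encodeDirection left) p q) s)))
    directionCode-complete right p q s = inj₂ (inj₂ (inj₂ (refl , proj₂ (word-iff (encodeDirection right) p q) s)))

-- The code formula makes the input the code of the described level

module CodeSound (x u : List Bool) (L : Level) (described : Describes L (certified x u)) where
  open Level L
  open Game L
  open Described x u L described
  open Describes described
  open Spelling x u hiding (N)

  private
    N : ℕ
    N = lastPosition x u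

  exact : ∀ {i} g {a b} → i < G g a b → N ⊓ suc i ≡ suc i
  exact g i< = up-exact i< (certified-≤ x u g _ _)

  cells : ℕ → ℕ → ℕ × ℕ
  cells i j = G cellRowTag i j , G cellColTag i j

  after-bit : ∀ {p b} → x ! p ≡ just b → N ⊓ suc p ≡ suc p
  after-bit h = up-exact (!-just x h) (ℕ.≤-trans length≤ (ℕ.n≤1+n _))

  opaque
    unfolding grayF

    gray-sound : ∀ i p q → Holds grayF (toℕ i ∷ p ∷ q ∷ []) → Spells x (encodeBlock (block i)) p q
    gray-sound i p q (kind≡ , h , size-code , cell-codes , end) rewrite block≡ i | kind≡ =
      h , subst (λ n → Spells x (encodeℕ n ++ concatMap encodeCell as) (suc p) q) (sym length≡)
        (spells-join (encodeℕ size)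
          (subst (λ m → Unary size m (G cellPosTag (toℕ i) 0)) (after-bit h) (proj₁ (unary-iff _ _ _) size-code))
          (subst (Spells x (concatMap encodeCell as) (G cellPosTag (toℕ i) 0))
            (trans (cong (G cellPosTag (toℕ i)) length≡) end)
            (items-spell encodeCell as (G cellPosTag (toℕ i)) item)))
      where
      size : ℕ
      size = G sizeTag (toℕ i) 0
      as : List (ℕ × ℕ)
      as = List.applyUpTo (cells (toℕ i)) size
      length≡ : length as ≡ size
      length≡ = List.length-applyUpTo (cells (toℕ i)) size
      item : ∀ {j a} → as ! j ≡ just a →
             Spells x (encodeCell a) (G cellPosTag (toℕ i) j) (G cellPosTag (toℕ i) (suc j))
      item {j} eq with subst (j <_) length≡ (!-just as eq)
      ... | j< with just-injective (trans (sym eq) (applyUpTo-! (cells (toℕ i)) size j<)) | cell-codes j j<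
      ...   | refl | m , _ , row , col =
        spells-join (encodeℕ (G cellRowTag (toℕ i) j)) (proj₁ (unary-iff _ _ _) row)
          (subst (Unary _ m) (cong (G cellPosTag (toℕ i)) (exact sizeTag j<)) (proj₁ (unary-iff _ _ _) col))

    coloured-sound : ∀ i p q → Holds colouredF (toℕ i ∷ p ∷ q ∷ []) → Spells x (encodeBlock (block i)) p q
    coloured-sound i p q (kind≡ , h , p₅ , _ , width , p₄ , _ , height , p₃ , _ , left′ , p₂ , _ , top′ , p₁ , _ , dir , col)
      rewrite block≡ i | kind≡ =
      h , spells-join (encodeColour (colourOf (G colourTag (toℕ i) 0)))
            (subst (λ m → Spells x (encodeColour (colourOf (G colourTag (toℕ i) 0))) m p₁) (after-bit h) (colourCode-sound _ _ p₁ col))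
          (spells-join (encodeDirection (directionOf (G directionTag (toℕ i) 0))) (directionCode-sound _ p₁ p₂ dir)
          (spells-join (encodeℕ (G topTag (toℕ i) 0)) (proj₁ (unary-iff _ p₂ p₃) top′)
          (spells-join (encodeℕ (G leftTag (toℕ i) 0)) (proj₁ (unary-iff _ p₃ p₄) left′)
          (spells-join (encodeℕ (G heightTag (toℕ i) 0)) (proj₁ (unary-iff _ p₄ p₅) height)
            (proj₁ (unary-iff _ p₅ q) width)))))

  tileAt-! : ∀ r c → tileAt (cell (r , c)) ≡ ((Vec.toList grid ! r) Maybe.>>= λ row → Vec.toList row ! c)
  tileAt-! r c rewrite !-toList grid r with Vec.toList grid ! r
  ... | nothing  = refl
  ... | just row = !-toList row c

  tile-value : ∀ {r row c τ} → Vec.toList grid ! r ≡ just row → Vec.toList row ! c ≡ just τ →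
               r < rows × c < cols × τ ≡ tileOf (G tileTag r c)
  tile-value {r} {row} {c} {τ} eq eq′ = r< , c< ,
    just-injective (trans (sym (trans (tileAt-! r c) (trans (cong (Maybe._>>= (λ row → Vec.toList row ! c)) eq) eq′)))
                          (tile≡ r< c<))
    where
    r< : r < rows
    r< = subst (r <_) (Vec.length-toList grid) (!-just (Vec.toList grid) eq)
    c< : c < cols
    c< = subst (c <_) (Vec.length-toList row) (!-just (Vec.toList row) eq′)

  opaque
    unfolding codeF

    code-sound : Holds codeF [] → encode L ≡ x
    code-sound ((p₁ , _ , rows-code , cols-code) , rows-codes , count-code , block-codes , not-true , not-false) =
      spells-whole x (encode L) (subst (Spells x (encode L) 0) end≡ whole)
      where
      TP : ℕ → ℕ → ℕ
      TP = G tilePosTag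
      BP : ℕ → ℕ
      BP i = G blockPosTag i 0
      row-code : ∀ {r row} → Vec.toList grid ! r ≡ just row → Spells x (encodeRow row) (TP r 0) (TP (suc r) 0)
      row-code {r} {row} eq =
        subst (Spells x (encodeRow row) (TP r 0))
          (trans (cong (TP r) (trans (Vec.length-toList row) (sym cols≡)))
            (trans (proj₂ (rows-codes r r<)) (cong (λ s → TP s 0) (exact rowsTag r<))))
          (items-spell encodeTile (Vec.toList row) (TP r) tile-code)
        where
        r< : r < G rowsTag 0 0
        r< = subst (r <_) (trans (Vec.length-toList grid) (sym rows≡)) (!-just (Vec.toList grid) eq)
        tile-code : ∀ {c τ} → Vec.toList row ! c ≡ just τ → Spells x (encodeTile τ) (TP r c) (TP r (suc c))
        tile-code {c} eq′ with tile-value eq eq′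
        ... | _ , c<cols , refl =
          subst (Spells x (encodeTile (tileOf (G tileTag r c))) (TP r c)) (cong (TP r) (exact colsTag c<))
            (tileCode-sound _ _ _ (proj₁ (rows-codes r r<) c c<))
          where
          c< : c < G colsTag 0 0
          c< = subst (c <_) (sym cols≡) c<cols
      block-code : ∀ {j b} → blocks ! j ≡ just b → Spells x (encodeBlock b) (BP j) (BP (suc j))
      block-code eq with !-index blocks eq
      ... | i , refl , refl =
        subst (Spells x (encodeBlock (block i)) (BP (toℕ i))) (cong BP (exact countTag (index< i)))
          ([ gray-sound i _ _ , coloured-sound i _ _ ]′ (block-codes (toℕ i) (index< i)))
      whole : Spells x (encode L) 0 (BP (length blocks))
      whole =
        spells-join (encodeℕ rows) (subst (λ v → Unary v 0 p₁) rows≡ (proj₁ (unary-iff _ _ _) rows-code))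
        (spells-join (encodeℕ cols) (subst (λ v → Unary v p₁ (TP 0 0)) cols≡ (proj₁ (unary-iff _ _ _) cols-code))
        (spells-join (concatMap encodeRow (Vec.toList grid))
          (subst (λ n → Spells x (concatMap encodeRow (Vec.toList grid)) (TP 0 0) (TP n 0))
            (trans (Vec.length-toList grid) (sym rows≡))
            (items-spell encodeRow (Vec.toList grid) (λ r → TP r 0) row-code))
        (spells-join (encodeℕ (length blocks)) (subst (λ v → Unary v _ _) count≡ (proj₁ (unary-iff _ _ _) count-code))
          (items-spell encodeBlock blocks BP block-code))))
      end≡ : BP (length blocks) ≡ length x
      end≡ = ℕ.≤-antisym (spells-≤ (encode L) whole z≤n)
        (!-nothing x (λ { true → not-true ∘ trans (cong (x !_) end′) ; false → not-false ∘ trans (cong (x !_) end′) }))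
        where
        end′ : BP (G countTag 0 0) ≡ BP (length blocks)
        end′ = cong BP count≡

-- Well-formedness

opaque
  -- (i)
  shapeF placedF : Formula 1
  shapeF =
    arr kindTag v0 nil is 0 ∧ᶠ nil ≺ arr sizeTag v0 nil ∧ᶠ
      -- Cells are listed with the latest first, so the last one is the seed of the polyomino and
      -- the only one exempt.
      every (arr sizeTag v0 nil) (¬ᶠ (v0 ≐ down (arr sizeTag v1 nil)) ⇒ᶠ
        some (arr sizeTag v1 nil) (v1 ≺ v0 ∧ᶠ
          app adjacentF (arr cellRowTag v2 v1 ∷ arr cellColTag v2 v1 ∷ arr cellRowTag v2 v0 ∷ arr cellColTag v2 v0 ∷ []))) ∨ᶠ
    nil ≺ arr kindTag v0 nil ∧ᶠ nil ≺ arr heightTag v0 nil ∧ᶠ nil ≺ arr widthTag v0 nil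
  placedF =
    arr kindTag v0 nil is 0 ∧ᶠ
      every (arr sizeTag v0 nil) (app emptyF (arr cellRowTag v1 v0 ∷ arr cellColTag v1 v0 ∷ [])) ∨ᶠ
    nil ≺ arr kindTag v0 nil ∧ᶠ
      every (arr heightTag v0 nil) (every (arr widthTag v1 nil) (someCell (
        (¬ᶠ (v1 ≺ arr topTag v4 nil) ∧ᶠ v1 ∸ᵉ arr topTag v4 nil ≐ v3) ∧ᶠ
        (¬ᶠ (v0 ≺ arr leftTag v4 nil) ∧ᶠ v0 ∸ᵉ arr leftTag v4 nil ≐ v2) ∧ᶠ
        app emptyF (v1 ∷ v0 ∷ []))))

  disjointF attachedF : Formula 0
  disjointF = every countᵉ (every countᵉ (everyCell (
    app footF (v3 ∷ v1 ∷ v0 ∷ []) ⇒ᶠ app footF (v2 ∷ v1 ∷ v0 ∷ []) ⇒ᶠ v3 ≐ v2)))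
  attachedF = everyCell (nil ≺ down (arr tileTag v1 v0) ⇒ᶠ
    someCell (app adjacentF (v3 ∷ v2 ∷ v1 ∷ v0 ∷ []) ∧ᶠ app wallF (v1 ∷ v0 ∷ [])))

  wellFormedF : Formula 0
  wellFormedF = every countᵉ shapeF ∧ᶠ every countᵉ placedF ∧ᶠ disjointF ∧ᶠ attachedF

Attached : (ℕ → ℕ × ℕ) → ℕ → ℕ → Set
Attached f n j = ∃[ j′ ] (j′ < n × j < j′ × ∃[ d ] (step d (cell (f j)) ≡ cell (f j′)))

polyomino-iff : ∀ n f → (0 < n × (∀ j → j < n → j ≢ pred n → Attached f n j)) ⟺
                Polyomino (List.map cell (List.applyUpTo f n))
polyomino-iff n f = (λ (0<n , h) → build n f 0<n h) , destroy n f
  where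
  neighbour⁺ : ∀ {p} n (f : ℕ → ℕ × ℕ) j d → j < n → step d p ≡ cell (f j) →
               Any (λ q → ∃[ d ] (q ≡ step d p)) (List.map cell (List.applyUpTo f n))
  neighbour⁺ (suc n) f zero    d _         eq = here (d , sym eq)
  neighbour⁺ (suc n) f (suc j) d (s≤s j<n) eq = there (neighbour⁺ n (f ∘ suc) j d j<n eq)
  neighbour⁻ : ∀ {p} n (f : ℕ → ℕ × ℕ) → Any (λ q → ∃[ d ] (q ≡ step d p)) (List.map cell (List.applyUpTo f n)) →
               ∃[ j ] (j < n × ∃[ d ] (step d p ≡ cell (f j)))
  neighbour⁻ (suc n) f (here (d , eq)) = 0 , s≤s z≤n , d , sym eq
  neighbour⁻ (suc n) f (there a) with neighbour⁻ n (f ∘ suc) a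
  ... | j , j< , d , eq = suc j , s≤s j< , d , eq
  build : ∀ n f → 0 < n → (∀ j → j < n → j ≢ pred n → Attached f n j) → Polyomino (List.map cell (List.applyUpTo f n))
  build (suc zero)    f _ h = single _
  build (suc (suc n)) f _ h = attach (first (h 0 (s≤s z≤n) (λ ()))) (build (suc n) (f ∘ suc) (s≤s z≤n) later)
    where
    first : Attached f (suc (suc n)) 0 →
            Any (λ q → ∃[ d ] (q ≡ step d (cell (f 0)))) (List.map cell (List.applyUpTo (f ∘ suc) (suc n)))
    first (suc j , s≤s j< , _ , d , eq) = neighbour⁺ (suc n) (f ∘ suc) j d j< eq
    later : ∀ j → j < suc n → j ≢ n → Attached (f ∘ suc) (suc n) j
    later j j< j≢ with h (suc j) (s≤s j<) (j≢ ∘ ℕ.suc-injective)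
    ... | suc k , s≤s k< , s≤s j<k , e = k , k< , j<k , e
  destroy : ∀ n f → Polyomino (List.map cell (List.applyUpTo f n)) → 0 < n × (∀ j → j < n → j ≢ pred n → Attached f n j)
  destroy (suc zero)    f _ = s≤s z≤n , λ { zero _ 0≢ → contradiction refl 0≢ ; (suc j) (s≤s ()) _ }
  destroy (suc (suc n)) f (attach a poly) = s≤s z≤n , all
    where
    all : ∀ j → j < suc (suc n) → j ≢ suc n → Attached f (suc (suc n)) j
    all zero _ _ with neighbour⁻ (suc n) (f ∘ suc) a
    ... | j′ , j′< , e = suc j′ , s≤s j′< , s≤s z≤n , e
    all (suc j) (s≤s j<) j≢ with proj₂ (destroy (suc n) (f ∘ suc) poly) j j< (j≢ ∘ cong suc)
    ... | k , k< , j<k , e = suc k , s≤s k< , s≤s j<k , e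

module WellFormedness (x u : List Bool) (L : Level) (described : Describes L (certified x u)) where
  open Level L
  open Game L
  open Grid L
  open Described x u L described
  open Describes described

  opaque
    unfolding shapeF

    shape-iff : ∀ i → Holds shapeF (toℕ i ∷ []) ⟺ ProperShape (block i)
    shape-iff i rewrite block≡ i with G kindTag (toℕ i) 0
    ... | zero =
      (λ { (inj₁ (_ , 0<n , h)) → gray (proj₁ (polyomino-iff size f) (0<n , λ j j< j≢ → forth (h j j< j≢)))
         ; (inj₂ (() , _)) }) ,
      (λ { (gray poly) → let (0<n , h) = proj₂ (polyomino-iff size f) poly in
                         inj₁ (refl , 0<n , λ j j< j≢ → back (h j j< j≢)) })
      where
      size : ℕ
      size = G sizeTag (toℕ i) 0
      f : ℕ → ℕ × ℕ
      f j = G cellRowTag (toℕ i) j , G cellColTag (toℕ i) j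
      Linked : ℕ → Set
      Linked j = ∃[ j′ ] (j′ < size × j < j′ ×
        Holds adjacentF (proj₁ (f j) ∷ proj₂ (f j) ∷ proj₁ (f j′) ∷ proj₂ (f j′) ∷ []))
      forth : ∀ {j} → Linked j → Attached f size j
      forth (j′ , j′< , j<j′ , h) = j′ , j′< , j<j′ , proj₁ (adjacent-iff _ _ _ _) h
      back : ∀ {j} → Attached f size j → Linked j
      back (j′ , j′< , j<j′ , h) = j′ , j′< , j<j′ , proj₂ (adjacent-iff _ _ _ _) h
    ... | suc _ =
      (λ { (inj₁ (() , _)) ; (inj₂ (_ , h , w)) → coloured h w }) ,
      (λ { (coloured h w) → inj₂ (s≤s z≤n , h , w) })

    placed-iff : ∀ i → Holds placedF (toℕ i ∷ []) ⟺ (∀ {p} → p ∈ footprint (block i) → Free p)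
    placed-iff i rewrite block≡ i with G kindTag (toℕ i) 0
    ... | zero = (λ { (inj₁ (_ , h)) → forth h ; (inj₂ (() , _)) }) , (λ h → inj₁ (refl , back h))
      where
      size : ℕ
      size = G sizeTag (toℕ i) 0
      f : ℕ → ℕ × ℕ
      f j = G cellRowTag (toℕ i) j , G cellColTag (toℕ i) j
      Empties : Set
      Empties = ∀ j → j < size → Holds emptyF (proj₁ (f j) ∷ proj₂ (f j) ∷ [])
      forth : Empties → ∀ {p} → p ∈ List.map cell (List.applyUpTo f size) → Free p
      forth h p∈ with ∈-map⁻ cell p∈
      ... | _ , a∈ , refl with ∈-applyUpTo⁻ f a∈
      ...   | j , j< , refl = proj₁ (empty-iff _ _) (h j j<)
      back : (∀ {p} → p ∈ List.map cell (List.applyUpTo f size) → Free p) → Empties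
      back h j j< = proj₂ (empty-iff _ _) (h (∈-map⁺ cell (∈-applyUpTo⁺ f j<)))
    ... | suc _ = (λ { (inj₁ (() , _)) ; (inj₂ (_ , h)) → forth h }) , (λ h → inj₂ (s≤s z≤n , back h))
      where
      t l h w : ℕ
      t = G topTag (toℕ i) 0
      l = G leftTag (toℕ i) 0
      h = G heightTag (toℕ i) 0
      w = G widthTag (toℕ i) 0
      rs cs : List ℕ
      rs = List.map (λ j → t + j) (List.upTo h)
      cs = List.map (λ j → l + j) (List.upTo w)
      Empties : Set
      Empties = ∀ a → a < h → ∀ b → b < w → ∃[ r ] (r < G rowsTag 0 0 × ∃[ c ] (c < G colsTag 0 0 ×
        (¬ (r < t) × r ∸ t ≡ a) × (¬ (c < l) × c ∸ l ≡ b) × Holds emptyF (r ∷ c ∷ [])))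
      forth : Empties → ∀ {p} → p ∈ List.map cell (List.cartesianProduct rs cs) → Free p
      forth f p∈ with ∈-map⁻ cell p∈
      ... | (r , c) , rc∈ , refl with ∈-cartesianProduct⁻ rs cs rc∈
      ...   | r∈ , c∈ with ∈-map⁻ (λ j → t + j) r∈ | ∈-map⁻ (λ j → l + j) c∈
      ...     | a , a∈ , refl | b , b∈ , refl with f a (∈-upTo⁻ a∈) b (∈-upTo⁻ b∈)
      ...       | r , _ , c , _ , (r≮ , refl) , (c≮ , refl) , e =
        subst₂ (λ r c → Free (cell (r , c))) (sym (ℕ.m+[n∸m]≡n (ℕ.≮⇒≥ r≮))) (sym (ℕ.m+[n∸m]≡n (ℕ.≮⇒≥ c≮)))
          (proj₁ (empty-iff r c) e)
      back : (∀ {p} → p ∈ List.map cell (List.cartesianProduct rs cs) → Free p) → Empties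
      back f a a< b b< with f (∈-map⁺ cell (∈-cartesianProduct⁺ (∈-map⁺ (λ j → t + j) (∈-upTo⁺ a<)) (∈-map⁺ (λ j → l + j) (∈-upTo⁺ b<))))
      ... | free with tile-inside (cell (t + a , l + b)) free
      ...   | _ , _ , r< , c< , refl =
        t + a , subst (t + a <_) (sym rows≡) r< , l + b , subst (l + b <_) (sym cols≡) c< ,
        (ℕ.m+n≮m t a , ℕ.m+n∸m≡n t a) , (ℕ.m+n≮m l b , ℕ.m+n∸m≡n l b) , proj₂ (empty-iff _ _) free

    disjoint-iff : Placed L → Holds disjointF [] ⟺
      (∀ i j → ∀ {p} → p ∈ footprint (block i) → p ∈ footprint (block j) → toℕ i ≡ toℕ j)
    disjoint-iff placed = everyIndex-iff λ i → everyIndex-iff λ j →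
      everyCell-iff (λ p∈ → free-inside (placed i p∈)) (foot-iff i) (λ r c → iff-→ (foot-iff j r c) iff-refl)

    attached-iff : Holds attachedF [] ⟺ (∀ p a → tileAt p ≡ just (flower a) → ∃[ d ] (tileAt (step d p) ≡ just wall))
    attached-iff = forth , back
      where
      flower-2 : ∀ {v} → 0 < pred v → ∃[ a ] (tileOf v ≡ flower a)
      flower-2 {suc (suc v)} _ = _ , refl
      2-flower : ∀ v {a} → tileOf v ≡ flower a → 0 < pred v
      2-flower (suc (suc v)) _ = s≤s z≤n
      Walled : ℕ → ℕ → Set
      Walled r c = ∃[ r′ ] (r′ < G rowsTag 0 0 × ∃[ c′ ] (c′ < G colsTag 0 0 ×
        Holds adjacentF (r ∷ c ∷ r′ ∷ c′ ∷ []) × Holds wallF (r′ ∷ c′ ∷ [])))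
      forth : (∀ r → r < G rowsTag 0 0 → ∀ c → c < G colsTag 0 0 → 0 < pred (G tileTag r c) → Walled r c) →
              ∀ p a → tileAt p ≡ just (flower a) → ∃[ d ] (tileAt (step d p) ≡ just wall)
      forth h p a eq with tile-inside p eq
      ... | r , c , r< , c< , refl
          with h r (subst (r <_) (sym rows≡) r<) c (subst (c <_) (sym cols≡) c<)
                 (2-flower _ (just-injective (trans (sym (tile≡ r< c<)) eq)))
      ...   | r′ , _ , c′ , _ , adj , w with proj₁ (adjacent-iff r c r′ c′) adj
      ...     | d , step≡ = d , trans (cong tileAt step≡) (proj₁ (wall-iff r′ c′) w)
      back : (∀ p a → tileAt p ≡ just (flower a) → ∃[ d ] (tileAt (step d p) ≡ just wall)) →
             ∀ r → r < G rowsTag 0 0 → ∀ c → c < G colsTag 0 0 → 0 < pred (G tileTag r c) → Walled r c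
      back h r r< c c< fl with flower-2 {G tileTag r c} fl
      ... | a , eq with h (cell (r , c)) a (trans (tile≡ (subst (r <_) rows≡ r<) (subst (c <_) cols≡ c<)) (cong just eq))
      ...   | d , w with tile-inside (step d (cell (r , c))) w
      ...     | r′ , c′ , r′< , c′< , step≡ =
        r′ , subst (r′ <_) (sym rows≡) r′< , c′ , subst (c′ <_) (sym cols≡) c′< ,
        proj₂ (adjacent-iff r c r′ c′) (d , step≡) , proj₂ (wall-iff r′ c′) (trans (cong tileAt (sym step≡)) w)

    wellFormed-iff : Holds wellFormedF [] ⟺ WellFormed
    wellFormed-iff =
      (λ (s , p , d , a) → let placed = proj₁ (everyIndex-iff placed-iff) p in record
        { shapes = proj₁ (everyIndex-iff shape-iff) s ; placed = λ i → placed i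
        ; disjoint = λ i j p∈ p∈′ → toℕ-injective (proj₁ (disjoint-iff (λ i → placed i)) d i j p∈ p∈′)
        ; attached = proj₁ attached-iff a }) ,
      (λ wf → let open WellFormed wf in
        proj₂ (everyIndex-iff shape-iff) shapes ,
        proj₂ (everyIndex-iff placed-iff) (λ i → placed i) ,
        proj₂ (disjoint-iff placed) (λ i j p∈ p∈′ → cong toℕ (disjoint i j p∈ p∈′)) ,
        proj₂ attached-iff attached)

-- The accepting formula and its path part

-- The constant `k` may exceed the largest value, so it is subtracted by repeated predecessors.
downs : ∀ {m} → ℕ → Expr m → Expr m
downs zero    e = e
downs (suc k) e = down (downs k e)

opaque
  fewF : ℕ → Formula 0
  fewF k = downs k countᵉ ≐ nil

acceptF : ℕ → Formula 0
acceptF k = codeF ∧ᶠ wellFormedF ∧ᶠ fewF k ∧ᶠ pathF k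

few-iff : ∀ x u k → Meaning.Holds x (lastPosition x u) (certified x u) (fewF k) [] ⟺ (certified x u countTag 0 0 ≤ k)
few-iff x u k = few
  where
  open Meaning x (lastPosition x u) (certified x u)
  opaque
    unfolding fewF
    value-downs : ∀ k → value (downs k countᵉ) [] ≡ certified x u countTag 0 0 ∸ k
    value-downs zero    = refl
    value-downs (suc k) = trans (cong pred (value-downs k)) (ℕ.pred[m∸n]≡m∸[1+n] (certified x u countTag 0 0) k)
    few : Holds (fewF k) [] ⟺ (certified x u countTag 0 0 ≤ k)
    few = (λ eq → ℕ.m∸n≡0⇒m≤n (trans (sym (value-downs k)) eq)) , (λ le → trans (value-downs k) (ℕ.m≤n⇒m∸n≡0 le))

module PathCorrect (x u : List Bool) (L : Level) (described : Describes L (certified x u))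
  (k : ℕ) (few : length (Level.blocks L) ≤ k) (placed : Placed L)
  (v : ℕ → Game.State L)
  (rep : ∀ t → t ≤ certified x u lastTag 0 0 → Represents L (certified x u) t (v t)) where
  open Level L
  open Game L
  open Described x u L described
  open Safety L placed

  lastTime : ℕ
  lastTime = G lastTag 0 0

  -- The array element for the index up v0 is the one for suc t, as t < lastTime ≤ N.
  up-time : ∀ {t} → t < lastTime → lastPosition x u ⊓ suc t ≡ suc t
  up-time t<T = ℕ.m≥n⇒m⊓n≡n (ℕ.≤-trans t<T (certified-≤ x u lastTag 0 0))

  micro-at : ∀ t → t < lastTime → Safe L (v t) → Holds (microF k) (t ∷ lastPosition x u ⊓ suc t ∷ []) ⟺ Micro L (v t) (v (suc t))
  micro-at t t<T safe =
    subst (λ t′ → Holds (microF k) (t ∷ t′ ∷ []) ⟺ Micro L (v t) (v (suc t))) (sym (up-time t<T))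
      (Blooming.Stepping.micro-iff x u L described k few placed t (v t) (rep t (ℕ.<⇒≤ t<T)) safe
        (suc t) (v (suc t)) (rep (suc t) t<T))

  start-iff : (∀ i → G stateRowTag 0 (toℕ i) ≡ G rowsTag 0 0 × G stateColTag 0 (toℕ i) ≡ G colsTag 0 0 × G bloomedTag 0 (toℕ i) ≡ 0)
              ⟺ (v 0 ≡ initial)
  start-iff =
    (λ h → lookup-extensional _ _ (λ i → trans (rep 0 z≤n i) (trans (proj₁ (at-index i) (h i)) (sym (Vec.lookup-replicate i _))))) ,
    (λ eq i → proj₂ (at-index i) (trans (sym (rep 0 z≤n i)) (trans (cong (λ s → lookup s i) eq) (Vec.lookup-replicate i _))))
    where
    origin : cell (G rowsTag 0 0 , G colsTag 0 0) +ᶜ offset G ≡ (pos 0 , pos 0)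
    origin = cong₂ _,_ (ℤ.+-inverseʳ (pos (G rowsTag 0 0))) (ℤ.+-inverseʳ (pos (G colsTag 0 0)))
    at-index : ∀ i → (G stateRowTag 0 (toℕ i) ≡ G rowsTag 0 0 × G stateColTag 0 (toℕ i) ≡ G colsTag 0 0 × G bloomedTag 0 (toℕ i) ≡ 0)
               ⟺ (stateOf G 0 (toℕ i) ≡ blockState (pos 0 , pos 0) false)
    at-index i =
      (λ (a , b , c) → proj₁ iff-blockState
        (trans (cong₂ (λ a b → cell (a , b) +ᶜ offset G) a b) origin , proj₁ (isZero-iff _) c)) ,
      (λ eq → let (p , c) = proj₂ iff-blockState eq
                  (a , b) = cell-injective (+ᶜ-cancelʳ _ _ (offset G) (trans p (sym origin)))
              in a , b , proj₂ (isZero-iff _) c)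

  opaque
    unfolding pathF

    path-sound : Holds (pathF k) [] → Trace
    path-sound (start , micros , calm , won) = record
      { size = lastTime ; state = v ; start = start≡ ; steps = λ t t<T → proj₁ (micro-at t t<T (safe t (ℕ.<⇒≤ t<T))) (micros t t<T)
      ; settled = proj₁ (Blooming.settled-iff x u L described k few placed lastTime (v lastTime) (rep lastTime ℕ.≤-refl) (safe lastTime ℕ.≤-refl)) calm
      ; won = proj₁ (Blooming.allBloomed-iff x u L described k few placed lastTime (v lastTime) (rep lastTime ℕ.≤-refl) (safe lastTime ℕ.≤-refl)) won }
      where
      start≡ : v 0 ≡ initial
      start≡ = proj₁ start-iff (λ i → start (toℕ i) (index< i))
      -- `micro-at` interprets a step only from a safe state, so safety and the steps are
      -- established alternately along the path.
      safe : ∀ t → t ≤ lastTime → Safe L (v t)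
      safe zero    _   = subst (Safe L) (sym start≡) initial-safe
      safe (suc t) t<T = micro-safe (proj₁ (micro-at t t<T (safe t (ℕ.<⇒≤ t<T))) (micros t t<T)) (safe t (ℕ.<⇒≤ t<T))

    path-complete : (tr : Trace) → Trace.size tr ≡ lastTime → (∀ t → Trace.state tr t ≡ v t) → Holds (pathF k) []
    path-complete tr size≡ state≡ =
      proj₂ (everyIndex-iff (λ i → iff-refl)) (proj₂ start-iff (trans (sym (state≡ 0)) start)) ,
      (λ t t<T → proj₂ (micro-at t t<T (safe t (ℕ.<⇒≤ t<T)))
        (subst₂ (Micro L) (state≡ t) (state≡ (suc t)) (steps t (subst (t <_) (sym size≡) t<T)))) ,
      proj₂ (Blooming.settled-iff x u L described k few placed lastTime (v lastTime) (rep lastTime ℕ.≤-refl) (safe lastTime ℕ.≤-refl))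
        (subst Settled last≡ settled) ,
      proj₂ (Blooming.allBloomed-iff x u L described k few placed lastTime (v lastTime) (rep lastTime ℕ.≤-refl) (safe lastTime ℕ.≤-refl))
        (subst AllBloomed last≡ won)
      where
      open Trace tr
      last≡ : state size ≡ v lastTime
      last≡ = trans (cong state size≡) (state≡ lastTime)
      safe : ∀ t → t ≤ lastTime → Safe L (v t)
      safe t t≤T = subst (Safe L) (state≡ t) (trace-safe tr t (subst (t ≤_) (sym size≡) t≤T))

-- Soundness: the level read off a certificate

levelOf : Array → Level
levelOf G = record
  { rows   = G rowsTag 0 0
  ; cols   = G colsTag 0 0
  ; grid   = tabulate (λ r → tabulate (λ c → tileOf (G tileTag (toℕ r) (toℕ c))))
  ; blocks = List.applyUpTo (blockOf G) (G countTag 0 0)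
  }

tabulate-‼ : ∀ {A : Set} n (f : ℕ → A) {i} → i < n → tabulate {n = n} (f ∘ toℕ) ‼ pos i ≡ just (f i)
tabulate-‼ (suc n) f {zero}  _         = refl
tabulate-‼ (suc n) f {suc i} (s≤s i<n) = tabulate-‼ n (f ∘ suc) i<n

levelOf-described : ∀ G → Describes (levelOf G) G
levelOf-described G = record
  { rows≡ = refl ; cols≡ = refl ; count≡ = sym (List.length-applyUpTo (blockOf G) (G countTag 0 0))
  ; tile≡ = λ {r} {c} r< c< → trans
      (cong (Maybe._>>= (_‼ pos c)) (tabulate-‼ _ (λ r → tabulate (λ c → tileOf (G tileTag r (toℕ c)))) r<))
      (tabulate-‼ _ (λ c → tileOf (G tileTag r c)) c<)
  ; block≡ = List.lookup-applyUpTo (blockOf G) (G countTag 0 0)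
  }

accept-sound : ∀ x u k → Meaning.Holds x (lastPosition x u) (certified x u) (acceptF k) [] → Hanano≤ k x
accept-sound x u k (code , wf , few , path) =
  L , CodeSound.code-sound x u L described code , wellFormed , few′ ,
  Safety.trace⇒solvable L placed (PathCorrect.path-sound x u L described k few′ placed v rep path)
  where
  L : Level
  L = levelOf (certified x u)
  described : Describes L (certified x u)
  described = levelOf-described (certified x u)
  wellFormed : Game.WellFormed L
  wellFormed = proj₁ (WellFormedness.wellFormed-iff x u L described) wf
  placed : Placed L
  placed = Game.WellFormed.placed wellFormed
  few′ : length (Level.blocks L) ≤ k
  few′ = subst (_≤ k) (Describes.count≡ described) (proj₁ (few-iff x u k) few)
  v : ℕ → Game.State L
  v t = tabulate (λ i → stateOf (certified x u) t (toℕ i))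
  rep : ∀ t → t ≤ certified x u lastTag 0 0 → Represents L (certified x u) t (v t)
  rep t _ i = Vec.lookup∘tabulate (λ i → stateOf (certified x u) t (toℕ i)) i

-- Completeness: the array of a solvable level

kindOf sizeOf colourCodeOf directionCodeOf topOf leftOf heightOf widthOf : Block → ℕ
kindOf (gray _)                         = 0
kindOf (coloured _ _ _ _ _ _)           = 1
colourCodeOf (gray _)                   = 0
colourCodeOf (coloured a _ _ _ _ _)     = colourCode a
directionCodeOf (gray _)                = 0
directionCodeOf (coloured _ d _ _ _ _)  = directionCode d
topOf (gray _)                          = 0
topOf (coloured _ _ t _ _ _)            = t
leftOf (gray _)                         = 0
leftOf (coloured _ _ _ l _ _)           = l
heightOf (gray _)                       = 0
heightOf (coloured _ _ _ _ h _)         = h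
widthOf (gray _)                        = 0
widthOf (coloured _ _ _ _ _ w)          = w

cellsOf : Block → List (ℕ × ℕ)
cellsOf (gray ps)              = ps
cellsOf (coloured _ _ _ _ _ _) = []

sizeOf = length ∘ cellsOf

colourOf-code : ∀ a → colourOf (colourCode a) ≡ a
colourOf-code red    = refl
colourOf-code blue   = refl
colourOf-code yellow = refl

directionOf-code : ∀ d → directionOf (directionCode d) ≡ d
directionOf-code up    = refl
directionOf-code down  = refl
directionOf-code left  = refl
directionOf-code right = refl

tileOf-code : ∀ τ → tileOf (tileCode τ) ≡ τ
tileOf-code empty           = refl
tileOf-code wall            = refl
tileOf-code (flower red)    = refl
tileOf-code (flower blue)   = refl
tileOf-code (flower yellow) = refl

code-≤4 : (∀ τ → tileCode τ ≤ 4) × (∀ a → colourCode a ≤ 4) × (∀ d → directionCode d ≤ 4)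
code-≤4 =
  (λ { empty → z≤n ; wall → le {1} ; (flower red) → le {2} ; (flower blue) → le {3} ; (flower yellow) → le {4} }) ,
  (λ { red → z≤n ; blue → le {1} ; yellow → le {2} }) ,
  (λ { up → z≤n ; down → le {1} ; left → le {2} ; right → le {3} })
  where
  le : ∀ {i} {_ : True (i ℕ.≤? 4)} → i ≤ 4
  le {_} {t} = toWitness t

list-applyUpTo : ∀ {A : Set} (as : List A) (f : ℕ → A) → (∀ {j a} → as ! j ≡ just a → f j ≡ a) →
                 as ≡ List.applyUpTo f (length as)
list-applyUpTo []       f h = refl
list-applyUpTo (a ∷ as) f h = cong₂ _∷_ (sym (h {0} refl)) (list-applyUpTo as (f ∘ suc) (λ {j} → h {suc j}))

blockOf-attributes : ∀ (G : Array) i b →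
  G kindTag i 0 ≡ kindOf b → G colourTag i 0 ≡ colourCodeOf b → G directionTag i 0 ≡ directionCodeOf b →
  G topTag i 0 ≡ topOf b → G leftTag i 0 ≡ leftOf b → G heightTag i 0 ≡ heightOf b → G widthTag i 0 ≡ widthOf b →
  G sizeTag i 0 ≡ sizeOf b → (∀ {j a} → cellsOf b ! j ≡ just a → (G cellRowTag i j , G cellColTag i j) ≡ a) →
  b ≡ blockOf G i
blockOf-attributes G i (gray ps) k c d t l h w s cells rewrite k | s = cong gray (list-applyUpTo ps _ cells)
blockOf-attributes G i (coloured a e _ _ _ _) k c d t l h w s cells
  rewrite k | c | d | t | l | h | w | colourOf-code a | directionOf-code e = refl

module _ {A : Set} (f : A → List Bool) where

  offsetOf-≤ : ∀ as j → offsetOf f as j ≤ length (concatMap f as)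
  offsetOf-≤ []       j       = z≤n
  offsetOf-≤ (a ∷ as) zero    = z≤n
  offsetOf-≤ (a ∷ as) (suc j) = subst (length (f a) + offsetOf f as j ≤_) (sym (List.length-++ (f a)))
    (ℕ.+-monoʳ-≤ (length (f a)) (offsetOf-≤ as j))

-- One cell of a block suffices to bound its displacement in `safe⇒tame`.
shape-inhabited : ∀ {b} → ProperShape b → ∃[ p ] (p ∈ footprint b)
shape-inhabited (gray poly) = nonempty poly
  where
  nonempty : ∀ {ps} → Polyomino ps → ∃[ p ] (p ∈ ps)
  nonempty (single p)       = p , here refl
  nonempty (attach {p} _ _) = p , here refl
shape-inhabited (coloured 0<h 0<w) =
  _ , ∈-map⁺ cell (∈-cartesianProduct⁺ (∈-map⁺ _ (∈-upTo⁺ 0<h)) (∈-map⁺ _ (∈-upTo⁺ 0<w)))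

module LevelArray (L : Level) (placed : Placed L) (tr : Safety.Trace L placed) where
  open Level L
  open Game L
  open Safety L placed
  open Trace tr

  gridStart blockStart : ℕ
  gridStart  = length (encodeℕ rows) + length (encodeℕ cols)
  blockStart = gridStart + length (concatMap encodeRow (Vec.toList grid)) + length (encodeℕ (length blocks))

  rowTiles : ℕ → List Tile
  rowTiles r = Maybe.maybe Vec.toList [] (Vec.toList grid ! r)

  tilePos : ℕ → ℕ → ℕ
  tilePos r c = gridStart + offsetOf encodeRow (Vec.toList grid) r + offsetOf encodeTile (rowTiles r) c

  blockPos : ℕ → ℕ
  blockPos i = blockStart + offsetOf encodeBlock blocks i

  onBlock : (Block → ℕ) → ℕ → ℕ
  onBlock f i = Maybe.maybe f 0 (blocks ! i)

  cellPos : ℕ → Block → ℕ → ℕ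
  -- The successor skips the bit that distinguishes gray from coloured blocks.
  cellPos i b j = suc (blockPos i) + length (encodeℕ (sizeOf b)) + offsetOf encodeCell (cellsOf b) j

  cellAt : (ℕ × ℕ → ℕ) → ℕ → Block → ℕ
  cellAt f j b = Maybe.maybe f 0 (cellsOf b ! j)

  onState : (BlockState → ℕ) → ℕ → ℕ → ℕ
  onState f t i = Maybe.maybe f 0 (Vec.toList (state t) ! i)

  entries : Array
  entries rowsTag      _ _ = rows
  entries colsTag      _ _ = cols
  entries countTag     _ _ = length blocks
  entries lastTag      _ _ = size
  entries tileTag      r c = Maybe.maybe tileCode 0 (rowTiles r ! c)
  entries tilePosTag   r c = tilePos r c
  entries blockPosTag  i _ = blockPos i
  entries kindTag      i _ = onBlock kindOf i
  entries colourTag    i _ = onBlock colourCodeOf i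
  entries directionTag i _ = onBlock directionCodeOf i
  entries topTag       i _ = onBlock topOf i
  entries leftTag      i _ = onBlock leftOf i
  entries heightTag    i _ = onBlock heightOf i
  entries widthTag     i _ = onBlock widthOf i
  entries sizeTag      i _ = onBlock sizeOf i
  entries cellRowTag   i j = onBlock (cellAt proj₁ j) i
  entries cellColTag   i j = onBlock (cellAt proj₂ j) i
  entries cellPosTag   i j = onBlock (λ b → cellPos i b j) i
  entries stateRowTag  t i = onState rowOf t i
  entries stateColTag  t i = onState colOf t i
  entries bloomedTag   t i = onState (λ b → if bloomed b then 1 else 0) t i
  entries _            _ _ = 0

-- The certificate is known only through `agree`, so each use of an entry has to bound its indices
-- and its value by `W`. There are 21 tags, shifted displacements stay below twice the input length,
-- and times reach `size`.
module Complete (x u : List Bool) (L : Level) (k : ℕ) (encoded : encode L ≡ x) (wellFormed : Game.WellFormed L)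
  (few : length (Level.blocks L) ≤ k) (tr : Safety.Trace L (Game.WellFormed.placed wellFormed))
  (W : ℕ) (W<N : W < lastPosition x u)
  (agree : ∀ {g a b} → g < W → a < W → b < W →
           LevelArray.entries L (Game.WellFormed.placed wellFormed) tr g a b ≤ W →
           certified x u g a b ≡ LevelArray.entries L (Game.WellFormed.placed wellFormed) tr g a b)
  (input< : length x + length x < W) (size< : Safety.Trace.size tr < W) (tags≤ : 21 ≤ W) where
  open Level L
  open Game L
  open Game.WellFormed wellFormed
  open Grid L
  open Safety L placed
  open LevelArray L placed tr
  open Trace tr

  open Meaning x (lastPosition x u) (certified x u)
  open Spelling x u hiding (N)

  private
    N : ℕ
    N = lastPosition x u
    G : Array
    G = certified x u

  0<W : 0 < W
  0<W = ℕ.≤-trans (s≤s z≤n) tags≤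

  input≤ : ∀ {a} → a ≤ length x → a < W
  input≤ a≤ = ℕ.≤-<-trans (ℕ.≤-trans a≤ (ℕ.m≤m+n _ _)) input<

  entry : ∀ g {_ : True (g ℕ.<? 21)} {a b v} → a < W → b < W → entries g a b ≡ v → v ≤ W → G g a b ≡ v
  entry g {t} {a} {b} a< b< refl v≤ =
    agree (ℕ.≤-trans (toWitness t) tags≤) a< b< v≤

  small : ∀ g {_ : True (g ℕ.<? 21)} {a b v} → a ≤ length x → b ≤ length x → entries g a b ≡ v → v ≤ length x → G g a b ≡ v
  small g {t} a≤ b≤ eq v≤ = entry g {t} (input≤ a≤) (input≤ b≤) eq (ℕ.<⇒≤ (input≤ v≤))

  suc-exact : ∀ {i} → i ≤ length x → N ⊓ suc i ≡ suc i
  suc-exact i≤ = ℕ.m≥n⇒m⊓n≡n (ℕ.≤-trans (input≤ i≤) (ℕ.<⇒≤ W<N))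

  -- Thanks to the unary code, every number of the level is at most the input length and fits into
  -- an entry of the array.
  unary-≤ : ∀ v {p q} → Unary v p q → q ≤ length x → v ≤ length x
  unary-≤ v {p} s q≤ = ℕ.≤-trans
    (ℕ.≤-trans (ℕ.≤-trans (ℕ.≤-reflexive (sym (List.length-replicate v)))
      (ℕ.≤-trans (ℕ.m≤m+n _ 1) (ℕ.≤-reflexive (sym (List.length-++ (List.replicate v true))))))
      (ℕ.≤-trans (ℕ.m≤n+m _ p) (ℕ.≤-reflexive (sym (spells-end (encodeℕ v) s))))) q≤

  start≤ : ∀ v {p q} → Spells x v p q → q ≤ length x → p ≤ length x
  start≤ v {p} s q≤ = ℕ.≤-trans (ℕ.≤-trans (ℕ.m≤m+n p _) (ℕ.≤-reflexive (sym (spells-end v s)))) q≤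

  unary-at : ∀ {v v′ p p′ q q′} → v′ ≡ v → p′ ≡ p → q′ ≡ q → Unary v p q → Holds unaryF (v′ ∷ p′ ∷ q′ ∷ [])
  unary-at refl refl refl s = proj₂ (unary-iff _ _ _) s

  unary-<′ : ∀ v {p q} → Unary v p q → p < q
  unary-<′ zero    (_ , refl) = ℕ.≤-refl
  unary-<′ (suc v) (_ , s)    = ℕ.<-trans ℕ.≤-refl (unary-<′ v s)

  rowList : List (Vec Tile cols)
  rowList = Vec.toList grid

  gridEnd : ℕ
  gridEnd = gridStart + length (concatMap encodeRow rowList)

  whole : Spells x (encode L) 0 (length x)
  whole = subst (λ w → Spells x w 0 (length x)) (sym encoded) (spells-self x)

  after-rows : Spells x (encodeℕ cols ++ concatMap encodeRow rowList ++ encodeList encodeBlock blocks)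
                 (length (encodeℕ rows)) (length x)
  after-rows = proj₂ (spells-split (encodeℕ rows) whole)

  after-cols : Spells x (concatMap encodeRow rowList ++ encodeList encodeBlock blocks) gridStart (length x)
  after-cols = proj₂ (spells-split (encodeℕ cols) after-rows)

  after-grid : Spells x (encodeList encodeBlock blocks) gridEnd (length x)
  after-grid = proj₂ (spells-split (concatMap encodeRow rowList) after-cols)

  rows-code : Unary rows 0 (length (encodeℕ rows))
  rows-code = proj₁ (spells-split (encodeℕ rows) whole)

  cols-code : Unary cols (length (encodeℕ rows)) gridStart
  cols-code = proj₁ (spells-split (encodeℕ cols) after-rows)

  grid-code : Spells x (concatMap encodeRow rowList) gridStart gridEnd
  grid-code = proj₁ (spells-split (concatMap encodeRow rowList) after-cols)

  count-code : Unary (length blocks) gridEnd blockStart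
  count-code = proj₁ (spells-split (encodeℕ (length blocks)) after-grid)

  blocks-code : Spells x (concatMap encodeBlock blocks) blockStart (length x)
  blocks-code = proj₂ (spells-split (encodeℕ (length blocks)) after-grid)

  blockStart≤ : blockStart ≤ length x
  blockStart≤ = start≤ (concatMap encodeBlock blocks) blocks-code ℕ.≤-refl

  gridEnd≤ : gridEnd ≤ length x
  gridEnd≤ = start≤ (encodeℕ (length blocks)) count-code blockStart≤

  gridStart≤ : gridStart ≤ length x
  gridStart≤ = start≤ (concatMap encodeRow rowList) grid-code gridEnd≤

  rows≤ : rows ≤ length x
  rows≤ = unary-≤ rows rows-code (start≤ (encodeℕ cols) cols-code gridStart≤)

  cols≤ : cols ≤ length x
  cols≤ = unary-≤ cols cols-code gridStart≤

  count≤ : length blocks ≤ length x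
  count≤ = unary-≤ (length blocks) count-code blockStart≤

  rowsG : G rowsTag 0 0 ≡ rows
  rowsG = small rowsTag z≤n z≤n refl rows≤

  colsG : G colsTag 0 0 ≡ cols
  colsG = small colsTag z≤n z≤n refl cols≤

  countG : G countTag 0 0 ≡ length blocks
  countG = small countTag z≤n z≤n refl count≤

  lastG : G lastTag 0 0 ≡ size
  lastG = entry lastTag 0<W 0<W refl (ℕ.<⇒≤ size<)

  rowTiles≡ : ∀ {r row} → rowList ! r ≡ just row → rowTiles r ≡ Vec.toList row
  rowTiles≡ eq = cong (Maybe.maybe Vec.toList []) eq

  row-code : ∀ {r row} → rowList ! r ≡ just row →
    Spells x (encodeRow row) (gridStart + offsetOf encodeRow rowList r) (gridStart + offsetOf encodeRow rowList (suc r))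
  row-code eq = spells-items encodeRow rowList grid-code eq

  rowStart≤ : ∀ r → gridStart + offsetOf encodeRow rowList r ≤ length x
  rowStart≤ r = ℕ.≤-trans (ℕ.+-monoʳ-≤ gridStart (offsetOf-≤ encodeRow rowList r)) gridEnd≤

  tilePos≤ : ∀ r c → tilePos r c ≤ length x
  tilePos≤ r c with rowList ! r in eq
  ... | nothing  = ℕ.≤-trans (ℕ.≤-reflexive (ℕ.+-identityʳ _)) (rowStart≤ r)
  ... | just row = ℕ.≤-trans (ℕ.+-monoʳ-≤ _ (offsetOf-≤ encodeTile (Vec.toList row) c))
    (ℕ.≤-trans (ℕ.≤-reflexive (sym (spells-end (encodeRow row) (row-code eq)))) (rowStart≤ (suc r)))

  tilePosG : ∀ {r c} → r ≤ length x → c ≤ length x → G tilePosTag r c ≡ tilePos r c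
  tilePosG {r} {c} r≤ c≤ = small tilePosTag r≤ c≤ refl (tilePos≤ r c)

  tilePos-zero : ∀ r → tilePos r 0 ≡ gridStart + offsetOf encodeRow rowList r
  tilePos-zero r = trans (cong (gridStart + offsetOf encodeRow rowList r +_) (offsetOf-zero encodeTile (rowTiles r))) (ℕ.+-identityʳ _)

  tilePos-start : tilePos 0 0 ≡ gridStart
  tilePos-start = trans (tilePos-zero 0) (trans (cong (gridStart +_) (offsetOf-zero encodeRow rowList)) (ℕ.+-identityʳ _))

  -- `codeF` takes the position of the row after the last one as the place where the number of
  -- blocks is written.
  tilePos-end : tilePos rows 0 ≡ gridEnd
  tilePos-end = trans (tilePos-zero rows) (cong (gridStart +_)
    (trans (cong (offsetOf encodeRow rowList) (sym (Vec.length-toList grid))) (offsetOf-length encodeRow rowList)))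

  tilePos-row : ∀ {r row} → rowList ! r ≡ just row → tilePos r cols ≡ tilePos (suc r) 0
  tilePos-row {r} {row} eq = trans
    (trans (cong (λ ts → gridStart + offsetOf encodeRow rowList r + offsetOf encodeTile ts cols) (rowTiles≡ eq))
      (trans (cong (λ n → gridStart + offsetOf encodeRow rowList r + offsetOf encodeTile (Vec.toList row) n) (sym (Vec.length-toList row)))
        (cong (gridStart + offsetOf encodeRow rowList r +_) (offsetOf-length encodeTile (Vec.toList row)))))
    (trans (sym (spells-end (encodeRow row) (row-code eq))) (sym (tilePos-zero (suc r))))

  tile-code : ∀ {r row c τ} → rowList ! r ≡ just row → Vec.toList row ! c ≡ just τ →
              Spells x (encodeTile τ) (tilePos r c) (tilePos r (suc c))
  tile-code {r} {row} {c} {τ} eq eq′ =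
    subst (λ ts → Spells x (encodeTile τ) (gridStart + offsetOf encodeRow rowList r + offsetOf encodeTile ts c)
                                          (gridStart + offsetOf encodeRow rowList r + offsetOf encodeTile ts (suc c)))
      (sym (rowTiles≡ eq)) (spells-items encodeTile (Vec.toList row) (row-code eq) eq′)

  some-row : ∀ {r} → r < rows → ∃[ row ] (rowList ! r ≡ just row)
  some-row r< = !-total rowList (subst (_ <_) (sym (Vec.length-toList grid)) r<)

  some-tile : ∀ (row : Vec Tile cols) {c} → c < cols → ∃[ τ ] (Vec.toList row ! c ≡ just τ)
  some-tile row c< = !-total (Vec.toList row) (subst (_ <_) (sym (Vec.length-toList row)) c<)

  tileG : ∀ {r row c τ} → r < rows → c < cols → rowList ! r ≡ just row → Vec.toList row ! c ≡ just τ → G tileTag r c ≡ tileCode τ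
  tileG {r} {row} {c} {τ} r< c< eq eq′ = entry tileTag (input≤ (ℕ.≤-trans (ℕ.<⇒≤ r<) rows≤)) (input≤ (ℕ.≤-trans (ℕ.<⇒≤ c<) cols≤))
    (cong (Maybe.maybe tileCode 0) (trans (cong (_! c) (rowTiles≡ eq)) eq′))
    (ℕ.≤-trans (proj₁ code-≤4 τ) (ℕ.≤-trans (toWitness {a? = 4 ℕ.≤? 21} tt) tags≤))

  module BlockCodes {i : ℕ} {b : Block} (at-i : blocks ! i ≡ just b) where

    i<count : i < length blocks
    i<count = !-just blocks at-i

    i≤ : i ≤ length x
    i≤ = ℕ.≤-trans (ℕ.<⇒≤ i<count) count≤

    code : Spells x (encodeBlock b) (blockPos i) (blockPos (suc i))
    code = spells-items encodeBlock blocks blocks-code at-i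

    on≡ : ∀ (f : Block → ℕ) → onBlock f i ≡ f b
    on≡ f = cong (Maybe.maybe f 0) at-i

  blockPos≤ : ∀ i → blockPos i ≤ length x
  blockPos≤ i = ℕ.≤-trans (ℕ.+-monoʳ-≤ blockStart (offsetOf-≤ encodeBlock blocks i))
    (ℕ.≤-reflexive (sym (spells-end (concatMap encodeBlock blocks) blocks-code)))

  blockPosG : ∀ {i} → i ≤ length x → G blockPosTag i 0 ≡ blockPos i
  blockPosG {i} i≤ = small blockPosTag i≤ z≤n refl (blockPos≤ i)

  module GrayCodes {i : ℕ} {ps : List (ℕ × ℕ)} (at-i : blocks ! i ≡ just (gray ps)) where
    open BlockCodes at-i

    cellsStart : ℕ
    cellsStart = suc (blockPos i) + length (encodeℕ (length ps))

    size-code : Unary (length ps) (suc (blockPos i)) cellsStart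
    size-code = proj₁ (spells-split (encodeℕ (length ps)) (proj₂ code))

    cells-code : Spells x (concatMap encodeCell ps) cellsStart (blockPos (suc i))
    cells-code = proj₂ (spells-split (encodeℕ (length ps)) (proj₂ code))

    position : ℕ → ℕ
    position j = cellsStart + offsetOf encodeCell ps j

    position≤ : ∀ j → position j ≤ length x
    position≤ j = ℕ.≤-trans (ℕ.+-monoʳ-≤ cellsStart (offsetOf-≤ encodeCell ps j))
      (ℕ.≤-trans (ℕ.≤-reflexive (sym (spells-end (concatMap encodeCell ps) cells-code))) (blockPos≤ (suc i)))

    size≤ : length ps ≤ length x
    size≤ = unary-≤ (length ps) size-code (ℕ.≤-trans (ℕ.m≤m+n cellsStart 0)
              (ℕ.≤-trans (ℕ.+-monoʳ-≤ cellsStart z≤n) (position≤ 0)))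

    sizeG : G sizeTag i 0 ≡ length ps
    sizeG = small sizeTag i≤ z≤n (on≡ sizeOf) size≤

    positionG : ∀ {j} → j ≤ length x → G cellPosTag i j ≡ position j
    positionG {j} j≤ = small cellPosTag i≤ j≤ (on≡ (λ b → cellPos i b j)) (position≤ j)

    module _ {j r c : ℕ} (at-j : ps ! j ≡ just (r , c)) where

      j< : j < length ps
      j< = !-just ps at-j

      j≤ : j ≤ length x
      j≤ = ℕ.≤-trans (ℕ.<⇒≤ j<) size≤

      cell-code : Spells x (encodeCell (r , c)) (position j) (position (suc j))
      cell-code = spells-items encodeCell ps cells-code at-j

      middle : ℕ
      middle = position j + length (encodeℕ r)

      row-unary : Unary r (position j) middle
      row-unary = proj₁ (spells-split (encodeℕ r) cell-code)

      col-unary : Unary c middle (position (suc j))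
      col-unary = proj₂ (spells-split (encodeℕ r) cell-code)

      rowG : G cellRowTag i j ≡ r
      rowG = small cellRowTag i≤ j≤ (trans (on≡ (cellAt proj₁ j)) (cong (Maybe.maybe proj₁ 0) at-j))
        (unary-≤ r row-unary (start≤ (encodeℕ c) col-unary (position≤ (suc j))))

      colG : G cellColTag i j ≡ c
      colG = small cellColTag i≤ j≤ (trans (on≡ (cellAt proj₂ j)) (cong (Maybe.maybe proj₂ 0) at-j))
        (unary-≤ c col-unary (position≤ (suc j)))

    opaque
      unfolding grayF

      gray-complete : Holds grayF (i ∷ G blockPosTag i 0 ∷ G blockPosTag (N ⊓ suc i) 0 ∷ [])
      gray-complete =
        small kindTag i≤ z≤n (on≡ kindOf) z≤n ,
        trans (cong (x !_) (blockPosG i≤)) (proj₁ code) ,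
        unary-at sizeG (trans (cong (λ p → N ⊓ suc p) (blockPosG i≤)) (suc-exact (blockPos≤ i)))
          (trans (positionG z≤n) (trans (cong (cellsStart +_) (offsetOf-zero encodeCell ps)) (ℕ.+-identityʳ cellsStart))) size-code ,
        item ,
        trans (cong (G cellPosTag i) sizeG) (trans (positionG size≤)
          (trans (cong (cellsStart +_) (offsetOf-length encodeCell ps))
            (trans (sym (spells-end (concatMap encodeCell ps) cells-code))
              (sym (trans (cong (λ n → G blockPosTag n 0) (suc-exact i≤)) (blockPosG (ℕ.≤-trans i<count count≤)))))))
        where
        item : ∀ j → j < G sizeTag i 0 → ∃[ m ] (m < G cellPosTag i (N ⊓ suc j) ×
          Holds unaryF (G cellRowTag i j ∷ G cellPosTag i j ∷ m ∷ []) ×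
          Holds unaryF (G cellColTag i j ∷ m ∷ G cellPosTag i (N ⊓ suc j) ∷ []))
        item j j<G with !-total ps (subst (j <_) sizeG j<G)
        ... | (r , c) , at-j =
          middle at-j , subst (middle at-j <_) (sym next≡) (unary-<′ c (col-unary at-j)) ,
          unary-at (rowG at-j) (positionG (j≤ at-j)) refl (row-unary at-j) ,
          unary-at (colG at-j) refl next≡ (col-unary at-j)
          where
          next≡ : G cellPosTag i (N ⊓ suc j) ≡ position (suc j)
          next≡ = trans (cong (G cellPosTag i) (suc-exact (j≤ at-j))) (positionG (ℕ.≤-trans (j< at-j) size≤))

  module ColouredCodes {i : ℕ} {a d t l h v} (at-i : blocks ! i ≡ just (coloured a d t l h v)) where
    open BlockCodes at-i

    p₁ p₂ p₃ p₄ p₅ q : ℕ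
    p₁ = suc (blockPos i) + length (encodeColour a)
    p₂ = p₁ + length (encodeDirection d)
    p₃ = p₂ + length (encodeℕ t)
    p₄ = p₃ + length (encodeℕ l)
    p₅ = p₄ + length (encodeℕ h)
    q  = blockPos (suc i)

    after₁ : Spells x (encodeDirection d ++ encodeℕ t ++ encodeℕ l ++ encodeℕ h ++ encodeℕ v) p₁ q
    after₁ = proj₂ (spells-split (encodeColour a) (proj₂ code))
    after₂ : Spells x (encodeℕ t ++ encodeℕ l ++ encodeℕ h ++ encodeℕ v) p₂ q
    after₂ = proj₂ (spells-split (encodeDirection d) after₁)
    after₃ : Spells x (encodeℕ l ++ encodeℕ h ++ encodeℕ v) p₃ q
    after₃ = proj₂ (spells-split (encodeℕ t) after₂)
    after₄ : Spells x (encodeℕ h ++ encodeℕ v) p₄ q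
    after₄ = proj₂ (spells-split (encodeℕ l) after₃)
    width-code : Unary v p₅ q
    width-code = proj₂ (spells-split (encodeℕ h) after₄)
    height-code : Unary h p₄ p₅
    height-code = proj₁ (spells-split (encodeℕ h) after₄)
    left-code : Unary l p₃ p₄
    left-code = proj₁ (spells-split (encodeℕ l) after₃)
    top-code : Unary t p₂ p₃
    top-code = proj₁ (spells-split (encodeℕ t) after₂)
    direction-code : Spells x (encodeDirection d) p₁ p₂
    direction-code = proj₁ (spells-split (encodeDirection d) after₁)
    colour-code : Spells x (encodeColour a) (suc (blockPos i)) p₁
    colour-code = proj₁ (spells-split (encodeColour a) (proj₂ code))

    p₅≤ : p₅ ≤ length x
    p₅≤ = start≤ (encodeℕ v) width-code (blockPos≤ (suc i))
    p₄≤ : p₄ ≤ length x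
    p₄≤ = start≤ (encodeℕ h) height-code p₅≤
    p₃≤ : p₃ ≤ length x
    p₃≤ = start≤ (encodeℕ l) left-code p₄≤

    code≤W : ∀ {n} → n ≤ 4 → n ≤ W
    code≤W n≤4 = ℕ.≤-trans n≤4 (ℕ.≤-trans (toWitness {a? = 4 ℕ.≤? 21} tt) tags≤)

    kindG : G kindTag i 0 ≡ 1
    kindG = entry kindTag (input≤ i≤) 0<W (on≡ kindOf) 0<W
    colourG : G colourTag i 0 ≡ colourCode a
    colourG = entry colourTag (input≤ i≤) 0<W (on≡ colourCodeOf) (code≤W (proj₁ (proj₂ code-≤4) a))
    directionG : G directionTag i 0 ≡ directionCode d
    directionG = entry directionTag (input≤ i≤) 0<W (on≡ directionCodeOf) (code≤W (proj₂ (proj₂ code-≤4) d))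
    topG : G topTag i 0 ≡ t
    topG = small topTag i≤ z≤n (on≡ topOf) (unary-≤ t top-code p₃≤)
    leftG : G leftTag i 0 ≡ l
    leftG = small leftTag i≤ z≤n (on≡ leftOf) (unary-≤ l left-code p₄≤)
    heightG : G heightTag i 0 ≡ h
    heightG = small heightTag i≤ z≤n (on≡ heightOf) (unary-≤ h height-code p₅≤)
    widthG : G widthTag i 0 ≡ v
    widthG = small widthTag i≤ z≤n (on≡ widthOf) (unary-≤ v width-code (blockPos≤ (suc i)))

    opaque
      unfolding grayF

      coloured-complete : Holds colouredF (i ∷ G blockPosTag i 0 ∷ G blockPosTag (N ⊓ suc i) 0 ∷ [])
      coloured-complete =
        kindG ,
        trans (cong (x !_) (blockPosG i≤)) (proj₁ code) ,
        p₅ , subst (p₅ <_) (sym next≡) (unary-<′ v width-code) , unary-at widthG refl next≡ width-code ,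
        p₄ , unary-<′ h height-code , unary-at heightG refl refl height-code ,
        p₃ , unary-<′ l left-code , unary-at leftG refl refl left-code ,
        p₂ , unary-<′ t top-code , unary-at topG refl refl top-code ,
        p₁ , direction-< d ,
        subst (λ n → Holds directionCodeF (n ∷ p₁ ∷ p₂ ∷ [])) (sym directionG) (directionCode-complete d p₁ p₂ direction-code) ,
        subst₂ (λ n p → Holds colourCodeF (n ∷ p ∷ p₁ ∷ [])) (sym colourG)
          (sym (trans (cong (λ p → N ⊓ suc p) (blockPosG i≤)) (suc-exact (blockPos≤ i))))
          (colourCode-complete a (suc (blockPos i)) p₁ colour-code)
        where
        next≡ : G blockPosTag (N ⊓ suc i) 0 ≡ q
        next≡ = trans (cong (λ n → G blockPosTag n 0) (suc-exact i≤)) (blockPosG (ℕ.≤-trans i<count count≤))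
        direction-< : ∀ d → p₁ < p₁ + length (encodeDirection d)
        direction-< up    = ℕ.m<m+n p₁ (s≤s z≤n)
        direction-< down  = ℕ.m<m+n p₁ (s≤s z≤n)
        direction-< left  = ℕ.m<m+n p₁ (s≤s z≤n)
        direction-< right = ℕ.m<m+n p₁ (s≤s z≤n)

  tile-at : ∀ {r row c τ} → rowList ! r ≡ just row → Vec.toList row ! c ≡ just τ → tileAt (cell (r , c)) ≡ just τ
  tile-at {r} {row} {c} eq eq′ rewrite !-toList grid r | eq = trans (!-toList row c) eq′

  described-block : ∀ b {i} → blocks ! i ≡ just b → b ≡ blockOf G i
  described-block b@(gray ps) {i} at-i = blockOf-attributes G i b
    (small kindTag i≤ z≤n (on≡ kindOf) z≤n) (small colourTag i≤ z≤n (on≡ colourCodeOf) z≤n)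
    (small directionTag i≤ z≤n (on≡ directionCodeOf) z≤n) (small topTag i≤ z≤n (on≡ topOf) z≤n)
    (small leftTag i≤ z≤n (on≡ leftOf) z≤n) (small heightTag i≤ z≤n (on≡ heightOf) z≤n)
    (small widthTag i≤ z≤n (on≡ widthOf) z≤n)
    sizeG (λ at-j → cong₂ _,_ (rowG at-j) (colG at-j))
    where
    open BlockCodes at-i
    open GrayCodes at-i
  described-block b@(coloured a d t l h v) {i} at-i = blockOf-attributes G i b
    kindG colourG directionG topG leftG heightG widthG (small sizeTag i≤ z≤n (on≡ sizeOf) z≤n) (λ ())
    where
    open BlockCodes at-i
    open ColouredCodes at-i

  described : Describes L G
  described = record
    { rows≡ = rowsG ; cols≡ = colsG ; count≡ = countG ; tile≡ = tile
    ; block≡ = λ i → described-block (block i) (!-lookup blocks i) }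
    where
    tile : ∀ {r c} → r < rows → c < cols → tileAt (cell (r , c)) ≡ just (tileOf (G tileTag r c))
    tile {r} {c} r< c< with some-row r<
    ... | row , eq with some-tile row c<
    ...   | τ , eq′ = trans (tile-at eq eq′)
      (cong just (trans (sym (tileOf-code τ)) (cong tileOf (sym (tileG r< c< eq eq′)))))

  opaque
    unfolding codeF

    code-complete : Holds codeF []
    code-complete =
      (length (encodeℕ rows) ,
       subst (length (encodeℕ rows) <_) (sym start≡) (unary-<′ cols cols-code) ,
       unary-at rowsG refl refl rows-code ,
       unary-at colsG refl start≡ cols-code) ,
      rows-codes ,
      unary-at countG
        (trans (cong (λ r → G tilePosTag r 0) rowsG) (trans (tilePosG rows≤ z≤n) tilePos-end))
        (trans (blockPosG z≤n) (trans (cong (blockStart +_) (offsetOf-zero encodeBlock blocks)) (ℕ.+-identityʳ _)))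
        count-code ,
      blocks-codes ,
      (λ h → beyond h) , (λ h → beyond h)
      where
      start≡ : G tilePosTag 0 0 ≡ gridStart
      start≡ = trans (tilePosG z≤n z≤n) tilePos-start
      rows-codes : ∀ r → r < G rowsTag 0 0 →
        (∀ c → c < G colsTag 0 0 → Holds tileCodeF (G tileTag r c ∷ G tilePosTag r c ∷ G tilePosTag r (N ⊓ suc c) ∷ [])) ×
        G tilePosTag r (G colsTag 0 0) ≡ G tilePosTag (N ⊓ suc r) 0
      rows-codes r r<G with subst (r <_) rowsG r<G
      ... | r< with some-row r<
      ...   | row , eq = tiles , trans (cong (G tilePosTag r) colsG) (trans (tilePosG r≤ cols≤) (trans (tilePos-row eq)
          (sym (trans (cong (λ s → G tilePosTag s 0) (suc-exact r≤)) (tilePosG (ℕ.≤-trans r< rows≤) z≤n)))))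
        where
        r≤ : r ≤ length x
        r≤ = ℕ.≤-trans (ℕ.<⇒≤ r<) rows≤
        tiles : ∀ c → c < G colsTag 0 0 → Holds tileCodeF (G tileTag r c ∷ G tilePosTag r c ∷ G tilePosTag r (N ⊓ suc c) ∷ [])
        tiles c c<G with subst (c <_) colsG c<G
        ... | c< with some-tile row c<
        ...   | τ , eq′
            rewrite suc-exact {c} (ℕ.≤-trans (ℕ.<⇒≤ c<) cols≤) | tileG r< c< eq eq′
                  | tilePosG {r} {c} r≤ (ℕ.≤-trans (ℕ.<⇒≤ c<) cols≤)
                  | tilePosG {r} {suc c} r≤ (ℕ.≤-trans c< cols≤) =
          tileCode-complete τ _ _ (tile-code eq eq′)
      blocks-codes : ∀ i → i < G countTag 0 0 →
        Holds grayF (i ∷ G blockPosTag i 0 ∷ G blockPosTag (N ⊓ suc i) 0 ∷ []) ⊎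
        Holds colouredF (i ∷ G blockPosTag i 0 ∷ G blockPosTag (N ⊓ suc i) 0 ∷ [])
      blocks-codes i i<G with !-total blocks (subst (i <_) countG i<G)
      ... | gray ps , at-i = inj₁ (GrayCodes.gray-complete at-i)
      ... | coloured _ _ _ _ _ _ , at-i = inj₂ (ColouredCodes.coloured-complete at-i)
      beyond : ∀ {b} → ¬ (x ! G blockPosTag (G countTag 0 0) 0 ≡ just b)
      beyond h = ℕ.<-irrefl end≡ (!-just x h)
        where
        end≡ : G blockPosTag (G countTag 0 0) 0 ≡ length x
        end≡ = trans (cong (λ n → G blockPosTag n 0) countG) (trans (blockPosG count≤)
          (trans (cong (blockStart +_) (offsetOf-length encodeBlock blocks))
            (sym (spells-end (concatMap encodeBlock blocks) blocks-code))))

  !-state : ∀ {n} (as : Vec BlockState n) i → Vec.toList as ! toℕ i ≡ just (lookup as i)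
  !-state (a ∷ as) zero    = refl
  !-state (a ∷ as) (suc i) = !-state as i

  represents : ∀ t → t ≤ size → Represents L G t (state t)
  represents t t≤ i = proj₁ iff-blockState (place , flag)
    where
    b : BlockState
    b = lookup (state t) i
    open Tame (safe⇒tame {state t} (λ i → shape-inhabited (shapes i)) (trace-safe tr t t≤) i)
    on≡ : ∀ (f : BlockState → ℕ) → onState f t (toℕ i) ≡ f b
    on≡ f = cong (Maybe.maybe f 0) (!-state (state t) i)
    t<W : t < W
    t<W = ℕ.≤-<-trans t≤ size<
    i<W : toℕ i < W
    i<W = input≤ (ℕ.≤-trans (ℕ.<⇒≤ (toℕ<n i)) count≤)
    double : ∀ {n m} → n < m + m → m ≤ length x → n ≤ W
    double n< m≤ = ℕ.<⇒≤ (ℕ.<-trans (ℕ.<-≤-trans n< (ℕ.+-mono-≤ m≤ m≤)) input<)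
    place : displacement b ≡ cell (G stateRowTag t (toℕ i) , G stateColTag t (toℕ i)) +ᶜ offset G
    place
      rewrite entry stateRowTag t<W i<W (on≡ rowOf) (double row< rows≤)
            | entry stateColTag t<W i<W (on≡ colOf) (double col< cols≤) | rowsG | colsG =
      cong₂ _,_ row≡ col≡
    flag : bloomed b ≡ isPositive (G bloomedTag t (toℕ i))
    flag = trans (positive (bloomed b))
      (cong isPositive (sym (entry bloomedTag t<W i<W (on≡ (λ b → if bloomed b then 1 else 0)) (bit≤ (bloomed b)))))
      where
      positive : ∀ c → c ≡ isPositive (if c then 1 else 0)
      positive true  = refl
      positive false = refl
      bit≤ : ∀ c → (if c then 1 else 0) ≤ W
      bit≤ true  = 0<W
      bit≤ false = z≤n

  accept-complete : Holds (acceptF k) []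
  accept-complete =
    code-complete ,
    proj₂ (WellFormedness.wellFormed-iff x u L described) wellFormed ,
    proj₂ (few-iff x u k) (subst (_≤ k) (sym countG) few) ,
    PathCorrect.path-complete x u L described k few placed state
      (λ t t≤ → represents t (subst (t ≤_) lastG t≤)) tr (sym lastG) (λ t → refl)

-- Size of the certificate, and membership in NP

powᵖ : Polynomial → ℕ → Polynomial
powᵖ p zero    = con 1
powᵖ p (suc k) = p ⊗ powᵖ p k

pow-value : ∀ p k n → ⟦ powᵖ p k ⟧ n ≡ ⟦ p ⟧ n ^ k
pow-value p zero    n = refl
pow-value p (suc k) n = cong (⟦ p ⟧ n *_) (pow-value p k n)

-- With `D` twice the input length, `statesᵖ` is `blockCodes` to the power `k`. The width exceeds
-- `D`, the length of a short trace and the number of tags; the certificate consists of the prefix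
-- of length `1 + W` and of `W` to the fourth bits.
statesᵖ widthᵖ certificateᵖ : ℕ → Polynomial
statesᵖ k      = powᵖ (((con 1 ⊕ (var ⊕ var)) ⊗ (con 1 ⊕ (var ⊕ var))) ⊗ con 2) k
widthᵖ k       = con 1 ⊕ ((var ⊕ var) ⊕ (statesᵖ k ⊕ con 21))
certificateᵖ k = (con 1 ⊕ widthᵖ k) ⊕ (((widthᵖ k ⊗ widthᵖ k) ⊗ widthᵖ k) ⊗ widthᵖ k)

length-encodeℕ : ∀ n → n ≤ length (encodeℕ n)
length-encodeℕ zero    = z≤n
length-encodeℕ (suc n) = s≤s (length-encodeℕ n)

length-left : ∀ (v w : List Bool) → length v ≤ length (v ++ w)
length-left v w = ℕ.≤-trans (ℕ.m≤m+n _ _) (ℕ.≤-reflexive (sym (List.length-++ v)))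

length-right : ∀ (v w : List Bool) → length w ≤ length (v ++ w)
length-right v w = ℕ.≤-trans (ℕ.m≤n+m _ (length v)) (ℕ.≤-reflexive (sym (List.length-++ v)))

module _ (L : Level) where
  open Level L

  rows≤length : rows ≤ length (encode L)
  rows≤length = ℕ.≤-trans (length-encodeℕ rows) (length-left (encodeℕ rows) _)

  cols≤length : cols ≤ length (encode L)
  cols≤length = ℕ.≤-trans (length-encodeℕ cols)
    (ℕ.≤-trans (length-left (encodeℕ cols) _) (length-right (encodeℕ rows) _))

certificate : ∀ k x → Hanano≤ k x → ∃[ u ] (length u ≤ ⟦ certificateᵖ k ⟧ (length x) ×
  Meaning.Holds x (lastPosition x u) (certified x u) (acceptF k) [])
certificate k x (L , encoded , wellFormed , few , solvable) =
  u , ℕ.≤-reflexive (Table.length-table w entries) ,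
  Complete.accept-complete x u L k encoded wellFormed few tr W (Table.W<N w entries x)
    (Table.certified-table w entries x) input< size< tags≤
  where
  open Level L
  open Game.WellFormed wellFormed
  open Safety L placed using (Trace; solvable⇒trace; module Codes)
  D : ℕ
  D = length x + length x
  twice≤ : ∀ {m} → m ≤ length (encode L) → m + m ≤ suc D
  twice≤ m≤ = ℕ.m≤n⇒m≤1+n (ℕ.+-mono-≤ m≤x m≤x)
    where m≤x = ℕ.≤-trans m≤ (ℕ.≤-reflexive (cong length encoded))
  open Codes D (twice≤ (rows≤length L)) (twice≤ (cols≤length L))
  nonempty : ∀ i → ∃[ p ] (p ∈ footprint (Game.block L i))
  nonempty i = shape-inhabited (shapes i)
  short : Σ[ tr ∈ Trace ] Trace.size tr < blockCodes ^ length blocks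
  short = short-trace nonempty (solvable⇒trace solvable)
  tr : Trace
  tr = proj₁ short
  open LevelArray L placed tr using (entries)
  w W : ℕ
  w = D + (⟦ statesᵖ k ⟧ (length x) + 21)
  W = suc w
  u : List Bool
  u = Table.table w entries
  input< : D < W
  input< = s≤s (ℕ.m≤m+n D _)
  size< : Trace.size tr < W
  -- Raising the exponent from the number of blocks to the fixed `k` turns the bound on the trace
  -- into a polynomial.
  size< = ℕ.≤-trans (proj₂ short) (ℕ.≤-trans (ℕ.^-monoʳ-≤ blockCodes few)
    (ℕ.≤-trans (ℕ.≤-reflexive (sym (pow-value _ k (length x))))
      (ℕ.≤-trans (ℕ.m≤m+n _ 21) (ℕ.≤-trans (ℕ.m≤n+m _ D) (ℕ.n≤1+n w)))))
  tags≤ : 21 ≤ W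
  tags≤ = ℕ.≤-trans (ℕ.m≤n+m 21 (⟦ statesᵖ k ⟧ (length x))) (ℕ.≤-trans (ℕ.m≤n+m _ D) (ℕ.n≤1+n w))

truth-positive : ∀ {P v} → Truth P v → (isPositive v ≡ true) ⟺ P
truth-positive (holds p)  = (λ _ → p) , (λ _ → refl)
truth-positive (fails ¬p) = (λ ()) , (λ p → contradiction p ¬p)

-- One equation between the verdict and a total Boolean function yields both that the verifier halts
-- and that it verifies.
decided⇒NP : ∀ {A : List Bool → Set} (machine : TuringMachine) (time size : Polynomial)
  (decides : List Bool → List Bool → Bool) →
  (∀ x u → TuringMachine.run machine (⟦ time ⟧ (length x + length u)) x u ≡ just (decides x u)) →
  (∀ x → A x ⟺ (∃[ u ] (length u ≤ ⟦ size ⟧ (length x) × decides x u ≡ true))) → NP A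
decided⇒NP machine time size decides runs A-iff = record
  { verifier         = machine
  ; timeBound        = time
  ; certificateBound = size
  ; halts            = λ x u → decides x u , runs x u
  ; verifies         = λ x → mk⇔
      (λ a → let (u , short , yes′) = proj₁ (A-iff x) a in u , short , trans (runs x u) (cong just yes′))
      (λ (u , short , run≡) → proj₂ (A-iff x) (u , short , just-injective (trans (sym (runs x u)) run≡)))
  }

theorem3 : (k : ℕ) → NP (Hanano≤ k)
theorem3 k = decided⇒NP decider deciderTime (certificateᵖ k)
  (λ x u → isPositive (Evaluation.eval x u (formulaTerm φ) [])) decider-correct λ x →
    (λ h → let (u , short , accepted) = certificate k x h in u , short , proj₂ (positive-iff x u) accepted) ,
    (λ (u , _ , positive) → accept-sound x u k (proj₁ (positive-iff x u) positive))
  where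
  φ : Formula 0
  φ = acceptF k
  open Decider (formulaTerm φ)
  positive-iff : ∀ x u → (isPositive (Evaluation.eval x u (formulaTerm φ) []) ≡ true) ⟺
                         Meaning.Holds x (lastPosition x u) (certified x u) φ []
  positive-iff x u = truth-positive (Translation.truth-formula x u φ [])
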